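{- Let $b_1,\dots,b_n$ be a finite sequence of positive integers and $c$ a positive integer. Let $t=3+\sum_{i=1}^n b_i$, $k=\mathrm{lcm}(b_1,\dots,b_n,c)$, and let $q_0$ be the smallest positive integer such that $q_0k^{ -t}-(t-1-t/k+k^{ -t})\sqrt{q_0}-t/k>1$. Let $q$ be a prime power with $k\mid(q-1)$ and $q\ge q_0$. Then for any orthomorphisms $\theta_1,\dots,\theta_n$ over $\mathbb{F}_q$ with $\theta_i\in\mathscr{C}_{b_i}(q)$ for $1\le i\le n$, there exists a near-linear strong orthomorphism $\phi\in\mathscr{D}_c(q)$ which is orthogonal to each of $\theta_1,\dots,\theta_n$.
   Context: Let $\mathbb{F}_q$ be the finite field of order $q$. An orthomorphism is a permutation $\theta$ of $\mathbb{F}_q$ such that $x\mapsto\theta(x)-x$ is also a permutation; it is a strong orthomorphism if moreover $x\mapsto\theta(x)+x$ is a permutation. Two orthomorphisms $\theta,\theta'$ are orthogonal if $x\mapsto\theta(x)-\theta'(x)$ is a permutation. For $k\mid(q-1)$, fix a generator $g$ of $\mathbb{F}_q^*$ and let $C_{k,i}=\{g^j: j\equiv i\pmod k\}$, $0\le i<k$. A cyclotomic map of index $k$ with multipliers $[a_0,\dots,a_{k-1}]$ is $\theta(0)=0$, $\theta(x)=a_ix$ for $x\in C_{k,i}$. $\mathscr{C}_k(q)$ is the set of orthomorphisms that are cyclotomic maps of index $k$, and $\mathscr{D}_k(q)=\mathscr{C}_k(q)\setminus\bigcup_{\ell<k,\ \ell\mid(q-1)}\mathscr{C}_\ell(q)$.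 An element of $\mathscr{C}_k(q)$ with multipliers $[a_0,\dots,a_{k-1}]$ is near-linear if $a_0\neq a_1=\cdots=a_{k-1}$. -}

module Defs where

open import Level using (0ℓ)
open import Data.Nat as ℕ using (ℕ; zero; suc)
open import Data.Nat.LCM using (lcm)
open import Data.Integer as ℤ using (ℤ; +_)
open import Data.Fin using (Fin; toℕ)
open import Data.Product using (Σ; ∃; _×_; _,_)
open import Relation.Nullary using (¬_)
open import Relation.Binary.PropositionalEquality using (_≡_; _≢_)
open import Algebra.Structures using (IsCommutativeRing)
open import Function.Bundles using (_↔_)

-- A finite field (with propositional equality) with an explicit
-- bijection to Fin size.  Its order `size` is then automatically a
-- prime power.

record FiniteField : Set₁ where
  infixl 7 _*_
  infixl 6 _+_ _-_
  field
    Carrier : Set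
    _+_ _*_ : Carrier → Carrier → Carrier
    -_      : Carrier → Carrier
    0# 1#   : Carrier
    isCommutativeRing : IsCommutativeRing _≡_ _+_ _*_ -_ 0# 1#
    0≢1     : 0# ≢ 1#
    inverse : ∀ x → x ≢ 0# → ∃ λ y → x * y ≡ 1#
    size    : ℕ
    enum    : Carrier ↔ Fin size

  _-_ : Carrier → Carrier → Carrier
  x - y = x + (- y)

  _^_ : Carrier → ℕ → Carrier
  x ^ zero  = 1#
  x ^ suc n = x * (x ^ n)

module _ (F : FiniteField) where
  open FiniteField F

  IsPerm : (Carrier → Carrier) → Set
  IsPerm f = (∀ x y → f x ≡ f y → x ≡ y) × (∀ y → ∃ λ x → f x ≡ y)

  IsOrthomorphism : (Carrier → Carrier) → Set
  IsOrthomorphism θ = IsPerm θ × IsPerm (λ x → θ x - x)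

  IsStrongOrthomorphism : (Carrier → Carrier) → Set
  IsStrongOrthomorphism θ = IsOrthomorphism θ × IsPerm (λ x → θ x + x)

  Orthogonal : (Carrier → Carrier) → (Carrier → Carrier) → Set
  Orthogonal θ θ' = IsPerm (λ x → θ x - θ' x)

  IsGenerator : Carrier → Set
  IsGenerator g = ∀ x → x ≢ 0# → ∃ λ j → g ^ j ≡ x

  CyclotomicWith : Carrier → (k : ℕ) → (Fin k → Carrier) → (Carrier → Carrier) → Set
  CyclotomicWith g k a θ =
    θ 0# ≡ 0# ×
    (∀ (i : Fin k) (m : ℕ) →
      θ (g ^ (toℕ i ℕ.+ m ℕ.* k)) ≡ a i * g ^ (toℕ i ℕ.+ m ℕ.* k))

  InC : Carrier → ℕ → (Carrier → Carrier) → Set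
  InC g k θ = IsOrthomorphism θ × ∃ λ a → CyclotomicWith g k a θ

  InD : Carrier → ℕ → (Carrier → Carrier) → Set
  InD g k θ = InC g k θ ×
    (∀ ℓ → 0 ℕ.< ℓ → ℓ ℕ.< k → ℓ Data.Nat.Divisibility.∣ (size ℕ.∸ 1) → ¬ InC g ℓ θ)
    where import Data.Nat.Divisibility

  NearLinear : Carrier → ℕ → (Carrier → Carrier) → Set
  NearLinear g k θ = ∃ λ (a : Fin k → Carrier) → CyclotomicWith g k a θ ×
    (∀ i j → toℕ i ≢ 0 → toℕ j ≢ 0 → a i ≡ a j) ×
    (∀ i j → toℕ i ≡ 0 → toℕ j ≢ 0 → a i ≢ a j)

sumF : ∀ n → (Fin n → ℕ) → ℕ
sumF zero    b = 0
sumF (suc n) b = b Fin.zero ℕ.+ sumF n (λ i → b (Fin.suc i))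
  where import Data.Fin as Fin

lcmF : ∀ n → (Fin n → ℕ) → ℕ → ℕ
lcmF zero    b c = c
lcmF (suc n) b c = lcm (b Fin.zero) (lcmF n (λ i → b (Fin.suc i)) c)
  where import Data.Fin as Fin

-- BoundHolds t k m  encodes the real inequality
--   m k^{-t} - (t - 1 - t/k + k^{-t}) √m - t/k > 1
-- (for k ≥ 1, t ≥ 1) after multiplying by K = k^t > 0:
--   L > B √m  with  L = m - t k^{t-1} - K,  B = tK - K - t k^{t-1} + 1 ≥ 0,
-- which (as B ≥ 0) is equivalent to  L > 0  and  B² m < L².
BoundHolds : ℕ → ℕ → ℕ → Set
BoundHolds t k m = (+ 0 ℤ.< L) × (B ℤ.* B ℤ.* + m ℤ.< L ℤ.* L)
  where
    K T : ℕ
    K = k ℕ.^ t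
    T = t ℕ.* k ℕ.^ (t ℕ.∸ 1)
    L B : ℤ
    L = + m ℤ.- + T ℤ.- + K
    B = + (t ℕ.* K) ℤ.- + K ℤ.- + T ℤ.+ + 1

{-# OPTIONS --safe #-}

-- Call two field elements equivalent when they lie in the same class of F* modulo k-th powers. If a ≠ b are
-- equivalent, a − 1 ~ b − 1, a + 1 ~ b + 1, and a − e and b − e are k-th powers for every multiplier e of every θᵢ,
-- then the cyclotomic map with multipliers [a, b, …, b] is as required. By the pigeonhole principle it is enough to
-- find more than k³ + 3 elements a for which all a − e are k-th powers.
--
-- These are counted by averaging a weight on ℤ/k over all characters ψ of the vector of indices of the a − e; for
-- ψ ≠ 0 of order d, Stepanov's method bounds each of the d classes of elements cut out by ψ by q/d + O(√q). The
-- auxiliary polynomial Σ λ x^(qi + a) y_j, where y_j = Π (1 − δₑx)^((q − 1) r_j(e) / k), is nonzero because the power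
-- series Π (1 − δₑx)^(−r_j(e) / k), to which y_j is congruent modulo x^q, are linearly independent over F[x]:
-- raising a relation of minimal length to the q-th power gives a relation between the same series, hence a
-- proportional one, and comparing orders at 1/δₑ shows that it has a single term.
module Submission where

open import Defs
open import Level using (0ℓ)
open import Algebra.Bundles using (CommutativeMonoid; CommutativeRing)
import Algebra.Properties.CommutativeSemiring.Exp
import Algebra.Properties.Ring
open import Data.Nat
import Data.Nat.Properties as ℕ
open import Data.Nat.Divisibility using (_∣_; divides)
open import Data.Nat.DivMod using (_/_; _%_)
import Data.Nat.DivMod as ℕ
import Data.Nat.Divisibility as ℕ
import Data.Nat.Solver
import Data.Nat.GCD as ℕ
open import Data.Nat.GCD using (gcd)
import Data.Nat.LCM as ℕ
open import Data.Nat.Primality using (Prime; prime?; euclidsLemma)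
import Data.Nat.Primality as ℕ
open import Data.Nat.Primality.Factorisation using (factorise)
open import Data.Integer as ℤ using (ℤ; 0ℤ; 1ℤ; -1ℤ)
import Data.Integer.Properties as ℤ
import Data.Integer.Solver
open import Data.Fin using (Fin)
import Data.Fin as Fin
import Data.Fin.Properties as Fin
open import Data.List using (List; []; _∷_; length; map; filter; allFin; applyUpTo; _++_; deduplicate)
import Data.List.Properties as List
open import Data.List.Membership.Propositional using (_∈_)
open import Data.List.Relation.Unary.All as All using ([]; _∷_)
open import Data.List.Relation.Unary.AllPairs using ([]; _∷_)
import Data.List.Membership.Propositional.Properties as ∈
import Data.List.Relation.Unary.Unique.Propositional.Properties as Unique
open import Data.List.Relation.Unary.Any using (here; there)
open import Data.List.Relation.Unary.Unique.Propositional using (Unique)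
open import Data.Empty using (⊥; ⊥-elim)
open import Data.Unit using (⊤; tt)
open import Data.Product using (∃; _×_; _,_; proj₁; proj₂)
open import Data.Sum using (_⊎_; inj₁; inj₂)
open import Function using (_∘_; it; Inverse)
open import Relation.Nullary using (¬_; ¬?; Dec; yes; no)
open import Relation.Nullary.Negation using (contradiction)
open import Relation.Binary.PropositionalEquality using (_≡_; _≢_; refl; sym; trans; cong; cong₂; subst; subst₂; module ≡-Reasoning)
import Relation.Binary.Reasoning.Setoid as SetoidReasoning
open import Relation.Binary.Definitions using (tri<; tri≈; tri>)
import Data.List.Relation.Unary.Unique.DecPropositional.Properties

-- Why the numerical hypothesis suffices: its exponent `t` exceeds the number S of multipliers by
-- three. Only the S conditions on a - e are counted through characters; those on a, a - 1 and a + 1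
-- are left to the pigeonhole principle, and the powers of k saved in this way pay for the constant
-- in Stepanov's bound. For k = 2 the comparison is tight.
--
-- Why this weight: Stepanov's method bounds classes from above only. Since the weight is at most 1,
-- its complement to 1 is nonnegative, so upper bounds alone give a lower bound for the count, with
-- integers in place of complex characters.
--
-- Why power series: the field is given without its characteristic, and neither a prime p nor
-- binomial coefficients occur. Additivity of the q-th power is deduced from x^q = x by counting
-- roots. Derivatives, which lose information in positive characteristic, are replaced by
-- substituting a curve x + R(x)τ into a polynomial: the order in τ of the result is the
-- multiplicity of the root x.

ifDec : ∀ {P A : Set} → Dec P → A → A → A
ifDec (yes _) x y = x
ifDec (no _)  x y = y

ifDec-yes : ∀ {P A : Set} (P? : Dec P) {x y : A} → P → ifDec P? x y ≡ x
ifDec-yes (yes _) p = refl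
ifDec-yes (no ¬p) p = contradiction p ¬p

ifDec-no : ∀ {P A : Set} (P? : Dec P) {x y : A} → ¬ P → ifDec P? x y ≡ y
ifDec-no (yes p) ¬p = contradiction p ¬p
ifDec-no (no _)  ¬p = refl

-- Finite sums and products over initial segments of ℕ

module PrefixSum (M : CommutativeMonoid 0ℓ 0ℓ) where
  open CommutativeMonoid M renaming (refl to ≈-refl; sym to ≈-sym; trans to ≈-trans)
  open SetoidReasoning setoid

  ∑ : ℕ → (ℕ → Carrier) → Carrier
  ∑ zero    f = ε
  ∑ (suc n) f = ∑ n f ∙ f n

  ∑-cong : ∀ n {f g : ℕ → Carrier} → (∀ i → i < n → f i ≈ g i) → ∑ n f ≈ ∑ n g
  ∑-cong zero    eq = ≈-refl
  ∑-cong (suc n) eq = ∙-cong (∑-cong n λ i i<n → eq i (ℕ.m<n⇒m<1+n i<n)) (eq n ℕ.≤-refl)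

  ∑-ε : ∀ n {f : ℕ → Carrier} → (∀ i → i < n → f i ≈ ε) → ∑ n f ≈ ε
  ∑-ε zero    eq = ≈-refl
  ∑-ε (suc n) eq = ≈-trans (∙-cong (∑-ε n λ i i<n → eq i (ℕ.m<n⇒m<1+n i<n)) (eq n ℕ.≤-refl)) (identityˡ ε)

  interchange : ∀ a b c d → (a ∙ b) ∙ (c ∙ d) ≈ (a ∙ c) ∙ (b ∙ d)
  interchange a b c d = begin
    (a ∙ b) ∙ (c ∙ d)  ≈⟨ assoc a b (c ∙ d) ⟩
    a ∙ (b ∙ (c ∙ d))  ≈⟨ ∙-congˡ (≈-sym (assoc b c d)) ⟩
    a ∙ ((b ∙ c) ∙ d)  ≈⟨ ∙-congˡ (∙-congʳ (comm b c)) ⟩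
    a ∙ ((c ∙ b) ∙ d)  ≈⟨ ∙-congˡ (assoc c b d) ⟩
    a ∙ (c ∙ (b ∙ d))  ≈⟨ ≈-sym (assoc a c (b ∙ d)) ⟩
    (a ∙ c) ∙ (b ∙ d)  ∎

  ∑-∙ : ∀ n (f g : ℕ → Carrier) → ∑ n (λ i → f i ∙ g i) ≈ ∑ n f ∙ ∑ n g
  ∑-∙ zero    f g = ≈-sym (identityˡ ε)
  ∑-∙ (suc n) f g = ≈-trans (∙-congʳ (∑-∙ n f g)) (interchange (∑ n f) (∑ n g) (f n) (g n))

  ∑-swap : ∀ n m (f : ℕ → ℕ → Carrier) →
    ∑ n (λ i → ∑ m (λ j → f i j)) ≈ ∑ m (λ j → ∑ n (λ i → f i j))
  ∑-swap zero    m f = ≈-sym (∑-ε m λ _ _ → ≈-refl)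
  ∑-swap (suc n) m f = ≈-trans (∙-congʳ (∑-swap n m f)) (≈-sym (∑-∙ m (λ j → ∑ n (λ i → f i j)) (f n)))

  ∑-front : ∀ n (f : ℕ → Carrier) → ∑ (suc n) f ≈ f 0 ∙ ∑ n (f ∘ suc)
  ∑-front zero    f = comm ε (f 0)
  ∑-front (suc n) f = ≈-trans (∙-congʳ (∑-front n f)) (assoc (f 0) (∑ n (f ∘ suc)) (f (suc n)))

  ∑-split : ∀ n m (f : ℕ → Carrier) → ∑ (n + m) f ≈ ∑ n f ∙ ∑ m (λ i → f (n + i))
  ∑-split n zero    f rewrite ℕ.+-identityʳ n = ≈-sym (identityʳ (∑ n f))
  ∑-split n (suc m) f rewrite ℕ.+-suc n m =
    ≈-trans (∙-congʳ (∑-split n m f)) (assoc (∑ n f) (∑ m (λ i → f (n + i))) (f (n + m)))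

  ∑-flatten : ∀ n m (f : ℕ → Carrier) → ∑ (n * m) f ≈ ∑ n (λ i → ∑ m (λ j → f (i * m + j)))
  ∑-flatten zero    m f = ≈-refl
  ∑-flatten (suc n) m f rewrite ℕ.+-comm m (n * m) =
    ≈-trans (∑-split (n * m) m f) (∙-congʳ (∑-flatten n m f))

  omit : ℕ → (ℕ → Carrier) → ℕ → Carrier
  omit e f i = ifDec (i ≟ e) ε (f i)

  omit-≡ : ∀ e (f : ℕ → Carrier) → omit e f e ≈ ε
  omit-≡ e f = reflexive (ifDec-yes (e ≟ e) refl)

  omit-≢ : ∀ {e i} (f : ℕ → Carrier) → i ≢ e → omit e f i ≈ f i
  omit-≢ {e} {i} f i≢e = reflexive (ifDec-no (i ≟ e) i≢e)

  ∑-omit : ∀ n {e} (f : ℕ → Carrier) → e < n → ∑ n f ≈ f e ∙ ∑ n (omit e f)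
  ∑-omit (suc n) {e} f e<1+n with e ≟ n
  ... | yes refl = begin
    ∑ n f ∙ f n                         ≈⟨ comm (∑ n f) (f n) ⟩
    f n ∙ ∑ n f                         ≈⟨ ∙-congˡ (∑-cong n λ i i<n → ≈-sym (omit-≢ f (ℕ.<⇒≢ i<n))) ⟩
    f n ∙ ∑ n (omit n f)                ≈⟨ ∙-congˡ (≈-sym (identityʳ _)) ⟩
    f n ∙ (∑ n (omit n f) ∙ ε)          ≈⟨ ∙-congˡ (∙-congˡ (≈-sym (omit-≡ n f))) ⟩
    f n ∙ (∑ n (omit n f) ∙ omit n f n) ∎
  ... | no e≢n = begin
    ∑ n f ∙ f n                         ≈⟨ ∙-cong (∑-omit n f (ℕ.≤∧≢⇒< (ℕ.≤-pred e<1+n) e≢n)) (≈-sym (omit-≢ f (e≢n ∘ sym))) ⟩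
    (f e ∙ ∑ n (omit e f)) ∙ omit e f n ≈⟨ assoc (f e) (∑ n (omit e f)) (omit e f n) ⟩
    f e ∙ (∑ n (omit e f) ∙ omit e f n) ∎

  only : ℕ → (ℕ → Carrier) → ℕ → Carrier
  only e f i = ifDec (i ≟ e) (f i) ε

  ∑-only : ∀ n {e} (f : ℕ → Carrier) → e < n → ∑ n (only e f) ≈ f e
  ∑-only n {e} f e<n = ≈-trans (∑-omit n (only e f) e<n)
    (≈-trans (∙-cong (reflexive (ifDec-yes (e ≟ e) refl)) (∑-ε n λ i _ → rest i)) (identityʳ (f e)))
    where
    rest : ∀ i → omit e (only e f) i ≈ ε
    rest i with i ≟ e
    ... | yes _ = ≈-refl
    ... | no _ = ≈-refl

module RingSums (R : CommutativeRing 0ℓ 0ℓ) where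
  open CommutativeRing R renaming (_+_ to _+ᴿ_; _*_ to _*ᴿ_; refl to ≈-refl; sym to ≈-sym; trans to ≈-trans)
  open PrefixSum +-commutativeMonoid public
  open PrefixSum *-commutativeMonoid public using () renaming
    ( ∑ to ∏; ∑-cong to ∏-cong; ∑-ε to ∏-1; ∑-∙ to ∏-*; ∑-omit to ∏-omit; omit to omit* )
  open Algebra.Properties.CommutativeSemiring.Exp commutativeSemiring public
    using (^-congˡ; ^-homo-*; ^-assocʳ; ^-distrib-*) renaming (_^_ to _^ᴿ_)

  *-distribˡ-∑ : ∀ n x (f : ℕ → Carrier) → x *ᴿ ∑ n f ≈ ∑ n (λ i → x *ᴿ f i)
  *-distribˡ-∑ zero    x f = zeroʳ x
  *-distribˡ-∑ (suc n) x f = ≈-trans (distribˡ x (∑ n f) (f n)) (+-congʳ (*-distribˡ-∑ n x f))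

  *-distribʳ-∑ : ∀ n x (f : ℕ → Carrier) → ∑ n f *ᴿ x ≈ ∑ n (λ i → f i *ᴿ x)
  *-distribʳ-∑ n x f = ≈-trans (*-comm (∑ n f) x)
    (≈-trans (*-distribˡ-∑ n x f) (∑-cong n λ i _ → *-comm x (f i)))

  1^n≈1 : ∀ n → 1# ^ᴿ n ≈ 1#
  1^n≈1 zero    = ≈-refl
  1^n≈1 (suc n) = ≈-trans (*-identityˡ _) (1^n≈1 n)

  ∏-^ : ∀ n m (f : ℕ → Carrier) → ∏ n f ^ᴿ m ≈ ∏ n (λ i → f i ^ᴿ m)
  ∏-^ zero    m f = 1^n≈1 m
  ∏-^ (suc n) m f = ≈-trans (^-distrib-* (∏ n f) (f n) m) (*-congʳ (∏-^ n m f))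

module ℕΣ = PrefixSum ℕ.+-0-commutativeMonoid

ℕ∑-const : ∀ n c → ℕΣ.∑ n (λ _ → c) ≡ n * c
ℕ∑-const zero    c = refl
ℕ∑-const (suc n) c = trans (cong (_+ c) (ℕ∑-const n c)) (ℕ.+-comm (n * c) c)

module DivMod where
  [j+in]%n≡j : ∀ i j n .{{_ : NonZero n}} → j < n → (i * n + j) % n ≡ j
  [j+in]%n≡j i j n j<n = trans (cong (_% n) (ℕ.+-comm (i * n) j)) (trans (ℕ.[m+kn]%n≡m%n j i n) (ℕ.m<n⇒m%n≡m j<n))

  [j+in]/n≡i : ∀ i j n .{{_ : NonZero n}} → j < n → (i * n + j) / n ≡ i
  [j+in]/n≡i i j n j<n = ℕ.*-cancelʳ-≡ _ _ n (ℕ.+-cancelˡ-≡ j _ _ (trans (cong (_+ (i * n + j) / n * n) (sym ([j+in]%n≡j i j n j<n)))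
    (trans (sym (ℕ.m≡m%n+[m/n]*n (i * n + j) n)) (ℕ.+-comm (i * n) j))))

  i*n+j< : ∀ {m n i j} → i < m → j < n → i * n + j < m * n
  i*n+j< {m} {n} {i} {j} i<m j<n = ℕ.<-≤-trans (ℕ.+-monoʳ-< (i * n) j<n)
    (ℕ.≤-trans (ℕ.≤-reflexive (ℕ.+-comm (i * n) n)) (ℕ.*-monoˡ-≤ n i<m))

funToFin-injective : ∀ {m n} (f h : Fin.Fin n → Fin.Fin m) → Fin.funToFin f ≡ Fin.funToFin h → ∀ i → f i ≡ h i
funToFin-injective f h eq i = trans (sym (Fin.finToFun-funToFin f i)) (trans (cong (λ t → Fin.finToFun t i) eq) (Fin.finToFun-funToFin h i))

funToFin-cong : ∀ {m} n {f h : Fin.Fin n → Fin.Fin m} → (∀ i → f i ≡ h i) → Fin.funToFin f ≡ Fin.funToFin h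
funToFin-cong zero    eq = refl
funToFin-cong (suc n) eq = cong₂ Fin.combine (eq Fin.zero) (funToFin-cong n (eq ∘ Fin.suc))

-- An integer weight on ℤ/k that replaces complex characters

module ℤΣ = PrefixSum ℤ.+-0-commutativeMonoid
module ℤP = Algebra.Properties.Ring ℤ.+-*-ring

ℤ-neg-∑ : ∀ n {f : ℕ → ℤ} → ℤΣ.∑ n (λ m → ℤ.- f m) ≡ ℤ.- ℤΣ.∑ n f
ℤ-neg-∑ zero    = refl
ℤ-neg-∑ (suc n) {f} = trans (cong (ℤ._+ ℤ.- f n) (ℤ-neg-∑ n)) (sym (ℤ.neg-distrib-+ (ℤΣ.∑ n f) (f n)))

-- A k-periodic weight on ℕ with value 1 at 0 and values at most 1 elsewhere, which sums to zero over every
-- nontrivial subgroup of ℤ/k: the convolution of the δ₀ − δ₋ᵤ over u = k/p with p prime.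
module Weight (k : ℕ) .{{_ : NonZero k}} where
  open Data.Nat.Solver.+-*-Solver

  record PrimeDivisor : Set where
    field
      p u     : ℕ
      prime   : Prime p
      u*p≡k   : u * p ≡ k

  open PrimeDivisor

  w : List PrimeDivisor → ℕ → ℤ
  w []       x = ifDec (k ℕ.∣? x) 1ℤ 0ℤ
  w (a ∷ as) x = w as x ℤ.- w as (x + u a)

  w-period : ∀ as x → w as (x + k) ≡ w as x
  w-period [] x with k ℕ.∣? x
  ... | yes k∣x = ifDec-yes (k ℕ.∣? (x + k)) (ℕ.∣m∣n⇒∣m+n k∣x ℕ.∣-refl)
  ... | no k∤x  = ifDec-no (k ℕ.∣? (x + k)) λ k∣ → k∤x (ℕ.∣m+n∣m⇒∣n (subst (k ∣_) (ℕ.+-comm x k) k∣) ℕ.∣-refl)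
  w-period (a ∷ as) x = cong₂ ℤ._-_ (w-period as x)
    (trans (cong (w as) (solve 3 (λ x k u → x :+ k :+ u := x :+ u :+ k) refl x k (u a))) (w-period as (x + u a)))

  w-period* : ∀ as x c → w as (x + c * k) ≡ w as x
  w-period* as x zero    = cong (w as) (ℕ.+-identityʳ x)
  w-period* as x (suc c) = trans (cong (w as) (solve 3 (λ x k c → x :+ (k :+ c) := x :+ c :+ k) refl x k (c * k)))
    (trans (w-period as (x + c * k)) (w-period* as x c))

  Π : List PrimeDivisor → ℕ
  Π []       = 1
  Π (a ∷ as) = p a * Π as

  Fresh : List PrimeDivisor → Set
  Fresh []       = ⊤
  Fresh (a ∷ as) = ¬ p a ∣ Π as × Fresh as

  -- Multiplication by `p a` turns the shift `u a` into k, so the product of all primes used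
  -- annihilates every point that the shifts reach from 0.
  w-support : ∀ as x → w as x ≢ 0ℤ → k ∣ x * Π as
  w-support [] x w≢0 with k ℕ.∣? x
  ... | yes k∣x = ℕ.∣m⇒∣m*n 1 k∣x
  ... | no _ = contradiction refl w≢0
  w-support (a ∷ as) x w≢0 with w as x ℤ.≟ 0ℤ
  ... | no wx≢0 = subst (k ∣_) (solve 3 (λ x q t → x :* t :* q := x :* (q :* t)) refl x (p a) (Π as)) (ℕ.∣m⇒∣m*n (p a) (w-support as x wx≢0))
  ... | yes wx≡0 with w as (x + u a) ℤ.≟ 0ℤ
  ...   | yes wxu≡0 = contradiction (cong₂ ℤ._-_ wx≡0 wxu≡0) w≢0
  ...   | no wxu≢0 = ℕ.∣m+n∣m⇒∣n (subst (k ∣_) distribute (ℕ.∣m⇒∣m*n (p a) (w-support as (x + u a) wxu≢0))) (ℕ.∣m⇒∣m*n (Π as) ℕ.∣-refl)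
    where
    distribute : (x + u a) * Π as * p a ≡ k * Π as + x * (p a * Π as)
    distribute = trans (solve 4 (λ x u q t → (x :+ u) :* t :* q := u :* q :* t :+ x :* (q :* t)) refl x (u a) (p a) (Π as))
      (cong (λ m → m * Π as + x * (p a * Π as)) (u*p≡k a))

  disjoint : ∀ a as x → ¬ p a ∣ Π as → w as x ≢ 0ℤ → w as (x + u a) ≡ 0ℤ
  disjoint a as x p∤ wx≢0 with w as (x + u a) ℤ.≟ 0ℤ
  ... | yes eq = eq
  ... | no wxu≢0 = contradiction (ℕ.*-cancelˡ-∣ (u a) (subst (_∣ u a * Π as) (sym (u*p≡k a))
      (ℕ.∣m+n∣m⇒∣n (subst (k ∣_) (ℕ.*-distribʳ-+ (Π as) x (u a)) (w-support as (x + u a) wxu≢0)) (w-support as x wx≢0)))) p∤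
    where
    instance
      u-nonZero : NonZero (u a)
      u-nonZero = ℕ.m*n≢0⇒m≢0 (u a) {{subst NonZero (sym (u*p≡k a)) it}}

  data Sign : ℤ → Set where
    zero : Sign 0ℤ
    one  : Sign 1ℤ
    neg  : Sign -1ℤ

  w-sign : ∀ as x → Fresh as → Sign (w as x)
  w-sign [] x _ with k ℕ.∣? x
  ... | yes _ = one
  ... | no _  = zero
  w-sign (a ∷ as) x (p∤ , fresh) = difference (w-sign as x fresh) (w-sign as (x + u a) fresh) (disjoint a as x p∤)
    where
    difference : ∀ {y z} → Sign y → Sign z → (y ≢ 0ℤ → z ≡ 0ℤ) → Sign (y ℤ.- z)
    difference zero zero _ = zero
    difference zero one  _ = neg
    difference zero neg  _ = one
    difference one  sz   d rewrite d (λ ()) = one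
    difference neg  sz   d rewrite d (λ ()) = neg

  w-0 : ∀ as → Fresh as → w as 0 ≡ 1ℤ
  w-0 [] _ = ifDec-yes (k ℕ.∣? 0) (k ℕ.∣0)
  w-0 (a ∷ as) (p∤ , fresh) = cong₂ ℤ._-_ (w-0 as fresh)
    (disjoint a as 0 p∤ λ eq → contradiction (trans (sym (w-0 as fresh)) eq) λ ())

  sum-shift : ∀ (f : ℕ → ℤ) → (∀ m → f (m + k) ≡ f m) → ∀ t → ℤΣ.∑ k (λ m → f (m + t)) ≡ ℤΣ.∑ k f
  sum-shift f period zero = ℤΣ.∑-cong k λ m _ → cong f (ℕ.+-identityʳ m)
  sum-shift f period (suc t) = trans (ℤΣ.∑-cong k λ m _ → cong f (ℕ.+-suc m t)) (trans once (sum-shift f period t))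
    where
    once : ℤΣ.∑ k (λ m → f (suc (m + t))) ≡ ℤΣ.∑ k (λ m → f (m + t))
    once = ℤP.+-cancelˡ (f t) _ _ (trans (sym (ℤΣ.∑-front k (λ m → f (m + t)))) (trans (ℤ.+-comm _ (f (k + t)))
      (cong (ℤ._+ ℤΣ.∑ k (λ m → f (m + t))) (trans (cong f (ℕ.+-comm k t)) (period t)))))

  -- `u a` lies in the subgroup of ℤ/k generated by `v`; multiples of k stand on both sides to avoid
  -- subtraction.
  Reaches : ℕ → PrimeDivisor → Set
  Reaches v a = ∃ λ t → ∃ λ c → ∃ λ c′ → t * v + c * k ≡ u a + c′ * k

  -- The sum runs over a coset of the subgroup generated by `v`. A shift by `u a` only permutes that
  -- coset, so the factor of the convolution belonging to `a` makes two equal sums cancel; the other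
  -- factors preserve the vanishing by linearity.
  sum-zero : ∀ as v {a} → a ∈ as → Reaches v a → ∀ x → ℤΣ.∑ k (λ m → w as (x + m * v)) ≡ 0ℤ
  sum-zero (b ∷ as) v {a} (there a∈as) reach x = trans (ℤΣ.∑-∙ k _ _) (cong₂ ℤ._+_ (sum-zero as v a∈as reach x)
    (trans (ℤ-neg-∑ k) (cong ℤ.-_ (trans (ℤΣ.∑-cong k λ m _ → cong (w as) (swap m)) (sum-zero as v a∈as reach (x + u b))))))
    where
    swap : ∀ m → x + m * v + u b ≡ x + u b + m * v
    swap m = solve 3 (λ x y u → x :+ y :+ u := x :+ u :+ y) refl x (m * v) (u b)
  sum-zero (a ∷ as) v (here refl) (t , c , c′ , eq) x = trans (ℤΣ.∑-cong k λ m _ → cong (λ z → f m ℤ.- z) (shifted m))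
    (trans (ℤΣ.∑-∙ k f (λ m → ℤ.- f (m + t))) (trans (cong (λ z → ℤΣ.∑ k f ℤ.+ z) (trans (ℤ-neg-∑ k) (cong ℤ.-_ (sum-shift f period t)))) (ℤ.+-inverseʳ (ℤΣ.∑ k f))))
    where
    f : ℕ → ℤ
    f m = w as (x + m * v)
    period : ∀ m → f (m + k) ≡ f m
    period m = trans (cong (w as) (solve 4 (λ x m k v → x :+ (m :+ k) :* v := x :+ m :* v :+ v :* k) refl x m k v)) (w-period* as _ v)
    shifted : ∀ m → w as (x + m * v + u a) ≡ f (m + t)
    shifted m = begin
      w as (x + m * v + u a)                ≡⟨ w-period* as _ c′ ⟨
      w as (x + m * v + u a + c′ * k)       ≡⟨ cong (w as) (trans (ℕ.+-assoc (x + m * v) (u a) (c′ * k)) (trans (cong (x + m * v +_) (sym eq))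
                                                 (solve 5 (λ x m v t c → x :+ m :* v :+ (t :* v :+ c) := x :+ (m :+ t) :* v :+ c) refl x m v t (c * k)))) ⟩
      w as (x + (m + t) * v + c * k)        ≡⟨ w-period* as _ c ⟩
      w as (x + (m + t) * v)                ∎
      where open ≡-Reasoning

  primesBelow : ℕ → List PrimeDivisor
  primesBelow zero = []
  primesBelow (suc n) with prime? n | n ℕ.∣? k
  ... | yes pn | yes (divides u eq) = record { p = n ; u = u ; prime = pn ; u*p≡k = sym eq } ∷ primesBelow n
  ... | yes _  | no _  = primesBelow n
  ... | no _   | _     = primesBelow n

  ∤Π : ∀ {q} → Prime q → ∀ as → (∀ a → a ∈ as → p a < q) → ¬ q ∣ Π as
  ∤Π pq [] _ q∣1 = ℕ.¬prime[1] (subst Prime (ℕ.∣1⇒≡1 q∣1) pq)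
  ∤Π pq (a ∷ as) small q∣ with euclidsLemma (p a) (Π as) pq q∣
  ... | inj₁ q∣p = ℕ.<⇒≱ (small a (here refl)) (ℕ.∣⇒≤ {{ℕ.prime⇒nonZero (prime a)}} q∣p)
  ... | inj₂ q∣Π = ∤Π pq as (λ b b∈ → small b (there b∈)) q∣Π

  primesBelow-< : ∀ n a → a ∈ primesBelow n → p a < n
  primesBelow-< (suc n) a a∈ with prime? n | n ℕ.∣? k
  primesBelow-< (suc n) a (here refl) | yes _ | yes _ = ℕ.≤-refl
  primesBelow-< (suc n) a (there a∈)  | yes _ | yes _ = ℕ.m<n⇒m<1+n (primesBelow-< n a a∈)
  primesBelow-< (suc n) a a∈          | yes _ | no _  = ℕ.m<n⇒m<1+n (primesBelow-< n a a∈)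
  primesBelow-< (suc n) a a∈          | no _  | _     = ℕ.m<n⇒m<1+n (primesBelow-< n a a∈)

  primesBelow-fresh : ∀ n → Fresh (primesBelow n)
  primesBelow-fresh zero = tt
  primesBelow-fresh (suc n) with prime? n | n ℕ.∣? k
  ... | yes pn | yes _ = ∤Π pn (primesBelow n) (primesBelow-< n) , primesBelow-fresh n
  ... | yes _  | no _  = primesBelow-fresh n
  ... | no _   | _     = primesBelow-fresh n

  primesBelow-complete : ∀ n q → q < n → Prime q → q ∣ k → ∃ λ a → a ∈ primesBelow n × p a ≡ q
  primesBelow-complete (suc n) q q<1+n pq q∣k with prime? n | n ℕ.∣? k | ℕ.m≤n⇒m<n∨m≡n (ℕ.≤-pred q<1+n)
  ... | yes pn | yes (divides _ _) | inj₂ refl = _ , here refl , refl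
  ... | yes _  | no n∤k            | inj₂ refl = contradiction q∣k n∤k
  ... | no ¬pn | _                 | inj₂ refl = contradiction pq ¬pn
  ... | yes _  | yes (divides _ _) | inj₁ q<n = let a , a∈ , eq = primesBelow-complete n q q<n pq q∣k in a , there a∈ , eq
  ... | yes _  | no _              | inj₁ q<n = primesBelow-complete n q q<n pq q∣k
  ... | no _   | _                 | inj₁ q<n = primesBelow-complete n q q<n pq q∣k

  primeDivisor : ∀ n → n ≢ 0 → n ≢ 1 → ∃ λ q → Prime q × q ∣ n
  primeDivisor n n≢0 n≢1 with factorise n {{≢-nonZero n≢0}}
  ... | record { factors = [] ; isFactorisation = eq } = contradiction eq n≢1
  ... | record { factors = q ∷ _ ; isFactorisation = eq ; factorsPrime = pq ∷ _ } = q , pq , subst (q ∣_) (sym eq) (ℕ.m∣m*n _)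

  all : List PrimeDivisor
  all = primesBelow (suc k)

  -- The order k / gcd(v, k) of `v` is not 1, so some prime p divides it. Then k / p is a multiple
  -- of the gcd, and Bézout's identity expresses it through `v`.
  reach : ∀ v → ¬ k ∣ v → ∃ λ a → a ∈ all × Reaches v a
  reach v k∤v with ℕ.mkGCD v k
  ... | G , isGCD with ℕ.GCD.gcd∣m isGCD | ℕ.GCD.gcd∣n isGCD
  ...   | G∣v | divides d′ k≡ with primeDivisor d′ d′≢0 d′≢1
    where
    d′≢0 : d′ ≢ 0
    d′≢0 refl = ≢-nonZero⁻¹ k k≡
    d′≢1 : d′ ≢ 1
    d′≢1 refl = k∤v (subst (_∣ v) (sym (trans k≡ (ℕ.*-identityˡ G))) G∣v)
  ...     | q , pq , divides w′ d′≡ with primesBelow-complete (suc k) q (s≤s (ℕ.∣⇒≤ q∣k)) pq q∣k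
    where
    q∣k : q ∣ k
    q∣k = divides (w′ * G) (trans k≡ (trans (cong (_* G) d′≡) (solve 3 (λ w q g → w :* q :* g := w :* g :* q) refl w′ q G)))
  ...       | a , a∈ , refl = a , a∈ , reaches (ℕ.Bézout.identity isGCD)
    where
    u≡ : u a ≡ w′ * G
    u≡ = ℕ.*-cancelʳ-≡ _ _ (p a) {{ℕ.prime⇒nonZero (prime a)}} (trans (u*p≡k a) (trans k≡ (trans (cong (_* G) d′≡)
      (solve 3 (λ w q g → w :* q :* g := w :* g :* q) refl w′ (p a) G))))
    reaches : ℕ.Bézout.Identity G v k → Reaches v a
    reaches (ℕ.Bézout.+- x y eq) = w′ * x , 0 , w′ * y , (begin
      w′ * x * v + 0            ≡⟨ trans (ℕ.+-identityʳ _) (ℕ.*-assoc w′ x v) ⟩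
      w′ * (x * v)              ≡⟨ cong (w′ *_) eq ⟨
      w′ * (G + y * k)          ≡⟨ solve 4 (λ w g y k → w :* (g :+ y :* k) := w :* g :+ w :* y :* k) refl w′ G y k ⟩
      w′ * G + w′ * y * k       ≡⟨ cong (_+ w′ * y * k) u≡ ⟨
      u a + w′ * y * k          ∎)
      where open ≡-Reasoning
    -- In this form of Bézout's identity `G` is congruent to minus `x * v`; the factor `κ` = k - 1
    -- plays the part of -1 modulo k.
    reaches (ℕ.Bézout.-+ x y eq) = κ * w′ * x , w′ * G , κ * w′ * y , (begin
      κ * w′ * x * v + w′ * G * k             ≡⟨ cong (λ n → κ * w′ * x * v + w′ * G * n) (sym k≡1+κ) ⟩
      κ * w′ * x * v + w′ * G * suc κ         ≡⟨ solve 5 (λ κ w x v g → κ :* w :* x :* v :+ w :* g :* (con 1 :+ κ) := w :* g :+ κ :* w :* (g :+ x :* v)) refl κ w′ x v G ⟩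
      w′ * G + κ * w′ * (G + x * v)           ≡⟨ cong₂ (λ m n → m + κ * w′ * n) (sym u≡) eq ⟩
      u a + κ * w′ * (y * k)                  ≡⟨ cong (u a +_) (sym (ℕ.*-assoc (κ * w′) y k)) ⟩
      u a + κ * w′ * y * k                    ∎)
      where
      open ≡-Reasoning
      κ : ℕ
      κ = pred k
      k≡1+κ : suc κ ≡ k
      k≡1+κ = ℕ.suc-pred k

  -- The weight is at most 1, so the absolute value only changes the type. Nonnegativity is what
  -- makes upper bounds for the classes sufficient.
  ŵ : ℕ → ℕ
  ŵ x = ℤ.∣ 1ℤ ℤ.- w all x ∣

  +ŵ : ∀ x → ℤ.+ ŵ x ≡ 1ℤ ℤ.- w all x
  +ŵ x with w all x | w-sign all x (primesBelow-fresh (suc k))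
  ... | .0ℤ  | zero = refl
  ... | .1ℤ  | one  = refl
  ... | .-1ℤ | neg  = refl

  ŵ-period : ∀ x c → ŵ (x + c * k) ≡ ŵ x
  ŵ-period x c = cong (λ z → ℤ.∣ 1ℤ ℤ.- z ∣) (w-period* all x c)

  ŵ-multiple : ∀ c → ŵ (c * k) ≡ 0
  ŵ-multiple c = trans (ŵ-period 0 c) (cong (λ z → ℤ.∣ 1ℤ ℤ.- z ∣) (w-0 all (primesBelow-fresh (suc k))))

  ŵ-sum : ∀ v → ¬ k ∣ v → ∀ x → ℕΣ.∑ k (λ m → ŵ (x + m * v)) ≡ k
  ŵ-sum v k∤v x with reach v k∤v
  ... | a , a∈ , r = ℤ.+-injective (begin
    ℤ.+ ℕΣ.∑ k (λ m → ŵ (x + m * v))                              ≡⟨ pos-∑ k ⟩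
    ℤΣ.∑ k (λ m → ℤ.+ ŵ (x + m * v))                              ≡⟨ ℤΣ.∑-cong k (λ m _ → +ŵ (x + m * v)) ⟩
    ℤΣ.∑ k (λ m → 1ℤ ℤ.- w all (x + m * v))                       ≡⟨ sub-∑ k ⟩
    ℤ.+ k ℤ.- ℤΣ.∑ k (λ m → w all (x + m * v))                    ≡⟨ cong (λ z → ℤ.+ k ℤ.- z) (sum-zero all v a∈ r x) ⟩
    ℤ.+ k ℤ.- 0ℤ                                                  ≡⟨ ℤ.+-identityʳ _ ⟩
    ℤ.+ k                                                         ∎)
    where
    open ≡-Reasoning
    pos-∑ : ∀ n {f : ℕ → ℕ} → ℤ.+ ℕΣ.∑ n f ≡ ℤΣ.∑ n (λ m → ℤ.+ f m)
    pos-∑ zero    = refl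
    pos-∑ (suc n) {f} = trans (ℤ.pos-+ (ℕΣ.∑ n f) (f n)) (cong (ℤ._+ ℤ.+ f n) (pos-∑ n))
    sub-∑ : ∀ n {f : ℕ → ℤ} → ℤΣ.∑ n (λ m → 1ℤ ℤ.- f m) ≡ ℤ.+ n ℤ.- ℤΣ.∑ n f
    sub-∑ zero    = refl
    sub-∑ (suc n) {f} = trans (cong (ℤ._+ (1ℤ ℤ.- f n)) (sub-∑ n)) (trans (ℤΣ.interchange (ℤ.+ n) (ℤ.- ℤΣ.∑ n f) 1ℤ (ℤ.- f n))
      (cong₂ ℤ._+_ (trans (sym (ℤ.pos-+ n 1)) (cong ℤ.+_ (ℕ.+-comm n 1))) (sym (ℤ.neg-distrib-+ (ℤΣ.∑ n f) (f n)))))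

-- Averaging over all vectors modulo k

sumOver : {A : Set} → List A → (A → ℕ) → ℕ
sumOver []       f = 0
sumOver (a ∷ as) f = f a + sumOver as f

sumOver-cong : ∀ {A : Set} as {f h : A → ℕ} → (∀ a → f a ≡ h a) → sumOver as f ≡ sumOver as h
sumOver-cong []       eq = refl
sumOver-cong (a ∷ as) eq = cong₂ _+_ (eq a) (sumOver-cong as eq)

ℕ∑-mono-≤ : ∀ n {f h : ℕ → ℕ} → (∀ i → i < n → f i ≤ h i) → ℕΣ.∑ n f ≤ ℕΣ.∑ n h
ℕ∑-mono-≤ zero    le = z≤n
ℕ∑-mono-≤ (suc n) le = ℕ.+-mono-≤ (ℕ∑-mono-≤ n λ i i<n → le i (ℕ.m<n⇒m<1+n i<n)) (le n ℕ.≤-refl)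

ℕ∑-*ʳ : ∀ n f c → ℕΣ.∑ n f * c ≡ ℕΣ.∑ n (λ i → f i * c)
ℕ∑-*ʳ zero    f c = refl
ℕ∑-*ʳ (suc n) f c = trans (ℕ.*-distribʳ-+ c (ℕΣ.∑ n f) (f n)) (cong (_+ f n * c) (ℕ∑-*ʳ n f c))

length-filter-∷ : ∀ {A : Set} {P : A → Set} (P? : ∀ a → Dec (P a)) a as →
  length (filter P? (a ∷ as)) ≡ ifDec (P? a) 1 0 + length (filter P? as)
length-filter-∷ P? a as with P? a
... | yes _ = refl
... | no _  = refl

sumOver-classes : ∀ {A : Set} d .{{_ : NonZero d}} (key : A → ℕ) (f : ℕ → ℕ) as →
  sumOver as (λ a → f (key a % d)) ≡ ℕΣ.∑ d (λ l → f l * length (filter (λ a → l ≟ key a % d) as))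
sumOver-classes d key f [] = sym (ℕΣ.∑-ε d λ l _ → ℕ.*-zeroʳ (f l))
sumOver-classes d key f (a ∷ as) = sym (begin
  ℕΣ.∑ d (λ l → f l * length (filter (λ a → l ≟ key a % d) (a ∷ as)))
    ≡⟨ ℕΣ.∑-cong d (λ l _ → trans (cong (f l *_) (length-filter-∷ (λ a → l ≟ key a % d) a as)) (trans (ℕ.*-distribˡ-+ (f l) _ _)
         (cong (_+ f l * length (filter (λ a → l ≟ key a % d) as)) (indicator l)))) ⟩
  ℕΣ.∑ d (λ l → ℕΣ.only (key a % d) f l + f l * length (filter (λ a → l ≟ key a % d) as))
    ≡⟨ ℕΣ.∑-∙ d _ _ ⟩
  ℕΣ.∑ d (ℕΣ.only (key a % d) f) + ℕΣ.∑ d (λ l → f l * length (filter (λ a → l ≟ key a % d) as))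
    ≡⟨ cong₂ _+_ (ℕΣ.∑-only d f (ℕ.m%n<n (key a) d)) (sym (sumOver-classes d key f as)) ⟩
  f (key a % d) + sumOver as (λ a → f (key a % d)) ∎)
  where
  open ≡-Reasoning
  indicator : ∀ l → f l * ifDec (l ≟ key a % d) 1 0 ≡ ℕΣ.only (key a % d) f l
  indicator l with l ≟ key a % d
  ... | yes _ = ℕ.*-identityʳ (f l)
  ... | no _  = ℕ.*-zeroʳ (f l)

module Averaging (κ : ℕ) where
  k : ℕ
  k = suc κ
  open Weight k public using (ŵ; ŵ-period; ŵ-sum; primeDivisor)

  dot : ℕ → (ℕ → ℕ) → (ℕ → ℕ) → ℕ
  dot s ψ x = ℕΣ.∑ s (λ e → ψ e * x e)

  extend : ℕ → ℕ → (ℕ → ℕ) → ℕ → ℕ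
  extend s m ψ e = ifDec (e ≟ s) m (ψ e)

  extend-≡ : ∀ s m ψ → extend s m ψ s ≡ m
  extend-≡ s m ψ = ifDec-yes (s ≟ s) refl

  extend-< : ∀ {s e} m ψ → e < s → extend s m ψ e ≡ ψ e
  extend-< {s} {e} m ψ e<s = ifDec-no (e ≟ s) (ℕ.<⇒≢ e<s)

  dot-extend : ∀ s m ψ x → dot (suc s) (extend s m ψ) x ≡ dot s ψ x + m * x s
  dot-extend s m ψ x = cong₂ _+_ (ℕΣ.∑-cong s λ e e<s → cong (_* x e) (extend-< m ψ e<s)) (cong (_* x s) (extend-≡ s m ψ))

  box : ℕ → ((ℕ → ℕ) → ℕ) → ℕ
  box zero    f = f (λ _ → 0)
  box (suc s) f = ℕΣ.∑ k (λ m → box s (λ ψ → f (extend s m ψ)))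

  box-cong : ∀ s {f h : (ℕ → ℕ) → ℕ} → (∀ ψ → f ψ ≡ h ψ) → box s f ≡ box s h
  box-cong zero    eq = eq _
  box-cong (suc s) eq = ℕΣ.∑-cong k λ m _ → box-cong s λ ψ → eq _

  box-+ : ∀ s (f h : (ℕ → ℕ) → ℕ) → box s (λ ψ → f ψ + h ψ) ≡ box s f + box s h
  box-+ zero    f h = refl
  box-+ (suc s) f h = trans (ℕΣ.∑-cong k λ m _ → box-+ s _ _) (ℕΣ.∑-∙ k _ _)

  box-0 : ∀ s → box s (λ _ → 0) ≡ 0
  box-0 zero    = refl
  box-0 (suc s) = ℕΣ.∑-ε k λ _ _ → box-0 s

  box-const : ∀ s c → box s (λ _ → c) ≡ k ^ s * c
  box-const zero    c = sym (ℕ.+-identityʳ c)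
  box-const (suc s) c = trans (ℕ∑-const k _) (trans (cong (k *_) (box-const s c)) (sym (ℕ.*-assoc k (k ^ s) c)))

  box-∑ : ∀ s n (f : ℕ → (ℕ → ℕ) → ℕ) → ℕΣ.∑ n (λ m → box s (f m)) ≡ box s (λ ψ → ℕΣ.∑ n (λ m → f m ψ))
  box-∑ s zero    f = sym (box-0 s)
  box-∑ s (suc n) f = trans (cong (_+ box s (f n)) (box-∑ s n f)) (sym (box-+ s _ (f n)))

  box-sumOver : ∀ {A : Set} s as (f : A → (ℕ → ℕ) → ℕ) → sumOver as (λ a → box s (f a)) ≡ box s (λ ψ → sumOver as (λ a → f a ψ))
  box-sumOver s []       f = sym (box-0 s)
  box-sumOver s (a ∷ as) f = trans (cong (box s (f a) +_) (box-sumOver s as f)) (sym (box-+ s (f a) _))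

  InBox : ℕ → (ℕ → ℕ) → Set
  InBox s ψ = ∀ e → e < s → ψ e < k

  InBox-extend : ∀ {s m ψ} → m < k → InBox s ψ → InBox (suc s) (extend s m ψ)
  InBox-extend {s} {m} {ψ} m<k inb e e<1+s with e ≟ s
  ... | yes _ = m<k
  ... | no e≢s = inb e (ℕ.≤∧≢⇒< (ℕ.≤-pred e<1+s) e≢s)

  box-≤ : ∀ s {f} C → (∀ ψ → InBox s ψ → f ψ ≤ C) → box s f ≤ k ^ s * C
  box-≤ zero    C le = ℕ.≤-trans (le _ (λ _ ())) (ℕ.≤-reflexive (sym (ℕ.+-identityʳ C)))
  box-≤ (suc s) C le = ℕ.≤-trans (ℕ∑-mono-≤ k λ m m<k → box-≤ s C λ ψ inb → le _ (InBox-extend m<k inb))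
    (ℕ.≤-reflexive (trans (ℕ∑-const k _) (sym (ℕ.*-assoc k (k ^ s) C))))

  NonZeroVector : ℕ → (ℕ → ℕ) → Set
  NonZeroVector s ψ = ∃ λ e → e < s × ψ e ≢ 0

  -- The extra `C` on the left records that the zero vector contributes nothing. That vector lies in
  -- the slice `m` = 0, which is handled by induction; the other κ slices use the plain bound.
  box-≤′ : ∀ s {f} C → (∀ ψ → InBox s ψ → NonZeroVector s ψ → f ψ ≤ C) →
    (∀ ψ → (∀ e → e < s → ψ e ≡ 0) → f ψ ≡ 0) → box s f + C ≤ k ^ s * C
  box-≤′ zero {f} C le z = ℕ.≤-reflexive (trans (cong (_+ C) (z (λ _ → 0) (λ _ ()))) (sym (ℕ.+-identityʳ C)))
  box-≤′ (suc s) {f} C le z = begin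
    ℕΣ.∑ k (λ m → box s (f ∘ extend s m)) + C
      ≡⟨ cong (_+ C) (ℕΣ.∑-front κ _) ⟩
    box s (f ∘ extend s 0) + ℕΣ.∑ κ (λ m → box s (f ∘ extend s (suc m))) + C
      ≡⟨ solve 3 (λ x y z → x :+ y :+ z := x :+ z :+ y) refl (box s (f ∘ extend s 0)) (ℕΣ.∑ κ (λ m → box s (f ∘ extend s (suc m)))) C ⟩
    box s (f ∘ extend s 0) + C + ℕΣ.∑ κ (λ m → box s (f ∘ extend s (suc m)))
      ≤⟨ ℕ.+-mono-≤ (box-≤′ s C first-≤ first-0) (ℕ∑-mono-≤ κ λ m m<κ → box-≤ s C λ ψ inb →
           le (extend s (suc m) ψ) (InBox-extend (s≤s m<κ) inb) (s , ℕ.≤-refl , λ eq → ℕ.1+n≢0 (trans (sym (extend-≡ s (suc m) ψ)) eq))) ⟩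
    k ^ s * C + ℕΣ.∑ κ (λ _ → k ^ s * C)
      ≡⟨ cong (k ^ s * C +_) (ℕ∑-const κ (k ^ s * C)) ⟩
    k * (k ^ s * C)
      ≡⟨ ℕ.*-assoc k (k ^ s) C ⟨
    k * k ^ s * C ∎
    where
    open ℕ.≤-Reasoning
    open Data.Nat.Solver.+-*-Solver
    first-≤ : ∀ ψ → InBox s ψ → NonZeroVector s ψ → f (extend s 0 ψ) ≤ C
    first-≤ ψ inb (e , e<s , ψe≢0) = le (extend s 0 ψ) (InBox-extend (s≤s z≤n) inb)
      (e , ℕ.m<n⇒m<1+n e<s , λ eq → ψe≢0 (trans (sym (extend-< 0 ψ e<s)) eq))
    first-0 : ∀ ψ → (∀ e → e < s → ψ e ≡ 0) → f (extend s 0 ψ) ≡ 0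
    first-0 ψ ψ≡0 = z (extend s 0 ψ) all-0
      where
      all-0 : ∀ e → e < suc s → extend s 0 ψ e ≡ 0
      all-0 e e<1+s with e ≟ s
      ... | yes _ = refl
      ... | no e≢s = ψ≡0 e (ℕ.≤∧≢⇒< (ℕ.≤-pred e<1+s) e≢s)

  Bad : ℕ → (ℕ → ℕ) → Set
  Bad s x = ∃ λ e → e < s × ¬ k ∣ x e

  bad? : ∀ s x → Dec (Bad s x)
  bad? s x = ℕ.anyUpTo? (λ e → ¬? (k ℕ.∣? x e)) s

  -- With all coordinates but `e` fixed, ψ · x runs through a coset of the subgroup generated by
  -- `x e`, which is nontrivial, so `ŵ` sums to k there. The offset `c` collects the coordinates
  -- already split off.
  box-bad : ∀ s x c → Bad s x → box s (λ ψ → ŵ (c + dot s ψ x)) ≡ k ^ s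
  box-bad (suc s) x c (e , e<1+s , k∤) = trans (ℕΣ.∑-cong k λ m _ → box-cong s λ ψ → cong (λ t → ŵ (c + t)) (dot-extend s m ψ x))
    (by-last (e ≟ s))
    where
    open Data.Nat.Solver.+-*-Solver
    by-last : Dec (e ≡ s) → ℕΣ.∑ k (λ m → box s (λ ψ → ŵ (c + (dot s ψ x + m * x s)))) ≡ k ^ suc s
    by-last (yes refl) = trans (box-∑ s k _) (trans (box-cong s λ ψ → trans (ℕΣ.∑-cong k λ m _ → cong ŵ (sym (ℕ.+-assoc c (dot s ψ x) (m * x s))))
      (ŵ-sum (x s) k∤ (c + dot s ψ x))) (trans (box-const s k) (ℕ.*-comm (k ^ s) k)))
    by-last (no e≢s) = trans (ℕΣ.∑-cong k λ m _ → trans (box-cong s λ ψ → cong ŵ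
        (solve 3 (λ c d m → c :+ (d :+ m) := c :+ m :+ d) refl c (dot s ψ x) (m * x s)))
      (box-bad s x (c + m * x s) (e , ℕ.≤∧≢⇒< (ℕ.≤-pred e<1+s) e≢s , k∤))) (ℕ∑-const k (k ^ s))

  -- Summed over all ψ, a bad element has weight exactly k^s and a good one at least 0. Exchanging
  -- the two sums gives (number of bad elements) · k^s ≤ (k^s - 1) · C, here rearranged without
  -- subtraction.
  averaging : ∀ {A : Set} s (as : List A) (v : A → ℕ → ℕ) C →
    (∀ ψ → InBox s ψ → NonZeroVector s ψ → sumOver as (λ a → ŵ (dot s ψ (v a))) ≤ C) →
    length as * k ^ s + C ≤ length (filter (λ a → ¬? (bad? s (v a))) as) * k ^ s + k ^ s * C
  averaging {A} s as v C le = ℕ.≤-trans (ℕ.+-monoˡ-≤ C (count as)) (ℕ.≤-trans (ℕ.≤-reflexive (ℕ.+-assoc (good as * k ^ s) _ C))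
      (ℕ.+-monoʳ-≤ (good as * k ^ s) (ℕ.≤-trans (ℕ.≤-reflexive (cong (_+ C) (box-sumOver s as _))) (box-≤′ s C le zeros))))
    where
    open Data.Nat.Solver.+-*-Solver
    good : List A → ℕ
    good as = length (filter (λ a → ¬? (bad? s (v a))) as)
    total : List A → ℕ
    total as = sumOver as (λ a → box s (λ ψ → ŵ (dot s ψ (v a))))
    count : ∀ as → length as * k ^ s ≤ good as * k ^ s + total as
    count [] = z≤n
    count (a ∷ as) with bad? s (v a)
    ... | yes bad = ℕ.≤-trans (ℕ.+-mono-≤ (ℕ.≤-reflexive (sym (box-bad s (v a) 0 bad))) (count as))
      (ℕ.≤-reflexive (solve 3 (λ x y z → x :+ (y :+ z) := y :+ (x :+ z)) refl _ (good as * k ^ s) (total as)))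
    ... | no _ = ℕ.≤-trans (ℕ.+-monoʳ-≤ (k ^ s) (ℕ.≤-trans (count as) (ℕ.+-monoʳ-≤ (good as * k ^ s) (ℕ.m≤n+m (total as) _))))
      (ℕ.≤-reflexive (sym (ℕ.+-assoc (k ^ s) (good as * k ^ s) _)))
    zeros : ∀ ψ → (∀ e → e < s → ψ e ≡ 0) → sumOver as (λ a → ŵ (dot s ψ (v a))) ≡ 0
    zeros ψ ψ≡0 = go as
      where
      go : ∀ as → sumOver as (λ a → ŵ (dot s ψ (v a))) ≡ 0
      go [] = refl
      go (a ∷ as) = cong₂ _+_ (trans (cong ŵ (ℕΣ.∑-ε s λ e e<s → cong (_* v a e) (ψ≡0 e e<s))) (ŵ-multiple 0)) (go as)
        where open Weight k using (ŵ-multiple)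

  -- h is the gcd of k and the entries of ψ, and suc d′ = k / h is the order of ψ modulo k.
  record Content (s : ℕ) (ψ : ℕ → ℕ) : Set where
    field
      h d′  : ℕ
      ρ     : ℕ → ℕ
      h*d≡k : h * suc d′ ≡ k
      0<d′  : 0 < d′
      ψ≡ρ*h : ∀ e → e < s → ψ e ≡ ρ e * h
      h-gcd : ∀ n → (∀ e → e < s → k ∣ n * ψ e) → k ∣ n * h

  content : ∀ s ψ → InBox s ψ → NonZeroVector s ψ → Content s ψ
  content s ψ inb (e , e<s , ψe≢0) = by-quotient (h∣k s) refl
    where
    h : ℕ → ℕ
    h zero    = k
    h (suc n) = gcd (ψ n) (h n)
    h∣k : ∀ n → h n ∣ k
    h∣k zero    = ℕ.∣-refl
    h∣k (suc n) = ℕ.∣-trans (ℕ.gcd[m,n]∣n (ψ n) (h n)) (h∣k n)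
    h∣ψ : ∀ n e → e < n → h n ∣ ψ e
    h∣ψ (suc n) e e<1+n with ℕ.m≤n⇒m<n∨m≡n (ℕ.≤-pred e<1+n)
    ... | inj₁ e<n  = ℕ.∣-trans (ℕ.gcd[m,n]∣n (ψ n) (h n)) (h∣ψ n e e<n)
    ... | inj₂ refl = ℕ.gcd[m,n]∣m (ψ n) (h n)
    greatest : ∀ n m → (∀ e → e < n → k ∣ m * ψ e) → k ∣ m * h n
    greatest zero    m k∣ = ℕ.∣n⇒∣m*n m ℕ.∣-refl
    greatest (suc n) m k∣ = subst (k ∣_) (sym (ℕ.c*gcd[m,n]≡gcd[cm,cn] m (ψ n) (h n)))
      (ℕ.gcd-greatest (k∣ n ℕ.≤-refl) (greatest n m λ e e<n → k∣ e (ℕ.m<n⇒m<1+n e<n)))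
    ρ : ℕ → ℕ
    ρ e with h s ℕ.∣? ψ e
    ... | yes (divides c _) = c
    ... | no _ = 0
    ρ-correct : ∀ e → e < s → ψ e ≡ ρ e * h s
    ρ-correct e e<s with h s ℕ.∣? ψ e
    ... | yes (divides c eq) = eq
    ... | no ∤ = contradiction (h∣ψ s e e<s) ∤
    by-quotient : ∀ {hs} → hs ∣ k → hs ≡ h s → Content s ψ
    by-quotient (divides (suc (suc d″)) k≡) refl = record
      { h = h s ; d′ = suc d″ ; ρ = ρ ; h*d≡k = trans (ℕ.*-comm (h s) _) (sym k≡) ; 0<d′ = s≤s z≤n ; ψ≡ρ*h = ρ-correct ; h-gcd = greatest s }
    -- A quotient 1 means that the gcd is k itself, so k divides the entry `ψ e`, although 0 < `ψ e`
    -- < k.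
    by-quotient (divides 1 k≡) refl = contradiction (ℕ.∣⇒≤ {{≢-nonZero ψe≢0}} (subst (_∣ ψ e) (sym (trans k≡ (ℕ.+-identityʳ (h s)))) (h∣ψ s e e<s)))
      (ℕ.<⇒≱ (inb e e<s))

  module _ {s ψ} (C : Content s ψ) where
    open Content C
    open Data.Nat.Solver.+-*-Solver

    d : ℕ
    d = suc d′

    dot-content : ∀ x → dot s ψ x ≡ dot s ρ x * h
    dot-content x = trans (ℕΣ.∑-cong s λ e e<s → trans (cong (_* x e) (ψ≡ρ*h e e<s))
      (solve 3 (λ r h x → r :* h :* x := r :* x :* h) refl (ρ e) h (x e))) (sym (ℕ∑-*ʳ s _ h))

    ŵ-reduce : ∀ m → ŵ (m * h) ≡ ŵ (m % d * h)
    ŵ-reduce m = trans (cong ŵ eq) (ŵ-period (m % d * h) (m / d))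
      where
      eq : m * h ≡ m % d * h + m / d * k
      eq = trans (cong (_* h) (ℕ.m≡m%n+[m/n]*n m d)) (trans (ℕ.*-distribʳ-+ h (m % d) (m / d * d))
        (cong (m % d * h +_) (trans (solve 3 (λ a d h → a :* d :* h := a :* (h :* d)) refl (m / d) d h) (cong (m / d *_) h*d≡k))))

    instance
      h-nonZero : NonZero h
      h-nonZero = ℕ.m*n≢0⇒m≢0 h {{subst NonZero (sym h*d≡k) it}}

    -- The multiples of `h` run `h` times through the subgroup of order `d` while the factor runs
    -- below k; the full sum is k = `h * d`, and `h` cancels.
    ŵ-subgroup-sum : ℕΣ.∑ d (λ l → ŵ (l * h)) ≡ d
    ŵ-subgroup-sum = ℕ.*-cancelˡ-≡ _ _ h (begin
      h * ℕΣ.∑ d (λ l → ŵ (l * h))                     ≡⟨ ℕ∑-const h _ ⟨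
      ℕΣ.∑ h (λ _ → ℕΣ.∑ d (λ l → ŵ (l * h)))          ≡⟨ ℕΣ.∑-cong h (λ i _ → ℕΣ.∑-cong d λ l l<d → sym (trans (ŵ-reduce (i * d + l))
                                                           (cong (λ t → ŵ (t * h)) (DivMod.[j+in]%n≡j i l d l<d)))) ⟩
      ℕΣ.∑ h (λ i → ℕΣ.∑ d (λ l → ŵ ((i * d + l) * h))) ≡⟨ ℕΣ.∑-flatten h d _ ⟨
      ℕΣ.∑ (h * d) (λ m → ŵ (m * h))                   ≡⟨ cong (λ n → ℕΣ.∑ n (λ m → ŵ (m * h))) h*d≡k ⟩
      ℕΣ.∑ k (λ m → ŵ (m * h))                         ≡⟨ ŵ-sum h k∤h 0 ⟩
      k                                                ≡⟨ h*d≡k ⟨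
      h * d                                            ∎)
      where
      open ≡-Reasoning
      k∤h : ¬ k ∣ h
      k∤h k∣h = ℕ.<⇒≱ (subst (h <_) h*d≡k (ℕ.m<m*n h d (s≤s 0<d′))) (ℕ.∣⇒≤ k∣h)

    -- For a vector of order `d` the weight depends only on the class modulo `d`, and the weights of
    -- the classes add up to `d`. A common bound for the class sizes is therefore enough.
    class-bound : ∀ {A : Set} (as : List A) (v : A → ℕ → ℕ) U →
      (∀ l → l < d → length (filter (λ a → l ≟ dot s ρ (v a) % d) as) ≤ U) →
      sumOver as (λ a → ŵ (dot s ψ (v a))) ≤ d * U
    class-bound as v U le = begin
      sumOver as (λ a → ŵ (dot s ψ (v a)))               ≡⟨ sumOver-cong as (λ a → trans (cong ŵ (dot-content (v a))) (ŵ-reduce (dot s ρ (v a)))) ⟩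
      sumOver as (λ a → ŵ (dot s ρ (v a) % d * h))       ≡⟨ sumOver-classes d (λ a → dot s ρ (v a)) (λ l → ŵ (l * h)) as ⟩
      ℕΣ.∑ d (λ l → ŵ (l * h) * length (filter (λ a → l ≟ dot s ρ (v a) % d) as))
                                                         ≤⟨ ℕ∑-mono-≤ d (λ l l<d → ℕ.*-monoʳ-≤ (ŵ (l * h)) (le l l<d)) ⟩
      ℕΣ.∑ d (λ l → ŵ (l * h) * U)                       ≡⟨ ℕ∑-*ʳ d _ U ⟨
      ℕΣ.∑ d (λ l → ŵ (l * h)) * U                       ≡⟨ cong (_* U) ŵ-subgroup-sum ⟩
      d * U                                              ∎
      where open ℕ.≤-Reasoning

    -- The exponents r_j(e) of the auxiliary polynomial: the multiple `j` of ψ, reduced modulo k.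
    -- They form a cyclic group of order `d`.
    exponent : ℕ → ℕ → ℕ
    exponent j e = (j * (ρ e * h)) % k

    exponent-<k : ∀ j e → exponent j e < k
    exponent-<k j e = ℕ.m%n<n (j * (ρ e * h)) k

    exponent-add : ∀ i j e → (exponent i e + exponent j e ≡ exponent ((i + j) % d) e) ⊎ (exponent i e + exponent j e ≡ k + exponent ((i + j) % d) e)
    exponent-add i j e = carry (exponent i e + exponent j e) (exponent ((i + j) % d) e)
        (ℕ.+-mono-< (exponent-<k i e) (exponent-<k j e)) (exponent-<k ((i + j) % d) e) (begin
      (exponent i e + exponent j e) % k                         ≡⟨ ℕ.%-distribˡ-+ (i * (ρ e * h)) (j * (ρ e * h)) k ⟨
      (i * (ρ e * h) + j * (ρ e * h)) % k                       ≡⟨ cong (_% k) (sym (ℕ.*-distribʳ-+ (ρ e * h) i j)) ⟩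
      ((i + j) * (ρ e * h)) % k                                 ≡⟨ cong (λ t → (t * (ρ e * h)) % k) (ℕ.m≡m%n+[m/n]*n (i + j) d) ⟩
      (((i + j) % d + (i + j) / d * d) * (ρ e * h)) % k         ≡⟨ cong (_% k) (solve 5 (λ a b d r h → (a :+ b :* d) :* (r :* h) := a :* (r :* h) :+ b :* r :* (h :* d)) refl ((i + j) % d) ((i + j) / d) d (ρ e) h) ⟩
      ((i + j) % d * (ρ e * h) + (i + j) / d * ρ e * (h * d)) % k ≡⟨ cong (λ t → ((i + j) % d * (ρ e * h) + (i + j) / d * ρ e * t) % k) h*d≡k ⟩
      ((i + j) % d * (ρ e * h) + (i + j) / d * ρ e * k) % k     ≡⟨ ℕ.[m+kn]%n≡m%n ((i + j) % d * (ρ e * h)) ((i + j) / d * ρ e) k ⟩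
      exponent ((i + j) % d) e                                  ∎)
      where
      open ≡-Reasoning
      carry : ∀ a b → a < k + k → b < k → a % k ≡ b → a ≡ b ⊎ a ≡ k + b
      carry a b a<2k b<k eq with a <? k
      ... | yes a<k = inj₁ (trans (sym (ℕ.m<n⇒m%n≡m a<k)) eq)
      ... | no a≮k with ℕ.m≤n⇒∃[o]m+o≡n (ℕ.≮⇒≥ a≮k)
      ...   | o , refl = inj₂ (cong (k +_) (trans (sym (ℕ.m<n⇒m%n≡m (ℕ.+-cancelˡ-< k o k a<2k))) (trans (sym (ℕ.[m+n]%n≡m%n o k))
        (trans (cong (_% k) (ℕ.+-comm o k)) eq))))

    -- Equality in all coordinates would give k ∣ (j - i) ψ(e) for all e, hence k ∣ (j - i) h by
    -- `h-gcd`, so `d` would divide j - i, which lies strictly between 0 and `d`.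
    exponent-distinct : ∀ i j → i < j → j < d → ∃ λ e → e < s × exponent i e ≢ exponent j e
    exponent-distinct i j i<j j<d with ℕ.anyUpTo? (λ e → ¬? (exponent i e ≟ exponent j e)) s
    ... | yes p = p
    ... | no ∄ = contradiction (ℕ.∣⇒≤ {{>-nonZero (ℕ.m<n⇒0<n∸m i<j)}} (ℕ.*-cancelˡ-∣ h (subst (_∣ h * (j ∸ i)) (sym h*d≡k)
        (subst (k ∣_) (ℕ.*-comm (j ∸ i) h) (h-gcd (j ∸ i) λ e e<s → subst (λ t → k ∣ (j ∸ i) * t) (sym (ψ≡ρ*h e e<s)) (difference e e<s))))))
      (ℕ.<⇒≱ (ℕ.≤-<-trans (ℕ.m∸n≤m j i) j<d))
      where
      difference : ∀ e → e < s → k ∣ (j ∸ i) * (ρ e * h)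
      difference e e<s = let t = ρ e * h in ℕ.∣m+n∣m⇒∣n (divides ((j * t) / k) (ℕ.+-cancelˡ-≡ ((i * t) % k) _ _ (begin
        (i * t) % k + ((i * t) / k * k + (j ∸ i) * t)  ≡⟨ ℕ.+-assoc ((i * t) % k) _ _ ⟨
        (i * t) % k + (i * t) / k * k + (j ∸ i) * t    ≡⟨ cong (_+ (j ∸ i) * t) (ℕ.m≡m%n+[m/n]*n (i * t) k) ⟨
        i * t + (j ∸ i) * t                            ≡⟨ ℕ.*-distribʳ-+ t i (j ∸ i) ⟨
        (i + (j ∸ i)) * t                              ≡⟨ cong (_* t) (ℕ.m+[n∸m]≡n (ℕ.<⇒≤ i<j)) ⟩
        j * t                                          ≡⟨ ℕ.m≡m%n+[m/n]*n (j * t) k ⟩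
        (j * t) % k + (j * t) / k * k                  ≡⟨ cong (_+ (j * t) / k * k) (sym same) ⟩
        (i * t) % k + (j * t) / k * k                  ∎))) (ℕ.∣n⇒∣m*n ((i * t) / k) ℕ.∣-refl)
        where
        open ≡-Reasoning
        same : exponent i e ≡ exponent j e
        same with exponent i e ≟ exponent j e
        ... | yes eq = eq
        ... | no neq = contradiction (e , e<s , neq) ∄

-- The parameters of Stepanov's bound for a vector of order d, in terms of M = ⌊√q⌋.
module Parameters (j σ : ℕ) where
  open Data.Nat.Solver.+-*-Solver

  k κ s Θ : ℕ
  k = 2 + j
  κ = 1 + j
  s = suc σ
  Θ = 1 + k * σ + (k + s * κ)

  module Bounds {q n₀ M : ℕ} (q≡ : q ≡ suc (k * n₀)) (M²≤q : M * M ≤ q) (q≤ : q ≤ M * (M + 2)) (ks<M : suc (k * s) ≤ M) (6≤M : 6 ≤ M)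
    {h d′ : ℕ} (hd≡k : h * suc d′ ≡ k) where
    -- `A` is the largest degree that the zero estimate admits: `d * (A + s)` equals q - 1. `P` is
    -- the number of unknowns per layer, and `N` is what remains of it after the `M` conditions that
    -- each further layer adds.
    d A P N : ℕ
    d = suc d′
    A = h * n₀ ∸ s
    P = d * A
    N = P ∸ M

    instance
      M-nonZero : NonZero M
      M-nonZero = >-nonZero (ℕ.≤-trans (s≤s z≤n) 6≤M)

      h-nonZero : NonZero h
      h-nonZero = ℕ.m*n≢0⇒m≢0 h {{subst NonZero (sym hd≡k) _}}

    d≤k : d ≤ k
    d≤k = subst (d ≤_) (trans (ℕ.*-comm d h) hd≡k) (ℕ.m≤m*n d h)

    d*hn₀ : suc (d * (h * n₀)) ≡ q
    d*hn₀ = trans (cong suc (trans (solve 3 (λ d h n → d :* (h :* n) := h :* d :* n) refl d h n₀) (cong (_* n₀) hd≡k))) (sym q≡)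

    1+ds≤M : suc (d * s) ≤ M
    1+ds≤M = ℕ.≤-trans (s≤s (ℕ.*-monoˡ-≤ s d≤k)) ks<M

    M≤q : M ≤ q
    M≤q = ℕ.≤-trans (ℕ.m≤m*n M M) M²≤q

    A+s : A + s ≡ h * n₀
    A+s = ℕ.m∸n+n≡m (ℕ.*-cancelˡ-≤ d (ℕ.≤-pred (ℕ.≤-trans 1+ds≤M (ℕ.≤-trans M≤q (ℕ.≤-reflexive (sym d*hn₀))))))

    1+P+ds : suc (P + d * s) ≡ q
    1+P+ds = trans (cong suc (trans (sym (ℕ.*-distribˡ-+ d A s)) (cong (d *_) A+s))) d*hn₀

    4M≤N : 4 * M ≤ N
    4M≤N = ℕ.m+n≤o⇒m≤o∸n (4 * M) (ℕ.+-cancelʳ-≤ M _ _ (begin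
      4 * M + M + M           ≡⟨ solve 1 (λ m → con 4 :* m :+ m :+ m := con 6 :* m) refl M ⟩
      6 * M                   ≤⟨ ℕ.*-monoˡ-≤ M 6≤M ⟩
      M * M                   ≤⟨ M²≤q ⟩
      q                       ≡⟨ 1+P+ds ⟨
      suc (P + d * s)         ≡⟨ ℕ.+-suc P (d * s) ⟨
      P + suc (d * s)         ≤⟨ ℕ.+-monoʳ-≤ P 1+ds≤M ⟩
      P + M                   ∎))
      where open ℕ.≤-Reasoning

    N+M : N + M ≡ P
    N+M = ℕ.m∸n+n≡m {P} {M} (ℕ.≮⇒≥ λ P<M → ℕ.<⇒≱ (ℕ.≤-trans (s≤s z≤n) (ℕ.≤-trans 6≤M (ℕ.m≤n*m M 4)))
      (ℕ.≤-trans 4M≤N (ℕ.≤-reflexive (ℕ.m≤n⇒m∸n≡0 (ℕ.<⇒≤ P<M)))))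

    instance
      N-nonZero : NonZero N
      N-nonZero = >-nonZero (ℕ.≤-trans (ℕ.≤-trans (s≤s z≤n) 6≤M) (ℕ.≤-trans (ℕ.m≤n*m M 4) 4M≤N))

    -- The least number of layers for which the `B * P` unknowns outnumber the `M * (A + B + σ * M)`
    -- conditions; this rearranges to `BN>`.
    B : ℕ
    B = suc (M * (A + σ * M) / N)

    BN> : M * (A + σ * M) < B * N
    BN> = begin-strict
      M * (A + σ * M)                                                    ≡⟨ ℕ.m≡m%n+[m/n]*n (M * (A + σ * M)) N ⟩
      M * (A + σ * M) % N + M * (A + σ * M) / N * N                      <⟨ ℕ.+-monoˡ-< _ (ℕ.m%n<n (M * (A + σ * M)) N) ⟩
      N + M * (A + σ * M) / N * N                                        ∎
      where open ℕ.≤-Reasoning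

    BN≤ : B * N ≤ N + M * (A + σ * M)
    BN≤ = ℕ.+-monoʳ-≤ N (ℕ.m/n*n≤m (M * (A + σ * M)) N)

    size : suc (d * (A + s)) ≤ q
    size = ℕ.≤-reflexive (trans (cong (λ t → suc (d * t)) A+s) d*hn₀)

    count : M * (A + B + σ * M) < B * (d * A)
    count = begin-strict
      M * (A + B + σ * M)            ≡⟨ solve 4 (λ m a b t → m :* (a :+ b :+ t) := m :* (a :+ t) :+ b :* m) refl M A B (σ * M) ⟩
      M * (A + σ * M) + B * M        <⟨ ℕ.+-monoˡ-< (B * M) BN> ⟩
      B * N + B * M                  ≡⟨ ℕ.*-distribˡ-+ B N M ⟨
      B * (N + M)                    ≡⟨ cong (B *_) N+M ⟩
      B * (d * A)                    ∎
      where open ℕ.≤-Reasoning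

    -- `N` falls short of q by at most 2M, and M² ≤ q, so q / N is at most 1 + 3 / M.
    qM≤ : q * M ≤ (M + 3) * N
    qM≤ = ℕ.+-cancelʳ-≤ ((M + 3) * (M + M)) _ _ (begin
      q * M + (M + 3) * (M + M)        ≡⟨ cong (q * M +_) (solve 1 (λ m → (m :+ con 3) :* (m :+ m) := con 6 :* m :+ con 2 :* (m :* m)) refl M) ⟩
      q * M + (6 * M + 2 * (M * M))    ≤⟨ ℕ.+-monoʳ-≤ (q * M) (ℕ.+-mono-≤ (ℕ.≤-trans (ℕ.*-monoˡ-≤ M 6≤M) M²≤q) (ℕ.*-monoʳ-≤ 2 M²≤q)) ⟩
      q * M + (q + 2 * q)              ≡⟨ solve 2 (λ q m → q :* m :+ (q :+ con 2 :* q) := (m :+ con 3) :* q) refl q M ⟩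
      (M + 3) * q                      ≤⟨ ℕ.*-monoʳ-≤ (M + 3) q≤N+2M ⟩
      (M + 3) * (N + (M + M))          ≡⟨ ℕ.*-distribˡ-+ (M + 3) N (M + M) ⟩
      (M + 3) * N + (M + 3) * (M + M)  ∎)
      where
      open ℕ.≤-Reasoning
      q≤N+2M : q ≤ N + (M + M)
      q≤N+2M = begin
        q                  ≡⟨ trans (sym 1+P+ds) (sym (ℕ.+-suc P (d * s))) ⟩
        P + suc (d * s)    ≤⟨ ℕ.+-monoʳ-≤ P 1+ds≤M ⟩
        P + M              ≡⟨ cong (_+ M) N+M ⟨
        N + M + M          ≡⟨ ℕ.+-assoc N M M ⟩
        N + (M + M)        ∎

    rest≤ : d * q + d * (s * (n₀ * κ)) ≤ (k + s * κ) * ((M + 3) * M)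
    rest≤ = begin
      d * q + d * (s * (n₀ * κ))       ≤⟨ ℕ.+-mono-≤ (ℕ.*-monoˡ-≤ q d≤k) (ℕ.*-monoˡ-≤ (s * (n₀ * κ)) d≤k) ⟩
      k * q + k * (s * (n₀ * κ))       ≡⟨ cong (k * q +_) (solve 4 (λ k s n c → k :* (s :* (n :* c)) := s :* c :* (k :* n)) refl k s n₀ κ) ⟩
      k * q + s * κ * (k * n₀)         ≤⟨ ℕ.+-monoʳ-≤ (k * q) (ℕ.*-monoʳ-≤ (s * κ) (ℕ.≤-trans (ℕ.n≤1+n (k * n₀)) (ℕ.≤-reflexive (sym q≡)))) ⟩
      k * q + s * κ * q                ≡⟨ ℕ.*-distribʳ-+ q k (s * κ) ⟨
      (k + s * κ) * q                  ≤⟨ ℕ.*-monoʳ-≤ (k + s * κ) (ℕ.≤-trans q≤ (ℕ.≤-trans (ℕ.≤-reflexive (ℕ.*-comm M (M + 2))) (ℕ.*-monoˡ-≤ M (ℕ.+-monoʳ-≤ M (ℕ.n≤1+n 2))))) ⟩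
      (k + s * κ) * ((M + 3) * M)      ∎
      where open ℕ.≤-Reasoning

    -- Together with Stepanov's inequality for `M` times a class size, this bounds every class by (q
    -- + Θ(M + 3)) / d. In Θ the part 1 + kσ comes from replacing `P + d * σ * M` by `N`, the part k
    -- from rounding `B` up, and sκ from the degrees of the y_j.
    bound : d * (q * B + s * (n₀ * κ)) ≤ (q + Θ * (M + 3)) * M
    bound = ℕ.*-cancelʳ-≤ _ _ N (begin
      d * (q * B + s * (n₀ * κ)) * N
        ≡⟨ solve 5 (λ d q b t n → d :* (q :* b :+ t) :* n := d :* q :* (b :* n) :+ d :* t :* n) refl d q B (s * (n₀ * κ)) N ⟩
      d * q * (B * N) + d * (s * (n₀ * κ)) * N
        ≤⟨ ℕ.+-monoˡ-≤ _ (ℕ.*-monoʳ-≤ (d * q) BN≤) ⟩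
      d * q * (N + M * (A + σ * M)) + d * (s * (n₀ * κ)) * N
        ≡⟨ solve 7 (λ d q n m a σ t → d :* q :* (n :+ m :* (a :+ σ :* m)) :+ d :* t :* n := q :* m :* (d :* a :+ d :* σ :* m) :+ (d :* q :+ d :* t) :* n) refl d q N M A σ (s * (n₀ * κ)) ⟩
      q * M * (P + d * σ * M) + (d * q + d * (s * (n₀ * κ))) * N
        ≡⟨ cong (λ t → q * M * (t + d * σ * M) + (d * q + d * (s * (n₀ * κ))) * N) (sym N+M) ⟩
      q * M * (N + M + d * σ * M) + (d * q + d * (s * (n₀ * κ))) * N
        ≡⟨ cong (_+ (d * q + d * (s * (n₀ * κ))) * N) (solve 4 (λ q m n e → q :* m :* (n :+ m :+ e :* m) := q :* m :* n :+ (con 1 :+ e) :* m :* (q :* m)) refl q M N (d * σ)) ⟩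
      q * M * N + (1 + d * σ) * M * (q * M) + (d * q + d * (s * (n₀ * κ))) * N
        ≤⟨ ℕ.+-mono-≤ (ℕ.+-monoʳ-≤ (q * M * N) (ℕ.*-mono-≤ (ℕ.*-monoˡ-≤ M (s≤s (ℕ.*-monoˡ-≤ σ d≤k))) qM≤)) (ℕ.*-monoˡ-≤ N rest≤) ⟩
      q * M * N + (1 + k * σ) * M * ((M + 3) * N) + (k + s * κ) * ((M + 3) * M) * N
        ≡⟨ solve 5 (λ q m n u v → q :* m :* n :+ u :* m :* ((m :+ con 3) :* n) :+ v :* ((m :+ con 3) :* m) :* n := (q :+ (u :+ v) :* (m :+ con 3)) :* m :* n) refl q M N (1 + k * σ) (k + s * κ) ⟩
      (q + Θ * (M + 3)) * M * N ∎)
      where open ℕ.≤-Reasoning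

  -- `k ^ s * Ψ` is one less than the coefficient `B` of the numerical hypothesis for t = s + 3.
  Ψ : ℕ
  Ψ = k * k * (s + 1 + j * (s + 2))

  -- The difference is a polynomial in `j` = k - 2 with nonnegative coefficients and without
  -- constant term; at k = 2 both sides agree.
  Ψ-≥ : Θ + (s + 3) ≤ Ψ
  Ψ-≥ = ℕ.≤-trans (ℕ.m≤m+n _ (12 * j + 6 * j * s + j * j * (5 * s + 9 + j * (s + 2)))) (ℕ.≤-reflexive
    (solve 2 (λ j σ → con 1 :+ (con 2 :+ j) :* σ :+ ((con 2 :+ j) :+ (con 1 :+ σ) :* (con 1 :+ j)) :+ ((con 1 :+ σ) :+ con 3) :+
        (con 12 :* j :+ con 6 :* j :* (con 1 :+ σ) :+ j :* j :* (con 5 :* (con 1 :+ σ) :+ con 9 :+ j :* ((con 1 :+ σ) :+ con 2)))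
      := (con 2 :+ j) :* (con 2 :+ j) :* ((con 1 :+ σ) :+ con 1 :+ j :* ((con 1 :+ σ) :+ con 2))) refl j σ))

  2k²≤Ψ : 2 * (k * k) ≤ Ψ
  2k²≤Ψ = ℕ.≤-trans (ℕ.≤-reflexive (ℕ.*-comm 2 (k * k))) (ℕ.*-monoʳ-≤ (k * k) (ℕ.≤-trans (ℕ.+-monoˡ-≤ 1 (s≤s z≤n)) (ℕ.m≤m+n (s + 1) _)))

  -- The number of pigeonholes: k³ triples of classes for a, a - 1, a + 1, and the exceptional
  -- elements 0, 1, -1.
  ν : ℕ
  ν = k * (k * k) + 3

  -- The reverse inequality would hold if at most `ν` elements were good. All terms not multiplied
  -- by `M` are absorbed into `(s + 3) * M`, for which `Ψ-≥` leaves room.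
  main : ∀ {q M} → M * M ≤ q → k ^ s * Ψ ≤ M → k ^ s * (Θ * (M + 3) + s + ν) < q
  main {q} {M} M²≤q QΨ≤M = begin-strict
    Q * (Θ * (M + 3) + s + ν)                 ≡⟨ cong (Q *_) (solve 4 (λ t m s n → t :* (m :+ con 3) :+ s :+ n := t :* m :+ (con 3 :* t :+ s :+ n)) refl Θ M s ν) ⟩
    Q * (Θ * M + (3 * Θ + s + ν))             <⟨ ℕ.*-monoʳ-< Q (ℕ.+-monoʳ-< (Θ * M) small) ⟩
    Q * (Θ * M + (s + 3) * M)                 ≡⟨ cong (Q *_) (ℕ.*-distribʳ-+ M Θ (s + 3)) ⟨
    Q * ((Θ + (s + 3)) * M)                   ≤⟨ ℕ.*-monoʳ-≤ Q (ℕ.*-monoˡ-≤ M Ψ-≥) ⟩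
    Q * (Ψ * M)                               ≡⟨ ℕ.*-assoc Q Ψ M ⟨
    Q * Ψ * M                                 ≤⟨ ℕ.*-monoˡ-≤ M QΨ≤M ⟩
    M * M                                     ≤⟨ M²≤q ⟩
    q                                         ∎
    where
    open ℕ.≤-Reasoning
    Q : ℕ
    Q = k ^ s
    instance
      Q-nonZero : NonZero Q
      Q-nonZero = ℕ.m^n≢0 k s
    kΨ≤M : k * Ψ ≤ M
    kΨ≤M = ℕ.≤-trans (ℕ.*-monoˡ-≤ Ψ (ℕ.m≤m*n k (k ^ σ) {{ℕ.m^n≢0 k σ}})) QΨ≤M
    small : 3 * Θ + s + ν < (s + 3) * M
    small = begin-strict
      3 * Θ + s + ν                       <⟨ ℕ.+-monoˡ-< ν (ℕ.≤-trans (ℕ.≤-trans (ℕ.m≤m+n (suc (3 * Θ + s)) (2 * s + 8)) (ℕ.≤-reflexive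
                                               (solve 2 (λ t s → con 1 :+ (con 3 :* t :+ s) :+ (con 2 :* s :+ con 8) := con 3 :* (t :+ (s :+ con 3))) refl Θ s))) (ℕ.*-monoʳ-≤ 3 Ψ-≥)) ⟩
      3 * Ψ + ν                           ≤⟨ ℕ.+-mono-≤ (ℕ.≤-trans (ℕ.*-monoʳ-≤ 3 (ℕ.m≤n*m Ψ k)) (ℕ.*-monoʳ-≤ 3 kΨ≤M)) ν≤M ⟩
      3 * M + M                           ≡⟨ ℕ.+-comm (3 * M) M ⟩
      4 * M                               ≤⟨ ℕ.*-monoˡ-≤ M (ℕ.+-monoˡ-≤ 3 {1} {s} (s≤s z≤n)) ⟩
      (s + 3) * M                         ∎
      where
      ν≤M : ν ≤ M
      ν≤M = begin
        k * (k * k) + 3                 ≤⟨ ℕ.+-monoʳ-≤ (k * (k * k)) (ℕ.≤-trans (ℕ.m≤m+n 3 5) (ℕ.*-mono-≤ {2} {k} (s≤s (s≤s z≤n)) (ℕ.*-mono-≤ {2} {k} {2} {k} (s≤s (s≤s z≤n)) (s≤s (s≤s z≤n))))) ⟩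
        k * (k * k) + k * (k * k)       ≡⟨ solve 1 (λ k → k :* (k :* k) :+ k :* (k :* k) := k :* (con 2 :* (k :* k))) refl k ⟩
        k * (2 * (k * k))               ≤⟨ ℕ.*-monoʳ-≤ k 2k²≤Ψ ⟩
        k * Ψ                           ≤⟨ kΨ≤M ⟩
        M                               ∎

-- Integer square roots, lists, and the numerical hypothesis over ℕ

isqrt : ∀ n → ∃ λ M → M * M ≤ n × n < suc M * suc M
isqrt zero = 0 , z≤n , s≤s z≤n
isqrt (suc n) with isqrt n
... | M , M²≤n , n< with suc M * suc M ≤? suc n
...   | yes le = suc M , le , ℕ.≤-trans (s≤s n<) (ℕ.*-mono-< (ℕ.n<1+n (suc M)) (ℕ.n<1+n (suc M)))
...   | no gt  = M , ℕ.m≤n⇒m≤1+n M²≤n , ℕ.≰⇒> gt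

length-filter-¬ : ∀ {A : Set} {P : A → Set} (P? : ∀ a → Dec (P a)) as →
  length (filter P? as) + length (filter (¬? ∘ P?) as) ≡ length as
length-filter-¬ P? [] = refl
length-filter-¬ P? (a ∷ as) with P? a
... | yes _ = cong suc (length-filter-¬ P? as)
... | no _  = trans (ℕ.+-suc _ _) (cong suc (length-filter-¬ P? as))

sumOver-1 : ∀ {A : Set} (as : List A) → sumOver as (λ _ → 1) ≡ length as
sumOver-1 []       = refl
sumOver-1 (a ∷ as) = cong suc (sumOver-1 as)

nth : {A : Set} → A → List A → ℕ → A
nth x []       i       = x
nth x (a ∷ as) zero    = a
nth x (a ∷ as) (suc i) = nth x as i

nth-∈ : ∀ {A : Set} x (as : List A) i → i < length as → nth x as i ∈ as
nth-∈ x (a ∷ as) zero    _         = here refl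
nth-∈ x (a ∷ as) (suc i) (s≤s i<n) = there (nth-∈ x as i i<n)

∈-nth : ∀ {A : Set} x {a : A} as → a ∈ as → ∃ λ i → i < length as × a ≡ nth x as i
∈-nth x (a ∷ as) (here refl) = 0 , s≤s z≤n , refl
∈-nth x (a ∷ as) (there a∈) = let i , i<n , eq = ∈-nth x as a∈ in suc i , s≤s i<n , eq

nth-injective : ∀ {A : Set} x (as : List A) → Unique as → ∀ i j → i < length as → j < length as → nth x as i ≡ nth x as j → i ≡ j
nth-injective x (a ∷ as) (a∉ ∷ u) zero    zero    _         _         eq = refl
nth-injective x (a ∷ as) (a∉ ∷ u) zero    (suc j) _         (s≤s j<n) eq = contradiction eq (All.lookup a∉ (nth-∈ x as j j<n))
nth-injective x (a ∷ as) (a∉ ∷ u) (suc i) zero    (s≤s i<n) _         eq = contradiction (sym eq) (All.lookup a∉ (nth-∈ x as i i<n))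
nth-injective x (a ∷ as) (a∉ ∷ u) (suc i) (suc j) (s≤s i<n) (s≤s j<n) eq = cong suc (nth-injective x as u i j i<n j<n eq)

list-pigeonhole : ∀ {A : Set} (as : List A) → Unique as → ∀ m → m < length as → (f : A → ℕ) → (∀ a → f a < m) →
  ∃ λ a → ∃ λ b → a ∈ as × b ∈ as × a ≢ b × f a ≡ f b
list-pigeonhole [] u m () f f<
list-pigeonhole {A} as@(x ∷ _) u m m<n f f< with Fin.pigeonhole m<n index
  where
  index : Fin.Fin (length as) → Fin.Fin m
  index i = Fin.fromℕ< (f< (nth x as (Fin.toℕ i)))
... | i , j , i<j , eq = nth x as (Fin.toℕ i) , nth x as (Fin.toℕ j) , nth-∈ x as _ (Fin.toℕ<n i) , nth-∈ x as _ (Fin.toℕ<n j)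
  , (λ same → ℕ.<⇒≢ i<j (nth-injective x as u _ _ (Fin.toℕ<n i) (Fin.toℕ<n j) same))
  , trans (sym (Fin.toℕ-fromℕ< _)) (trans (cong Fin.toℕ eq) (Fin.toℕ-fromℕ< _))

bound⇒T+K<m : ∀ t k m → BoundHolds t k m → t * k ^ (t ∸ 1) + k ^ t < m
bound⇒T+K<m t k m (0<L , _) = ℤ.drop‿+<+ (subst₂ ℤ._<_ (ℤ.+-identityˡ _) L+T+K (ℤ.+-monoˡ-< (ℤ.+ (T + K)) 0<L))
  where
  open Data.Integer.Solver.+-*-Solver
  T K : ℕ
  T = t * k ^ (t ∸ 1)
  K = k ^ t
  L+T+K : (ℤ.+ m ℤ.- ℤ.+ T ℤ.- ℤ.+ K) ℤ.+ ℤ.+ (T + K) ≡ ℤ.+ m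
  L+T+K = trans (cong (λ z → (ℤ.+ m ℤ.- ℤ.+ T ℤ.- ℤ.+ K) ℤ.+ z) (ℤ.pos-+ T K))
    (solve 3 (λ m t k → m :- t :- k :+ (t :+ k) := m) refl (ℤ.+ m) (ℤ.+ T) (ℤ.+ K))

-- As 0 < L ≤ m, the hypothesis gives B² m < L² ≤ m², and a factor m cancels. The equation
-- characterises `B` without subtraction.
bound⇒B²<m : ∀ t k m B → B + k ^ t + t * k ^ (t ∸ 1) ≡ t * k ^ t + 1 → BoundHolds t k m → B * B < m
bound⇒B²<m t k m B eq h@(_ , B²m<L²) = ℕ.*-cancelʳ-< m (B * B) m (ℕ.<-≤-trans (ℤ.drop‿+<+ (subst₂ ℤ._<_ B²m L² B²m<L²)) (ℕ.*-mono-≤ L≤m L≤m))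
  where
  open Data.Integer.Solver.+-*-Solver
  T K L : ℕ
  T = t * k ^ (t ∸ 1)
  K = k ^ t
  L = m ∸ (T + K)
  L≤m : L ≤ m
  L≤m = ℕ.m∸n≤m m (T + K)
  B≡ : ℤ.+ (t * K) ℤ.- ℤ.+ K ℤ.- ℤ.+ T ℤ.+ ℤ.+ 1 ≡ ℤ.+ B
  B≡ = begin
    ℤ.+ (t * K) ℤ.- ℤ.+ K ℤ.- ℤ.+ T ℤ.+ ℤ.+ 1            ≡⟨ solve 4 (λ x k t o → x :- k :- t :+ o := x :+ o :- k :- t) refl (ℤ.+ (t * K)) (ℤ.+ K) (ℤ.+ T) (ℤ.+ 1) ⟩
    (ℤ.+ (t * K) ℤ.+ ℤ.+ 1) ℤ.- ℤ.+ K ℤ.- ℤ.+ T          ≡⟨ cong (λ z → z ℤ.- ℤ.+ K ℤ.- ℤ.+ T) (trans (sym (ℤ.pos-+ (t * K) 1)) (trans (cong ℤ.+_ (sym eq))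
                                                              (trans (ℤ.pos-+ (B + K) T) (cong (ℤ._+ ℤ.+ T) (ℤ.pos-+ B K))))) ⟩
    (ℤ.+ B ℤ.+ ℤ.+ K ℤ.+ ℤ.+ T) ℤ.- ℤ.+ K ℤ.- ℤ.+ T      ≡⟨ solve 3 (λ b k t → b :+ k :+ t :- k :- t := b) refl (ℤ.+ B) (ℤ.+ K) (ℤ.+ T) ⟩
    ℤ.+ B                                                ∎
    where open ≡-Reasoning
  L≡ : ℤ.+ m ℤ.- ℤ.+ T ℤ.- ℤ.+ K ≡ ℤ.+ L
  L≡ = begin
    ℤ.+ m ℤ.- ℤ.+ T ℤ.- ℤ.+ K      ≡⟨ solve 3 (λ m t k → m :- t :- k := m :- (t :+ k)) refl (ℤ.+ m) (ℤ.+ T) (ℤ.+ K) ⟩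
    ℤ.+ m ℤ.- (ℤ.+ T ℤ.+ ℤ.+ K)    ≡⟨ cong (λ z → ℤ.+ m ℤ.- z) (ℤ.pos-+ T K) ⟨
    ℤ.+ m ℤ.- ℤ.+ (T + K)          ≡⟨ ℤ.m-n≡m⊖n m (T + K) ⟩
    m ℤ.⊖ (T + K)                  ≡⟨ ℤ.⊖-≥ (ℕ.<⇒≤ (bound⇒T+K<m t k m h)) ⟩
    ℤ.+ L                          ∎
    where open ≡-Reasoning
  B²m : (ℤ.+ (t * K) ℤ.- ℤ.+ K ℤ.- ℤ.+ T ℤ.+ ℤ.+ 1) ℤ.* (ℤ.+ (t * K) ℤ.- ℤ.+ K ℤ.- ℤ.+ T ℤ.+ ℤ.+ 1) ℤ.* ℤ.+ m ≡ ℤ.+ (B * B * m)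
  B²m = trans (cong (λ z → z ℤ.* z ℤ.* ℤ.+ m) B≡) (trans (cong (ℤ._* ℤ.+ m) (sym (ℤ.pos-* B B))) (sym (ℤ.pos-* (B * B) m)))
  L² : (ℤ.+ m ℤ.- ℤ.+ T ℤ.- ℤ.+ K) ℤ.* (ℤ.+ m ℤ.- ℤ.+ T ℤ.- ℤ.+ K) ≡ ℤ.+ (L * L)
  L² = trans (cong (λ z → z ℤ.* z) L≡) (sym (ℤ.pos-* L L))

-- Least common multiples and the list of all multipliers

lcmF-∣ : ∀ n b c i → b i ∣ lcmF n b c
lcmF-∣ (suc n) b c Fin.zero    = ℕ.m∣lcm[m,n] (b Fin.zero) _
lcmF-∣ (suc n) b c (Fin.suc i) = ℕ.∣-trans (lcmF-∣ n (b ∘ Fin.suc) c i) (ℕ.n∣lcm[m,n] (b Fin.zero) _)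

lcmF-∣ᶜ : ∀ n b c → c ∣ lcmF n b c
lcmF-∣ᶜ zero    b c = ℕ.∣-refl
lcmF-∣ᶜ (suc n) b c = ℕ.∣-trans (lcmF-∣ᶜ n (b ∘ Fin.suc) c) (ℕ.n∣lcm[m,n] (b Fin.zero) _)

lcmF-≢0 : ∀ n b c → (∀ i → 0 < b i) → 0 < c → lcmF n b c ≢ 0
lcmF-≢0 zero    b c 0<b 0<c eq = ℕ.<⇒≢ 0<c (sym eq)
lcmF-≢0 (suc n) b c 0<b 0<c eq with ℕ.m*n≡0⇒m≡0∨n≡0 (b Fin.zero) (trans (sym (ℕ.gcd*lcm (b Fin.zero) (lcmF n (b ∘ Fin.suc) c)))
  (trans (cong (gcd (b Fin.zero) (lcmF n (b ∘ Fin.suc) c) *_) eq) (ℕ.*-zeroʳ (gcd (b Fin.zero) (lcmF n (b ∘ Fin.suc) c)))))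
... | inj₁ b≡0 = ℕ.<⇒≢ (0<b Fin.zero) (sym b≡0)
... | inj₂ l≡0 = lcmF-≢0 n (b ∘ Fin.suc) c (0<b ∘ Fin.suc) 0<c l≡0

multipliers : ∀ {A : Set} n (b : Fin.Fin n → ℕ) → (∀ i → Fin.Fin (b i) → A) → List A
multipliers zero    b a = []
multipliers (suc n) b a = map (a Fin.zero) (allFin (b Fin.zero)) ++ multipliers n (b ∘ Fin.suc) (a ∘ Fin.suc)

length-multipliers : ∀ {A : Set} n b (a : ∀ i → Fin.Fin (b i) → A) → length (multipliers n b a) ≡ sumF n b
length-multipliers zero    b a = refl
length-multipliers (suc n) b a = trans (List.length-++ (map (a Fin.zero) (allFin (b Fin.zero))))
  (cong₂ _+_ (trans (List.length-map (a Fin.zero) (allFin (b Fin.zero))) (List.length-tabulate (λ i → i))) (length-multipliers n (b ∘ Fin.suc) (a ∘ Fin.suc)))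

∈-multipliers : ∀ {A : Set} n b (a : ∀ i → Fin.Fin (b i) → A) i j → a i j ∈ multipliers n b a
∈-multipliers (suc n) b a Fin.zero    j = ∈.∈-++⁺ˡ (∈.∈-map⁺ (a Fin.zero) (∈.∈-allFin j))
∈-multipliers (suc n) b a (Fin.suc i) j = ∈.∈-++⁺ʳ (map (a Fin.zero) (allFin (b Fin.zero))) (∈-multipliers n (b ∘ Fin.suc) (a ∘ Fin.suc) i j)

-- Field arithmetic and formal power series over F

module FieldTheory (FF : FiniteField) where
  open FiniteField FF
    renaming (_+_ to _+ᶠ_; _*_ to _*ᶠ_; -_ to -ᶠ_; _-_ to _-ᶠ_; _^_ to _^ᶠ_; Carrier to F; size to q)

  F-ring : CommutativeRing 0ℓ 0ℓ
  F-ring = record { isCommutativeRing = isCommutativeRing }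

  module K = CommutativeRing F-ring
  module KS = RingSums F-ring
  module KP = Algebra.Properties.Ring K.ring

  _≟ᶠ_ : ∀ (x y : F) → Dec (x ≡ y)
  x ≟ᶠ y with Inverse.to enum x Fin.≟ Inverse.to enum y
  ... | yes eq = yes (trans (sym (Inverse.strictlyInverseʳ enum x))
                   (trans (cong (Inverse.from enum) eq) (Inverse.strictlyInverseʳ enum y)))
  ... | no neq = no λ x≡y → neq (cong (Inverse.to enum) x≡y)

  _⁻¹ : F → F
  x ⁻¹ with x ≟ᶠ 0#
  ... | yes _ = 0#
  ... | no x≢0 = proj₁ (inverse x x≢0)

  ⁻¹-inverse : ∀ {x} → x ≢ 0# → x *ᶠ x ⁻¹ ≡ 1#
  ⁻¹-inverse {x} x≢0 with x ≟ᶠ 0#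
  ... | yes x≡0 = contradiction x≡0 x≢0
  ... | no x≢0′ = proj₂ (inverse x x≢0′)

  *-cancelˡ : ∀ {x y z} → x ≢ 0# → x *ᶠ y ≡ x *ᶠ z → y ≡ z
  *-cancelˡ {x} {y} {z} x≢0 eq = begin
    y                     ≡⟨ K.*-identityˡ y ⟨
    1# *ᶠ y               ≡⟨ cong (_*ᶠ y) (trans (sym (⁻¹-inverse x≢0)) (K.*-comm x (x ⁻¹))) ⟩
    (x ⁻¹ *ᶠ x) *ᶠ y      ≡⟨ K.*-assoc (x ⁻¹) x y ⟩
    x ⁻¹ *ᶠ (x *ᶠ y)      ≡⟨ cong (x ⁻¹ *ᶠ_) eq ⟩
    x ⁻¹ *ᶠ (x *ᶠ z)      ≡⟨ K.*-assoc (x ⁻¹) x z ⟨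
    (x ⁻¹ *ᶠ x) *ᶠ z      ≡⟨ cong (_*ᶠ z) (trans (K.*-comm (x ⁻¹) x) (⁻¹-inverse x≢0)) ⟩
    1# *ᶠ z               ≡⟨ K.*-identityˡ z ⟩
    z                     ∎
    where open ≡-Reasoning

  *-zero : ∀ {x y} → x ≢ 0# → x *ᶠ y ≡ 0# → y ≡ 0#
  *-zero {x} x≢0 eq = *-cancelˡ x≢0 (trans eq (sym (K.zeroʳ x)))

  *-≢0 : ∀ {x y} → x ≢ 0# → y ≢ 0# → x *ᶠ y ≢ 0#
  *-≢0 x≢0 y≢0 eq = y≢0 (*-zero x≢0 eq)

  ⁻¹-≢0 : ∀ {x} → x ≢ 0# → x ⁻¹ ≢ 0#
  ⁻¹-≢0 {x} x≢0 eq = 0≢1 (trans (sym (K.zeroʳ x)) (trans (cong (x *ᶠ_) (sym eq)) (⁻¹-inverse x≢0)))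

  ^-≢0 : ∀ {x} n → x ≢ 0# → x KS.^ᴿ n ≢ 0#
  ^-≢0 zero    x≢0 eq = 0≢1 (sym eq)
  ^-≢0 (suc n) x≢0 = *-≢0 x≢0 (^-≢0 n x≢0)

  ∏-≢0 : ∀ n (f : ℕ → F) → (∀ i → i < n → f i ≢ 0#) → KS.∏ n f ≢ 0#
  ∏-≢0 zero    f f≢0 eq = 0≢1 (sym eq)
  ∏-≢0 (suc n) f f≢0 = *-≢0 (∏-≢0 n f λ i i<n → f≢0 i (ℕ.m<n⇒m<1+n i<n)) (f≢0 n ℕ.≤-refl)

  -‿≡0 : ∀ {x y} → x -ᶠ y ≡ 0# → x ≡ y
  -‿≡0 {x} {y} eq = trans (KP.+-inverseˡ-unique x (-ᶠ y) eq) (KP.-‿involutive y)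

  -x*-y : ∀ x y → (-ᶠ x) *ᶠ (-ᶠ y) ≡ x *ᶠ y
  -x*-y x y = trans (sym (KP.-‿distribˡ-* x (-ᶠ y))) (trans (cong -ᶠ_ (sym (KP.-‿distribʳ-* x y))) (KP.-‿involutive _))

  x-y+y : ∀ x y → (x -ᶠ y) +ᶠ y ≡ x
  x-y+y x y = trans (K.+-assoc x (-ᶠ y) y) (trans (cong (x +ᶠ_) (K.-‿inverseˡ y)) (K.+-identityʳ x))

  difference : ∀ x y z → -ᶠ (x -ᶠ z) +ᶠ (y -ᶠ z) ≡ y -ᶠ x
  difference x y z = begin
    -ᶠ (x -ᶠ z) +ᶠ (y -ᶠ z)             ≡⟨ K.+-comm _ _ ⟩
    (y -ᶠ z) +ᶠ -ᶠ (x -ᶠ z)             ≡⟨ cong ((y -ᶠ z) +ᶠ_) (trans (KP.-‿anti-homo-+ x (-ᶠ z)) (cong (_+ᶠ -ᶠ x) (KP.-‿involutive z))) ⟩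
    (y -ᶠ z) +ᶠ (z +ᶠ -ᶠ x)             ≡⟨ K.+-assoc _ z (-ᶠ x) ⟨
    (y -ᶠ z) +ᶠ z +ᶠ -ᶠ x               ≡⟨ cong (_+ᶠ -ᶠ x) (x-y+y y z) ⟩
    y -ᶠ x                              ∎
    where open ≡-Reasoning

  Ser : Set
  Ser = ℕ → F

  infix 4 _≋_
  record _≋_ (s t : Ser) : Set where
    constructor mk
    field at : ∀ n → s n ≡ t n
  open _≋_

  infixl 6 _+ˢ_
  infixl 7 _*ˢ_ _·ˢ_

  _+ˢ_ _*ˢ_ : Ser → Ser → Ser
  (s +ˢ t) n = s n +ᶠ t n
  (s *ˢ t) zero    = s 0 *ᶠ t 0
  (s *ˢ t) (suc n) = s 0 *ᶠ t (suc n) +ᶠ ((s ∘ suc) *ˢ t) n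

  -ˢ_ : Ser → Ser
  (-ˢ s) n = -ᶠ s n

  ι : F → Ser
  ι c zero    = c
  ι c (suc _) = 0#

  _·ˢ_ : F → Ser → Ser
  (c ·ˢ s) n = c *ᶠ s n

  *ˢ-cong≤ : ∀ n {s s′ t t′ : Ser} → (∀ i → i ≤ n → s i ≡ s′ i) → (∀ i → i ≤ n → t i ≡ t′ i) →
    (s *ˢ t) n ≡ (s′ *ˢ t′) n
  *ˢ-cong≤ zero    es et = cong₂ _*ᶠ_ (es 0 z≤n) (et 0 z≤n)
  *ˢ-cong≤ (suc n) es et = cong₂ _+ᶠ_ (cong₂ _*ᶠ_ (es 0 z≤n) (et (suc n) ℕ.≤-refl))
    (*ˢ-cong≤ n (λ i i≤n → es (suc i) (s≤s i≤n)) (λ i i≤n → et i (ℕ.m≤n⇒m≤1+n i≤n)))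

  *ˢ-zeroˡ : ∀ {s} t → (∀ n → s n ≡ 0#) → ∀ n → (s *ˢ t) n ≡ 0#
  *ˢ-zeroˡ t s≡0 zero    = trans (cong (_*ᶠ t 0) (s≡0 0)) (K.zeroˡ _)
  *ˢ-zeroˡ t s≡0 (suc n) = trans (cong₂ _+ᶠ_ (trans (cong (_*ᶠ t (suc n)) (s≡0 0)) (K.zeroˡ _)) (*ˢ-zeroˡ t (s≡0 ∘ suc) n))
    (K.+-identityˡ 0#)

  ι-·ˢ : ∀ c s → ι c *ˢ s ≋ c ·ˢ s
  ι-·ˢ c s .at zero    = refl
  ι-·ˢ c s .at (suc n) = trans (cong (c *ᶠ s (suc n) +ᶠ_) (*ˢ-zeroˡ s (λ _ → refl) n)) (K.+-identityʳ _)

  ·ˢ-*ˢ : ∀ c s t n → ((c ·ˢ s) *ˢ t) n ≡ c *ᶠ (s *ˢ t) n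
  ·ˢ-*ˢ c s t zero    = K.*-assoc c (s 0) (t 0)
  ·ˢ-*ˢ c s t (suc n) = trans (cong₂ _+ᶠ_ (K.*-assoc c (s 0) (t (suc n))) (·ˢ-*ˢ c (s ∘ suc) t n))
    (sym (K.distribˡ c _ _))

  *ˢ-distribʳ : ∀ u s t n → ((s +ˢ t) *ˢ u) n ≡ (s *ˢ u) n +ᶠ (t *ˢ u) n
  *ˢ-distribʳ u s t zero    = K.distribʳ (u 0) (s 0) (t 0)
  *ˢ-distribʳ u s t (suc n) = trans
    (cong₂ _+ᶠ_ (K.distribʳ (u (suc n)) (s 0) (t 0)) (*ˢ-distribʳ u (s ∘ suc) (t ∘ suc) n))
    (KS.interchange _ _ _ _)

  *ˢ-unfoldʳ : ∀ s t n → (s *ˢ t) (suc n) ≡ s (suc n) *ᶠ t 0 +ᶠ (s *ˢ (t ∘ suc)) n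
  *ˢ-unfoldʳ s t zero    = K.+-comm _ _
  *ˢ-unfoldʳ s t (suc n) = begin
    s 0 *ᶠ t (2 + n) +ᶠ ((s ∘ suc) *ˢ t) (suc n)
      ≡⟨ cong (s 0 *ᶠ t (2 + n) +ᶠ_) (*ˢ-unfoldʳ (s ∘ suc) t n) ⟩
    s 0 *ᶠ t (2 + n) +ᶠ (s (2 + n) *ᶠ t 0 +ᶠ ((s ∘ suc) *ˢ (t ∘ suc)) n)
      ≡⟨ K.+-assoc _ _ _ ⟨
    s 0 *ᶠ t (2 + n) +ᶠ s (2 + n) *ᶠ t 0 +ᶠ ((s ∘ suc) *ˢ (t ∘ suc)) n
      ≡⟨ cong (_+ᶠ ((s ∘ suc) *ˢ (t ∘ suc)) n) (K.+-comm _ _) ⟩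
    s (2 + n) *ᶠ t 0 +ᶠ s 0 *ᶠ t (2 + n) +ᶠ ((s ∘ suc) *ˢ (t ∘ suc)) n
      ≡⟨ K.+-assoc _ _ _ ⟩
    s (2 + n) *ᶠ t 0 +ᶠ (s 0 *ᶠ t (2 + n) +ᶠ ((s ∘ suc) *ˢ (t ∘ suc)) n) ∎
    where open ≡-Reasoning

  *ˢ-comm : ∀ s t n → (s *ˢ t) n ≡ (t *ˢ s) n
  *ˢ-comm s t zero    = K.*-comm (s 0) (t 0)
  *ˢ-comm s t (suc n) = trans (cong₂ _+ᶠ_ (K.*-comm (s 0) (t (suc n))) (*ˢ-comm (s ∘ suc) t n))
    (sym (*ˢ-unfoldʳ t s n))

  *ˢ-assoc : ∀ s t u n → ((s *ˢ t) *ˢ u) n ≡ (s *ˢ (t *ˢ u)) n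
  *ˢ-assoc s t u zero    = K.*-assoc _ _ _
  *ˢ-assoc s t u (suc n) = begin
    s 0 *ᶠ t 0 *ᶠ u (suc n) +ᶠ ((s 0 ·ˢ (t ∘ suc) +ˢ (s ∘ suc) *ˢ t) *ˢ u) n
      ≡⟨ cong₂ _+ᶠ_ (K.*-assoc _ _ _) (*ˢ-distribʳ u (s 0 ·ˢ (t ∘ suc)) ((s ∘ suc) *ˢ t) n) ⟩
    s 0 *ᶠ (t 0 *ᶠ u (suc n)) +ᶠ (((s 0 ·ˢ (t ∘ suc)) *ˢ u) n +ᶠ (((s ∘ suc) *ˢ t) *ˢ u) n)
      ≡⟨ cong (s 0 *ᶠ (t 0 *ᶠ u (suc n)) +ᶠ_) (cong₂ _+ᶠ_ (·ˢ-*ˢ (s 0) (t ∘ suc) u n) (*ˢ-assoc (s ∘ suc) t u n)) ⟩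
    s 0 *ᶠ (t 0 *ᶠ u (suc n)) +ᶠ (s 0 *ᶠ ((t ∘ suc) *ˢ u) n +ᶠ ((s ∘ suc) *ˢ (t *ˢ u)) n)
      ≡⟨ K.+-assoc _ _ _ ⟨
    s 0 *ᶠ (t 0 *ᶠ u (suc n)) +ᶠ s 0 *ᶠ ((t ∘ suc) *ˢ u) n +ᶠ ((s ∘ suc) *ˢ (t *ˢ u)) n
      ≡⟨ cong (_+ᶠ ((s ∘ suc) *ˢ (t *ˢ u)) n) (K.distribˡ (s 0) _ _) ⟨
    s 0 *ᶠ (t *ˢ u) (suc n) +ᶠ ((s ∘ suc) *ˢ (t *ˢ u)) n ∎
    where open ≡-Reasoning

  Ser-ring : CommutativeRing 0ℓ 0ℓ
  Ser-ring = record
    { Carrier = Ser ; _≈_ = _≋_ ; _+_ = _+ˢ_ ; _*_ = _*ˢ_ ; -_ = -ˢ_ ; 0# = λ _ → 0# ; 1# = ι 1#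
    ; isCommutativeRing = record
      { isRing = record
        { +-isAbelianGroup = record
          { isGroup = record
            { isMonoid = record
              { isSemigroup = record
                { isMagma = record
                  { isEquivalence = record
                    { refl = mk λ _ → refl
                    ; sym = λ s≋t → mk λ n → sym (at s≋t n)
                    ; trans = λ s≋t t≋u → mk λ n → trans (at s≋t n) (at t≋u n) }
                  ; ∙-cong = λ p r → mk λ n → cong₂ _+ᶠ_ (at p n) (at r n) }
                ; assoc = λ s t u → mk λ n → K.+-assoc _ _ _ }
              ; identity = (λ s → mk λ n → K.+-identityˡ _) , (λ s → mk λ n → K.+-identityʳ _) }
            ; inverse = (λ s → mk λ n → K.-‿inverseˡ _) , (λ s → mk λ n → K.-‿inverseʳ _)
            ; ⁻¹-cong = λ p → mk λ n → cong -ᶠ_ (at p n) }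
          ; comm = λ s t → mk λ n → K.+-comm _ _ }
        ; *-cong = λ p r → mk λ n → *ˢ-cong≤ n (λ i _ → at p i) (λ i _ → at r i)
        ; *-assoc = λ s t u → mk (*ˢ-assoc s t u)
        ; *-identity = (λ s → mk λ n → 1*s s n) , (λ s → mk λ n → trans (*ˢ-comm s (ι 1#) n) (1*s s n))
        ; distrib = (λ s t u → mk λ n → trans (*ˢ-comm s (t +ˢ u) n)
                       (trans (*ˢ-distribʳ s t u n) (cong₂ _+ᶠ_ (*ˢ-comm t s n) (*ˢ-comm u s n))))
                  , (λ u s t → mk (*ˢ-distribʳ u s t)) }
      ; *-comm = λ s t → mk (*ˢ-comm s t) } }
    where
    1*s : ∀ s n → (ι 1# *ˢ s) n ≡ s n
    1*s s n = trans (at (ι-·ˢ 1# s) n) (K.*-identityˡ _)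

  module S = CommutativeRing Ser-ring
  module SS = RingSums Ser-ring
  module SP = Algebra.Properties.Ring S.ring
  module S-Reasoning = SetoidReasoning S.setoid
  open SS using (_^ᴿ_)

  infixr 8 _^ˢ_
  _^ˢ_ : Ser → ℕ → Ser
  _^ˢ_ = _^ᴿ_

  𝟘 𝟙 : Ser
  𝟘 = S.0#
  𝟙 = S.1#

  ι-+ : ∀ a b → ι (a +ᶠ b) ≋ ι a +ˢ ι b
  ι-+ a b .at zero    = refl
  ι-+ a b .at (suc n) = sym (K.+-identityˡ 0#)

  ι-* : ∀ a b → ι (a *ᶠ b) ≋ ι a *ˢ ι b
  ι-* a b = S.sym (S.trans (ι-·ˢ a (ι b)) (mk λ { zero → refl ; (suc n) → K.zeroʳ a }))

  ι-0 : ι 0# ≋ 𝟘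
  ι-0 .at zero    = refl
  ι-0 .at (suc n) = refl

  ι-cong : ∀ {a b} → a ≡ b → ι a ≋ ι b
  ι-cong refl = S.refl

  ι-^ : ∀ a n → ι (a KS.^ᴿ n) ≋ ι a ^ˢ n
  ι-^ a zero    = S.refl
  ι-^ a (suc n) = S.trans (ι-* a _) (S.*-congˡ (ι-^ a n))

  ι-∏ : ∀ n f → ι (KS.∏ n f) ≋ SS.∏ n (ι ∘ f)
  ι-∏ zero    f = S.refl
  ι-∏ (suc n) f = S.trans (ι-* _ (f n)) (S.*-congʳ (ι-∏ n f))

  ∑-at : ∀ n (f : ℕ → Ser) m → SS.∑ n f m ≡ KS.∑ n (λ i → f i m)
  ∑-at zero    f m = refl
  ∑-at (suc n) f m = cong (_+ᶠ f n m) (∑-at n f m)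

  ^-at0 : ∀ s n → (s ^ˢ n) 0 ≡ s 0 KS.^ᴿ n
  ^-at0 s zero    = refl
  ^-at0 s (suc n) = cong (s 0 *ᶠ_) (^-at0 s n)

  ∏-at0 : ∀ n (f : ℕ → Ser) → SS.∏ n f 0 ≡ KS.∏ n (λ i → f i 0)
  ∏-at0 zero    f = refl
  ∏-at0 (suc n) f = cong (_*ᶠ f n 0) (∏-at0 n f)

  X : Ser
  X zero          = 0#
  X (suc zero)    = 1#
  X (suc (suc _)) = 0#

  X*-0 : ∀ s → (X *ˢ s) 0 ≡ 0#
  X*-0 s = K.zeroˡ (s 0)

  X*-suc : ∀ s n → (X *ˢ s) (suc n) ≡ s n
  X*-suc s n = trans (cong₂ _+ᶠ_ (K.zeroˡ _) (trans (*ˢ-cong≤ n (λ { zero _ → refl ; (suc i) _ → refl }) (λ _ _ → refl))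
    (at (S.*-identityˡ s) n))) (K.+-identityˡ _)

  V : ℕ → Ser → Set
  V n s = ∀ i → i < n → s i ≡ 0#

  Ord : ℕ → Ser → Set
  Ord n s = V n s × s n ≢ 0#

  V-resp : ∀ {n s t} → s ≋ t → V n s → V n t
  V-resp s≋t v i i<n = trans (sym (at s≋t i)) (v i i<n)

  V-≤ : ∀ {m n s} → m ≤ n → V n s → V m s
  V-≤ m≤n v i i<m = v i (ℕ.<-≤-trans i<m m≤n)

  V-*ˢ : ∀ {n s} t → V n s → V n (s *ˢ t)
  V-*ˢ t v i i<n = trans (*ˢ-cong≤ i {s′ = 𝟘} (λ j j≤i → v j (ℕ.≤-<-trans j≤i i<n)) (λ _ _ → refl))
    (*ˢ-zeroˡ {𝟘} t (λ _ → refl) i)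

  V-*ˢʳ : ∀ {n s} t → V n s → V n (t *ˢ s)
  V-*ˢʳ {s = s} t v = V-resp (S.*-comm s t) (V-*ˢ t v)

  X^-at : ∀ m s i → (X ^ˢ m *ˢ s) (m + i) ≡ s i
  X^-at zero    s i = at (S.*-identityˡ s) i
  X^-at (suc m) s i = trans (at (S.*-assoc X (X ^ˢ m) s) (suc m + i)) (trans (X*-suc _ (m + i)) (X^-at m s i))

  X^-V : ∀ m s → V m (X ^ˢ m *ˢ s)
  X^-V (suc m) s zero    i<m       = trans (at (S.*-assoc X (X ^ˢ m) s) 0) (X*-0 (X ^ˢ m *ˢ s))
  X^-V (suc m) s (suc i) (s≤s i<m) = trans (at (S.*-assoc X (X ^ˢ m) s) (suc i)) (trans (X*-suc _ i) (X^-V m s i i<m))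

  V-factor : ∀ m {s} → V m s → s ≋ X ^ˢ m *ˢ (λ i → s (m + i))
  V-factor m {s} v .at i with ℕ.<-≤-connex i m
  ... | inj₁ i<m = trans (v i i<m) (sym (X^-V m _ i i<m))
  ... | inj₂ m≤i with ℕ.m≤n⇒∃[o]m+o≡n m≤i
  ...   | j , refl = sym (X^-at m (λ i → s (m + i)) j)

  module _ {m n : ℕ} {s t : Ser} (vs : V m s) (vt : V n t) where
    private
      s′ t′ : Ser
      s′ i = s (m + i)
      t′ i = t (n + i)

      factored : s *ˢ t ≋ X ^ˢ (m + n) *ˢ (s′ *ˢ t′)
      factored = begin
        s *ˢ t                                 ≈⟨ S.*-cong (V-factor m vs) (V-factor n vt) ⟩
        (X ^ˢ m *ˢ s′) *ˢ (X ^ˢ n *ˢ t′)       ≈⟨ SM.interchange (X ^ˢ m) s′ (X ^ˢ n) t′ ⟩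
        (X ^ˢ m *ˢ X ^ˢ n) *ˢ (s′ *ˢ t′)       ≈⟨ S.*-congʳ (S.sym (SS.^-homo-* X m n)) ⟩
        X ^ˢ (m + n) *ˢ (s′ *ˢ t′)             ∎
        where
        open S-Reasoning
        module SM = PrefixSum S.*-commutativeMonoid

    V-** : V (m + n) (s *ˢ t)
    V-** = V-resp (S.sym factored) (X^-V (m + n) _)

    lowest-** : (s *ˢ t) (m + n) ≡ s m *ᶠ t n
    lowest-** = begin
      (s *ˢ t) (m + n)                          ≡⟨ at factored (m + n) ⟩
      (X ^ˢ (m + n) *ˢ (s′ *ˢ t′)) (m + n)      ≡⟨ cong (X ^ˢ (m + n) *ˢ (s′ *ˢ t′)) (ℕ.+-identityʳ (m + n)) ⟨
      (X ^ˢ (m + n) *ˢ (s′ *ˢ t′)) (m + n + 0)  ≡⟨ X^-at (m + n) (s′ *ˢ t′) 0 ⟩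
      s (m + 0) *ᶠ t (n + 0)                    ≡⟨ cong₂ (λ i j → s i *ᶠ t j) (ℕ.+-identityʳ m) (ℕ.+-identityʳ n) ⟩
      s m *ᶠ t n                                ∎
      where open ≡-Reasoning

  V-^ˢ : ∀ {m s} n → V m s → V (n * m) (s ^ˢ n)
  V-^ˢ zero    v i ()
  V-^ˢ (suc n) v = V-** v (V-^ˢ n v)

  Ord-resp : ∀ {n s t} → s ≋ t → Ord n s → Ord n t
  Ord-resp s≋t (v , s≢0) = V-resp s≋t v , λ t≡0 → s≢0 (trans (at s≋t _) t≡0)

  Ord-* : ∀ {m n s t} → Ord m s → Ord n t → Ord (m + n) (s *ˢ t)
  Ord-* (vs , s≢0) (vt , t≢0) = V-** vs vt , λ eq → *-≢0 s≢0 t≢0 (trans (sym (lowest-** vs vt)) eq)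

  Ord-0 : ∀ {s} → s 0 ≢ 0# → Ord 0 s
  Ord-0 s≢0 = (λ _ ()) , s≢0

  Ord-^ : ∀ {m s} n → Ord m s → Ord (n * m) (s ^ˢ n)
  Ord-^ zero    o = Ord-0 (0≢1 ∘ sym)
  Ord-^ (suc n) o = Ord-* o (Ord-^ n o)

  Ord-unique : ∀ {m n s} → Ord m s → Ord n s → m ≡ n
  Ord-unique {m} {n} (vm , m≢0) (vn , n≢0) with ℕ.<-cmp m n
  ... | tri< m<n _ _ = contradiction (vn m m<n) m≢0
  ... | tri≈ _ m≡n _ = m≡n
  ... | tri> _ _ n<m = contradiction (vm n n<m) n≢0

  -- Whether a series is zero cannot be decided, so the order is sought among finitely many
  -- coefficients only.
  findOrd : ∀ n s → V n s ⊎ ∃ λ m → m < n × Ord m s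
  findOrd zero    s = inj₁ λ _ ()
  findOrd (suc n) s with findOrd n s
  ... | inj₂ (m , m<n , o) = inj₂ (m , ℕ.m<n⇒m<1+n m<n , o)
  ... | inj₁ v with s n ≟ᶠ 0#
  ...   | no s≢0 = inj₂ (n , ℕ.≤-refl , v , s≢0)
  ...   | yes s≡0 = inj₁ λ i i<1+n → case′ i (ℕ.m≤n⇒m<n∨m≡n (ℕ.≤-pred i<1+n))
    where
    case′ : ∀ i → i < n ⊎ i ≡ n → s i ≡ 0#
    case′ i (inj₁ i<n)  = v i i<n
    case′ i (inj₂ refl) = s≡0

  -- Once `m` coefficients of `s` are known to vanish, coefficient `a + m` of the product is the
  -- product of the two lowest coefficients, which forces the next one to vanish.
  V-cancel : ∀ {a u} m {s} → Ord a u → V (a + m) (u *ˢ s) → V m s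
  V-cancel zero    o v i ()
  V-cancel {a} {u} (suc m) {s} o@(vu , u≢0) v i i<1+m
    with ℕ.m≤n⇒m<n∨m≡n (ℕ.≤-pred i<1+m)
  ... | inj₁ i<m = vs i i<m
    where
    vs : V m s
    vs = V-cancel m o (V-≤ (ℕ.+-monoʳ-≤ a (ℕ.n≤1+n m)) v)
  ... | inj₂ refl = *-zero u≢0 (trans (sym (lowest-** vu vs)) (v (a + m) (ℕ.+-monoʳ-< a ℕ.≤-refl)))
    where
    vs : V m s
    vs = V-cancel m o (V-≤ (ℕ.+-monoʳ-≤ a (ℕ.n≤1+n m)) v)

  ≋𝟘-cancel : ∀ {a u s} → Ord a u → u *ˢ s ≋ 𝟘 → s ≋ 𝟘
  ≋𝟘-cancel o eq .at i = V-cancel (suc i) o (λ j _ → at eq j) i ℕ.≤-refl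

  Ser-domain : ∀ {s t} → s *ˢ t ≋ 𝟘 → ¬ (s ≋ 𝟘) → t ≋ 𝟘
  Ser-domain {s} {t} eq s≢0 .at i with findOrd (suc i) t
  ... | inj₁ v = v i ℕ.≤-refl
  ... | inj₂ (m , _ , o) = contradiction (≋𝟘-cancel o (S.trans (S.*-comm t s) eq)) s≢0

  -- Polynomials as coefficient lists, and their evaluation

  Pol : Set
  Pol = List F

  addP : Pol → Pol → Pol
  addP []      p       = p
  addP (a ∷ p) []      = a ∷ p
  addP (a ∷ p) (b ∷ r) = a +ᶠ b ∷ addP p r

  scaleP : F → Pol → Pol
  scaleP c = map (c *ᶠ_)

  mulP : Pol → Pol → Pol
  mulP []      r = []
  mulP (a ∷ p) r = addP (scaleP a r) (0# ∷ mulP p r)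

  coef : Pol → ℕ → F
  coef []      i       = 0#
  coef (a ∷ p) zero    = a
  coef (a ∷ p) (suc i) = coef p i

  length-addP : ∀ {n} p r → length p ≤ n → length r ≤ n → length (addP p r) ≤ n
  length-addP []      r       p≤n       r≤n       = r≤n
  length-addP (a ∷ p) []      p≤n       r≤n       = p≤n
  length-addP (a ∷ p) (b ∷ r) (s≤s p≤n) (s≤s r≤n) = s≤s (length-addP p r p≤n r≤n)

  length-scaleP : ∀ {n} c p → length p ≤ n → length (scaleP c p) ≤ n
  length-scaleP c p p≤n = ℕ.≤-trans (ℕ.≤-reflexive (List.length-map (c *ᶠ_) p)) p≤n

  length-mulP : ∀ m {n} p r → length p ≤ suc m → length r ≤ suc n → length (mulP p r) ≤ suc (m + n)
  length-mulP m [] r p≤ r≤ = z≤n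
  length-mulP zero {n} (a ∷ []) r p≤ r≤ = length-addP (scaleP a r) (0# ∷ []) (length-scaleP a r r≤) (s≤s z≤n)
  length-mulP zero (a ∷ b ∷ p) r (s≤s ()) r≤
  length-mulP (suc m) {n} (a ∷ p) r (s≤s p≤) r≤ = length-addP (scaleP a r) (0# ∷ mulP p r)
    (length-scaleP a r (ℕ.≤-trans r≤ (s≤s (ℕ.m≤n+m n (suc m))))) (s≤s (length-mulP m p r p≤ r≤))

  -- Evaluation in any commutative ring with a ring homomorphism from F. In power series,
  -- substitution of a curve detects multiplicities; in F itself, it describes how Taylor
  -- coefficients depend on the base point.
  module Eval (A : CommutativeRing 0ℓ 0ℓ) (ιᴬ : F → CommutativeRing.Carrier A)
    (ιᴬ-+ : ∀ a b → CommutativeRing._≈_ A (ιᴬ (a +ᶠ b)) (CommutativeRing._+_ A (ιᴬ a) (ιᴬ b)))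
    (ιᴬ-* : ∀ a b → CommutativeRing._≈_ A (ιᴬ (a *ᶠ b)) (CommutativeRing._*_ A (ιᴬ a) (ιᴬ b)))
    (ιᴬ-0 : CommutativeRing._≈_ A (ιᴬ 0#) (CommutativeRing.0# A))
    (ιᴬ-1 : CommutativeRing._≈_ A (ιᴬ 1#) (CommutativeRing.1# A)) where
    module A = CommutativeRing A
    open A using (_≈_; setoid) renaming (Carrier to C; _+_ to _+ᴬ_; _*_ to _*ᴬ_)
    module AS = RingSums A
    open AS using () renaming (_^ᴿ_ to _^ᴬ_)
    open SetoidReasoning setoid

    ev : Pol → C → C
    ev []      x = A.0#
    ev (a ∷ p) x = ιᴬ a +ᴬ x *ᴬ ev p x

    ev-addP : ∀ p r x → ev (addP p r) x ≈ ev p x +ᴬ ev r x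
    ev-addP []      r       x = A.sym (A.+-identityˡ _)
    ev-addP (a ∷ p) []      x = A.sym (A.+-identityʳ _)
    ev-addP (a ∷ p) (b ∷ r) x = begin
      ιᴬ (a +ᶠ b) +ᴬ x *ᴬ ev (addP p r) x                   ≈⟨ A.+-cong (ιᴬ-+ a b) (A.*-congˡ (ev-addP p r x)) ⟩
      (ιᴬ a +ᴬ ιᴬ b) +ᴬ x *ᴬ (ev p x +ᴬ ev r x)             ≈⟨ A.+-congˡ (A.distribˡ x _ _) ⟩
      (ιᴬ a +ᴬ ιᴬ b) +ᴬ (x *ᴬ ev p x +ᴬ x *ᴬ ev r x)        ≈⟨ AS.interchange _ _ _ _ ⟩
      (ιᴬ a +ᴬ x *ᴬ ev p x) +ᴬ (ιᴬ b +ᴬ x *ᴬ ev r x)        ∎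

    x*[a*y] : ∀ x a y → x *ᴬ (a *ᴬ y) ≈ a *ᴬ (x *ᴬ y)
    x*[a*y] x a y = A.trans (A.sym (A.*-assoc x a y)) (A.trans (A.*-congʳ (A.*-comm x a)) (A.*-assoc a x y))

    ev-scaleP : ∀ c p x → ev (scaleP c p) x ≈ ιᴬ c *ᴬ ev p x
    ev-scaleP c []      x = A.sym (A.zeroʳ _)
    ev-scaleP c (a ∷ p) x = begin
      ιᴬ (c *ᶠ a) +ᴬ x *ᴬ ev (scaleP c p) x     ≈⟨ A.+-cong (ιᴬ-* c a) (A.*-congˡ (ev-scaleP c p x)) ⟩
      ιᴬ c *ᴬ ιᴬ a +ᴬ x *ᴬ (ιᴬ c *ᴬ ev p x)     ≈⟨ A.+-congˡ (x*[a*y] x (ιᴬ c) (ev p x)) ⟩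
      ιᴬ c *ᴬ ιᴬ a +ᴬ ιᴬ c *ᴬ (x *ᴬ ev p x)     ≈⟨ A.sym (A.distribˡ _ _ _) ⟩
      ιᴬ c *ᴬ (ιᴬ a +ᴬ x *ᴬ ev p x)             ∎

    ev-mulP : ∀ p r x → ev (mulP p r) x ≈ ev p x *ᴬ ev r x
    ev-mulP []      r x = A.sym (A.zeroˡ _)
    ev-mulP (a ∷ p) r x = begin
      ev (addP (scaleP a r) (0# ∷ mulP p r)) x                 ≈⟨ ev-addP (scaleP a r) (0# ∷ mulP p r) x ⟩
      ev (scaleP a r) x +ᴬ (ιᴬ 0# +ᴬ x *ᴬ ev (mulP p r) x)     ≈⟨ A.+-cong (ev-scaleP a r x) (A.+-cong ιᴬ-0 (A.*-congˡ (ev-mulP p r x))) ⟩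
      ιᴬ a *ᴬ ev r x +ᴬ (A.0# +ᴬ x *ᴬ (ev p x *ᴬ ev r x))      ≈⟨ A.+-congˡ (A.trans (A.+-identityˡ _) (A.sym (A.*-assoc _ _ _))) ⟩
      ιᴬ a *ᴬ ev r x +ᴬ (x *ᴬ ev p x) *ᴬ ev r x                ≈⟨ A.sym (A.distribʳ _ _ _) ⟩
      (ιᴬ a +ᴬ x *ᴬ ev p x) *ᴬ ev r x                          ∎

    ev-coef : ∀ n p x → length p ≤ n → ev p x ≈ AS.∑ n (λ i → ιᴬ (coef p i) *ᴬ x ^ᴬ i)
    ev-coef n [] x _ = A.sym (AS.∑-ε n λ i _ → A.trans (A.*-congʳ ιᴬ-0) (A.zeroˡ _))
    ev-coef (suc n) (a ∷ p) x (s≤s p≤n) = begin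
      ιᴬ a +ᴬ x *ᴬ ev p x
        ≈⟨ A.+-cong (A.sym (A.*-identityʳ _)) (A.*-congˡ (ev-coef n p x p≤n)) ⟩
      ιᴬ a *ᴬ A.1# +ᴬ x *ᴬ AS.∑ n (λ i → ιᴬ (coef p i) *ᴬ x ^ᴬ i)
        ≈⟨ A.+-congˡ (AS.*-distribˡ-∑ n x _) ⟩
      ιᴬ a *ᴬ A.1# +ᴬ AS.∑ n (λ i → x *ᴬ (ιᴬ (coef p i) *ᴬ x ^ᴬ i))
        ≈⟨ A.+-congˡ (AS.∑-cong n λ i _ → x*[a*y] x _ _) ⟩
      ιᴬ a *ᴬ A.1# +ᴬ AS.∑ n (λ i → ιᴬ (coef p i) *ᴬ x ^ᴬ suc i)
        ≈⟨ A.sym (AS.∑-front n _) ⟩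
      AS.∑ (suc n) (λ i → ιᴬ (coef (a ∷ p) i) *ᴬ x ^ᴬ i) ∎

    -- A function together with a bound for its degree as a polynomial. Degrees of composite
    -- expressions are then assembled by closure rules, without computing coefficients.
    Rep : ℕ → (C → C) → Set
    Rep n φ = ∃ λ p → length p ≤ suc n × ∀ x → ev p x ≈ φ x

    Rep-resp : ∀ {n φ ψ} → (∀ x → φ x ≈ ψ x) → Rep n φ → Rep n ψ
    Rep-resp eq (p , p≤ , evp) = p , p≤ , λ x → A.trans (evp x) (eq x)

    Rep-≤ : ∀ {m n φ} → m ≤ n → Rep m φ → Rep n φ
    Rep-≤ m≤n (p , p≤ , evp) = p , ℕ.≤-trans p≤ (s≤s m≤n) , evp

    Rep-const : ∀ c → Rep 0 (λ _ → ιᴬ c)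
    Rep-const c = c ∷ [] , s≤s z≤n , λ x → A.trans (A.+-congˡ (A.zeroʳ x)) (A.+-identityʳ _)

    Rep-0 : Rep 0 (λ _ → A.0#)
    Rep-0 = [] , z≤n , λ _ → A.refl

    Rep-1 : Rep 0 (λ _ → A.1#)
    Rep-1 = Rep-resp (λ _ → ιᴬ-1) (Rep-const 1#)

    Rep-id : Rep 1 (λ x → x)
    Rep-id = 0# ∷ 1# ∷ [] , s≤s (s≤s z≤n) , λ x → begin
      ιᴬ 0# +ᴬ x *ᴬ (ιᴬ 1# +ᴬ x *ᴬ A.0#)  ≈⟨ A.+-cong ιᴬ-0 (A.*-congˡ (A.+-cong ιᴬ-1 (A.zeroʳ x))) ⟩
      A.0# +ᴬ x *ᴬ (A.1# +ᴬ A.0#)          ≈⟨ A.+-identityˡ _ ⟩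
      x *ᴬ (A.1# +ᴬ A.0#)                  ≈⟨ A.*-congˡ (A.+-identityʳ _) ⟩
      x *ᴬ A.1#                            ≈⟨ A.*-identityʳ x ⟩
      x                                    ∎

    Rep-+ : ∀ {n φ ψ} → Rep n φ → Rep n ψ → Rep n (λ x → φ x +ᴬ ψ x)
    Rep-+ (p , p≤ , evp) (r , r≤ , evr) =
      addP p r , length-addP p r p≤ r≤ , λ x → A.trans (ev-addP p r x) (A.+-cong (evp x) (evr x))

    Rep-* : ∀ {m n φ ψ} → Rep m φ → Rep n ψ → Rep (m + n) (λ x → φ x *ᴬ ψ x)
    Rep-* {m} (p , p≤ , evp) (r , r≤ , evr) =
      mulP p r , length-mulP m p r p≤ r≤ , λ x → A.trans (ev-mulP p r x) (A.*-cong (evp x) (evr x))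

    Rep-^ : ∀ {m φ} n → Rep m φ → Rep (n * m) (λ x → φ x ^ᴬ n)
    Rep-^ zero    r = Rep-1
    Rep-^ (suc n) r = Rep-* r (Rep-^ n r)

    Rep-∏ : ∀ n (d : ℕ → ℕ) (φ : ℕ → C → C) → (∀ i → i < n → Rep (d i) (φ i)) →
      Rep (ℕΣ.∑ n d) (λ x → AS.∏ n (λ i → φ i x))
    Rep-∏ zero    d φ r = Rep-1
    Rep-∏ (suc n) d φ r = Rep-* (Rep-∏ n d φ λ i i<n → r i (ℕ.m<n⇒m<1+n i<n)) (r n ℕ.≤-refl)

    Rep-∑ : ∀ {d} n (φ : ℕ → C → C) → (∀ i → i < n → Rep d (φ i)) → Rep d (λ x → AS.∑ n (λ i → φ i x))
    Rep-∑ zero    φ r = Rep-≤ z≤n Rep-0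
    Rep-∑ (suc n) φ r = Rep-+ (Rep-∑ n φ λ i i<n → r i (ℕ.m<n⇒m<1+n i<n)) (r n ℕ.≤-refl)

  module ES = Eval Ser-ring ι ι-+ ι-* ι-0 S.refl
  open ES using (ev; Rep)
  module EK = Eval F-ring (λ a → a) (λ _ _ → refl) (λ _ _ → refl) refl refl

  1≢0 : 1# ≢ 0#
  1≢0 = 0≢1 ∘ sym

  -- Roots with multiplicity, measured along curves

  -- Synthetic division. The identity holds at every series `y`, so it can be applied at a curve on
  -- which y - a has order one.
  divide : ∀ a p → ∃ λ r → ∃ λ c → length r ≤ length p ∸ 1 × ∀ y → ev p y ≋ (y +ˢ -ˢ ι a) *ˢ ev r y +ˢ ι c
  divide a [] = [] , 0# , z≤n , λ y → S.sym (S.trans (S.+-cong (S.zeroʳ _) ι-0) (S.+-identityˡ 𝟘))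
  divide a (b ∷ []) = [] , b , z≤n , λ y → S.trans (S.+-congˡ (S.zeroʳ y))
    (S.trans (S.+-comm (ι b) 𝟘) (S.+-congʳ (S.sym (S.zeroʳ _))))
  divide a (b ∷ p@(_ ∷ _)) with divide a p
  ... | r , c , r≤ , eq = c ∷ r , b +ᶠ a *ᶠ c , s≤s r≤ , λ y → let d = y +ˢ -ˢ ι a in begin
    ι b +ˢ y *ˢ ev p y
      ≈⟨ S.+-congˡ (S.*-congˡ (eq y)) ⟩
    ι b +ˢ y *ˢ (d *ˢ ev r y +ˢ ι c)
      ≈⟨ S.+-congˡ (S.distribˡ y _ _) ⟩
    ι b +ˢ (y *ˢ (d *ˢ ev r y) +ˢ y *ˢ ι c)
      ≈⟨ S.+-congˡ (S.+-cong (ES.x*[a*y] y d _) (S.*-congʳ (S.sym (y≋ y)))) ⟩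
    ι b +ˢ (d *ˢ (y *ˢ ev r y) +ˢ (d +ˢ ι a) *ˢ ι c)
      ≈⟨ S.+-congˡ (S.+-congˡ (S.distribʳ (ι c) d (ι a))) ⟩
    ι b +ˢ (d *ˢ (y *ˢ ev r y) +ˢ (d *ˢ ι c +ˢ ι a *ˢ ι c))
      ≈⟨ S.+-congˡ (S.sym (S.+-assoc _ _ _)) ⟩
    ι b +ˢ (d *ˢ (y *ˢ ev r y) +ˢ d *ˢ ι c +ˢ ι a *ˢ ι c)
      ≈⟨ S.+-congˡ (S.+-congʳ (S.trans (S.+-comm _ _) (S.sym (S.distribˡ d _ _)))) ⟩
    ι b +ˢ (d *ˢ (ι c +ˢ y *ˢ ev r y) +ˢ ι a *ˢ ι c)
      ≈⟨ S.trans (S.+-comm _ _) (S.+-assoc _ _ _) ⟩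
    d *ˢ (ι c +ˢ y *ˢ ev r y) +ˢ (ι a *ˢ ι c +ˢ ι b)
      ≈⟨ S.+-congˡ (S.trans (S.+-comm _ _) (S.+-congˡ (S.sym (ι-* a c)))) ⟩
    d *ˢ (ι c +ˢ y *ˢ ev r y) +ˢ (ι b +ˢ ι (a *ᶠ c))
      ≈⟨ S.+-congˡ (S.sym (ι-+ b (a *ᶠ c))) ⟩
    d *ˢ ev (c ∷ r) y +ˢ ι (b +ᶠ a *ᶠ c) ∎
    where
    open S-Reasoning
    y≋ : ∀ y → (y +ˢ -ˢ ι a) +ˢ ι a ≋ y
    y≋ y = S.trans (S.+-assoc y _ _) (S.trans (S.+-congˡ (S.-‿inverseˡ (ι a))) (S.+-identityʳ y))

  -- A curve through `a` with nonzero velocity. Since y - a has order 1, the order of p(y) is the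
  -- multiplicity of `a` as a root of p, in any characteristic.
  LocalAt : F → Ser → Set
  LocalAt a y = y 0 ≡ a × y 1 ≢ 0#

  local-Ord1 : ∀ {a y} → LocalAt a y → Ord 1 (y +ˢ -ˢ ι a)
  local-Ord1 {a} {y} (y0 , y1) =
    (λ { zero _ → trans (cong (_+ᶠ -ᶠ a) y0) (K.-‿inverseʳ a) ; (suc _) (s≤s ()) })
    , λ eq → y1 (-‿≡0 eq)

  remainder≡0 : ∀ {a c y s} r → LocalAt a y → s ≋ (y +ˢ -ˢ ι a) *ˢ r +ˢ ι c → s 0 ≡ 0# → c ≡ 0#
  remainder≡0 {a} {c} {y} {s} r ly eq s≡0 = begin
    c                                   ≡⟨ K.+-identityˡ c ⟨
    0# +ᶠ c                             ≡⟨ cong (_+ᶠ c) (K.zeroˡ _) ⟨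
    0# *ᶠ r 0 +ᶠ c                      ≡⟨ cong (λ t → t *ᶠ r 0 +ᶠ c) (proj₁ (local-Ord1 {y = y} ly) 0 (s≤s z≤n)) ⟨
    ((y +ˢ -ˢ ι a) *ˢ r +ˢ ι c) 0       ≡⟨ at eq 0 ⟨
    s 0                                 ≡⟨ s≡0 ⟩
    0#                                  ∎
    where open ≡-Reasoning

  strip : ∀ M a y p → LocalAt a y → V M (ev p y) →
    ∃ λ r → length r ≤ length p ∸ M × ∀ z → ev p z ≋ (z +ˢ -ˢ ι a) ^ˢ M *ˢ ev r z
  strip zero    a y p ly v = p , ℕ.≤-refl , λ z → S.sym (S.*-identityˡ _)
  strip (suc M) a y p ly v =
    let r , c , r≤ , eq = divide a p
        c≡0 = remainder≡0 {y = y} (ev r y) ly (eq y) (v 0 (s≤s z≤n))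
        eq′ = λ z → S.trans (eq z) (S.trans (S.+-congˡ (S.trans (ι-cong c≡0) ι-0)) (S.+-identityʳ _))
        r′ , r′≤ , eqr = strip M a y r ly (V-cancel M (local-Ord1 {y = y} ly) (V-resp (eq′ y) v))
    in r′ , ℕ.≤-trans r′≤ (ℕ.≤-trans (ℕ.∸-monoˡ-≤ M r≤) (ℕ.≤-reflexive (ℕ.∸-+-assoc (length p) 1 M)))
      , λ z → S.trans (eq′ z) (S.trans (S.*-congˡ (eqr z)) (S.sym (S.*-assoc _ _ _)))

  -- After (z - a)^M is split off, this factor is a unit along the curve through any other root b,
  -- so the multiplicity at b survives in the quotient. Each root may come with its own curve.
  roots : ∀ M as (y : F → Ser) p → Unique as →
    (∀ a → a ∈ as → LocalAt a (y a) × V M (ev p (y a))) →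
    length p ≤ M * length as → ∀ z → ev p z ≋ 𝟘
  roots M [] y p u h p≤ z with p | ℕ.≤-trans p≤ (ℕ.≤-reflexive (ℕ.*-zeroʳ M))
  ... | [] | z≤n = S.refl
  roots M (a ∷ as) y p (a∉as ∷ u) h p≤ z with strip M a (y a) p (proj₁ (h a (here refl))) (proj₂ (h a (here refl)))
  ... | r , r≤ , eq = S.trans (eq z) (S.trans (S.*-congˡ (roots M as y r u h′ r≤′ z)) (S.zeroʳ _))
    where
    r≤′ : length r ≤ M * length as
    r≤′ = ℕ.≤-trans r≤ (ℕ.≤-trans (ℕ.∸-monoˡ-≤ M (ℕ.≤-trans p≤ (ℕ.≤-reflexive (ℕ.*-suc M (length as)))))
      (ℕ.≤-reflexive (ℕ.m+n∸m≡n M _)))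
    h′ : ∀ b → b ∈ as → LocalAt b (y b) × V M (ev r (y b))
    h′ b b∈as = proj₁ hb , V-cancel M (Ord-^ M (Ord-0 b-a)) (subst (λ k → V k ((y b +ˢ -ˢ ι a) ^ˢ M *ˢ ev r (y b)))
        (cong (_+ M) (sym (ℕ.*-zeroʳ M))) (V-resp (eq (y b)) (proj₂ hb)))
      where
      hb : LocalAt b (y b) × V M (ev p (y b))
      hb = h b (there b∈as)
      b-a : (y b +ˢ -ˢ ι a) 0 ≢ 0#
      b-a e = All.lookup a∉as b∈as (sym (trans (sym (proj₁ (proj₁ hb))) (-‿≡0 e)))

  IsZero : Pol → Set
  IsZero p = ∀ i → coef p i ≡ 0#

  isZero? : ∀ p → Dec (IsZero p)
  isZero? [] = yes λ _ → refl
  isZero? (a ∷ p) with a ≟ᶠ 0# | isZero? p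
  ... | yes a≡0 | yes p≡0 = yes λ { zero → a≡0 ; (suc i) → p≡0 i }
  ... | no a≢0  | _       = no λ z → a≢0 (z 0)
  ... | yes _   | no p≢0  = no λ z → p≢0 (z ∘ suc)

  ev-IsZero : ∀ p → IsZero p → ∀ z → ev p z ≋ 𝟘
  ev-IsZero []      p≡0 z = S.refl
  ev-IsZero (a ∷ p) p≡0 z = S.trans (S.+-cong (S.trans (ι-cong (p≡0 0)) ι-0)
    (S.trans (S.*-congˡ (ev-IsZero p (p≡0 ∘ suc) z)) (S.zeroʳ z))) (S.+-identityˡ 𝟘)

  ev-X : ∀ p i → ev p X i ≡ coef p i
  ev-X []      i       = refl
  ev-X (a ∷ p) zero    = trans (cong (a +ᶠ_) (X*-0 (ev p X))) (K.+-identityʳ a)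
  ev-X (a ∷ p) (suc i) = trans (K.+-identityˡ _) (trans (X*-suc (ev p X) i) (ev-X p i))

  IsZero-X : ∀ p → ev p X ≋ 𝟘 → IsZero p
  IsZero-X p eq i = trans (sym (ev-X p i)) (at eq i)

  negP : Pol → Pol
  negP = scaleP (-ᶠ 1#)

  ev-negP : ∀ p z → ev (negP p) z ≋ -ˢ ev p z
  ev-negP p z = S.trans (ES.ev-scaleP (-ᶠ 1#) p z) (S.trans (ι-·ˢ (-ᶠ 1#) _) (mk λ n → KP.-1*x≈-x _))

  -- If the first `length p` coefficients of p(y) vanished, `a` would be a root of multiplicity
  -- `length p`, which exceeds the possible degree and makes `p` zero.
  ord-exists : ∀ {a y} p → LocalAt a y → ¬ IsZero p → ∃ λ v → Ord v (ev p y)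
  ord-exists {a} {y} p ly p≢0 with findOrd (length p) (ev p y)
  ... | inj₂ (v , _ , o) = v , o
  ... | inj₁ v = contradiction (IsZero-X p (roots (length p) (a ∷ []) (λ _ → y) p ([] ∷ [])
      (λ { _ (here refl) → ly , v }) (ℕ.≤-reflexive (sym (ℕ.*-identityʳ _))) X)) p≢0

  -- Degree below n, the counterpart of `V`: a series with both `V n` and `Z n` is zero.
  Z : ℕ → Ser → Set
  Z n s = ∀ i → n ≤ i → s i ≡ 0#

  Z-≤ : ∀ {m n s} → m ≤ n → Z m s → Z n s
  Z-≤ m≤n z i n≤i = z i (ℕ.≤-trans m≤n n≤i)

  Z-* : ∀ m {n s t} → Z m s → Z (suc n) t → Z (m + n) (s *ˢ t)
  Z-* zero    zs zt i _ = *ˢ-zeroˡ _ (λ j → zs j z≤n) i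
  Z-* (suc m) zs zt (suc i) (s≤s m+n≤i) = trans
    (cong₂ _+ᶠ_ (trans (cong (_ *ᶠ_) (zt (suc i) (s≤s (ℕ.≤-trans (ℕ.m≤n+m _ m) m+n≤i)))) (K.zeroʳ _))
      (Z-* m (λ j m≤j → zs (suc j) (s≤s m≤j)) zt i m+n≤i))
    (K.+-identityˡ 0#)

  Z-∑ : ∀ {m} n (f : ℕ → Ser) → (∀ i → i < n → Z m (f i)) → Z m (SS.∑ n f)
  Z-∑ n f z i m≤i = trans (∑-at n f i) (KS.∑-ε n λ j j<n → z j j<n i m≤i)

  coef-≥ : ∀ p i → length p ≤ i → coef p i ≡ 0#
  coef-≥ []      i       _         = refl
  coef-≥ (a ∷ p) (suc i) (s≤s p≤i) = coef-≥ p i p≤i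

  Z-ev : ∀ {n} p → length p ≤ n → Z n (ev p X)
  Z-ev p p≤n i n≤i = trans (ev-X p i) (coef-≥ p i (ℕ.≤-trans p≤n n≤i))

  Z-Rep : ∀ {n φ} → Rep n φ → Z (suc n) (φ X)
  Z-Rep (p , p≤ , evp) i n<i = trans (sym (at (evp X) i)) (Z-ev p p≤ i n<i)

  poly : (ℕ → F) → ℕ → Pol
  poly f n = applyUpTo f n

  length-poly : ∀ f n → length (poly f n) ≡ n
  length-poly = List.length-applyUpTo

  ev-poly : ∀ f n y → ev (poly f n) y ≋ SS.∑ n (λ a → ι (f a) *ˢ y ^ˢ a)
  ev-poly f n y = S.trans (ES.ev-coef n (poly f n) y (ℕ.≤-reflexive (length-poly f n)))
    (SS.∑-cong n λ i i<n → S.*-congʳ (ι-cong (coef-poly f n i i<n)))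
    where
    coef-poly : ∀ f n i → i < n → coef (poly f n) i ≡ f i
    coef-poly f (suc n) zero    _         = refl
    coef-poly f (suc n) (suc i) (s≤s i<n) = coef-poly (f ∘ suc) n i i<n

  IsZero-poly : ∀ f n → IsZero (poly f n) → ∀ a → a < n → f a ≡ 0#
  IsZero-poly f (suc n) z zero    _         = z 0
  IsZero-poly f (suc n) z (suc a) (s≤s a<n) = IsZero-poly (f ∘ suc) n (z ∘ suc) a a<n

  -- The multiplicative group and its generator

  module WithGenerator (g : F) (gen : IsGenerator FF g) (2<q : 2 < q) where
    infixr 8 _^ᵏ_
    _^ᵏ_ : F → ℕ → F
    _^ᵏ_ = KS._^ᴿ_

    ^ᶠ≡^ᵏ : ∀ x n → x ^ᶠ n ≡ x ^ᵏ n
    ^ᶠ≡^ᵏ x zero    = refl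
    ^ᶠ≡^ᵏ x (suc n) = cong (x *ᶠ_) (^ᶠ≡^ᵏ x n)

    dlog : ∀ x → x ≢ 0# → ∃ λ j → g ^ᵏ j ≡ x
    dlog x x≢0 with gen x x≢0
    ... | j , eq = j , trans (sym (^ᶠ≡^ᵏ g j)) eq

    private
      to : F → Fin.Fin q
      to = Inverse.to enum
      from : Fin.Fin q → F
      from = Inverse.from enum
      to-injective : ∀ {x y} → to x ≡ to y → x ≡ y
      to-injective {x} {y} eq = trans (sym (Inverse.strictlyInverseʳ enum x))
        (trans (cong from eq) (Inverse.strictlyInverseʳ enum y))
      from-injective : ∀ {i j} → from i ≡ from j → i ≡ j
      from-injective {i} {j} eq = trans (sym (Inverse.strictlyInverseˡ enum i))
        (trans (cong to eq) (Inverse.strictlyInverseˡ enum j))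

    elems : List F
    elems = map from (allFin q)

    elems-unique : Unique elems
    elems-unique = Unique.map⁺ from-injective (Unique.allFin⁺ q)

    length-elems : length elems ≡ q
    length-elems = trans (List.length-map from (allFin q)) (List.length-tabulate (λ i → i))

    q-1 : ℕ
    q-1 = q ∸ 1

    1<q : 1 < q
    1<q = ℕ.<⇒≤ 2<q

    q≡ : q ≡ suc q-1
    q≡ = sym (ℕ.m+[n∸m]≡n (ℕ.<⇒≤ 1<q))

    instance
      q-1-nonZero : NonZero q-1
      q-1-nonZero = >-nonZero (ℕ.m<n⇒0<n∸m 1<q)

    ^ᵏ-mod : ∀ {x} n .{{_ : NonZero n}} j → x ^ᵏ n ≡ 1# → x ^ᵏ j ≡ x ^ᵏ (j % n)
    ^ᵏ-mod {x} n j eq = begin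
      x ^ᵏ j                                ≡⟨ cong (x ^ᵏ_) (ℕ.m≡m%n+[m/n]*n j n) ⟩
      x ^ᵏ (j % n + j / n * n)              ≡⟨ KS.^-homo-* x (j % n) (j / n * n) ⟩
      x ^ᵏ (j % n) *ᶠ x ^ᵏ (j / n * n)      ≡⟨ cong (λ e → x ^ᵏ (j % n) *ᶠ x ^ᵏ e) (ℕ.*-comm (j / n) n) ⟩
      x ^ᵏ (j % n) *ᶠ x ^ᵏ (n * (j / n))    ≡⟨ cong (x ^ᵏ (j % n) *ᶠ_) (KS.^-assocʳ x n (j / n)) ⟨
      x ^ᵏ (j % n) *ᶠ (x ^ᵏ n) ^ᵏ (j / n)   ≡⟨ cong (λ y → x ^ᵏ (j % n) *ᶠ y ^ᵏ (j / n)) eq ⟩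
      x ^ᵏ (j % n) *ᶠ 1# ^ᵏ (j / n)         ≡⟨ cong (x ^ᵏ (j % n) *ᶠ_) (KS.1^n≈1 (j / n)) ⟩
      x ^ᵏ (j % n) *ᶠ 1#                    ≡⟨ K.*-identityʳ _ ⟩
      x ^ᵏ (j % n)                          ∎
      where open ≡-Reasoning

    private
      small : ∀ {n} (f : F → Fin.Fin n) → (∀ {x y} → f x ≡ f y → x ≡ y) → q ≤ n
      small f inj = Fin.injective⇒≤ {f = f ∘ from} (from-injective ∘ inj)

    -- In the field with two elements 0 = g is also a "generator", because 0⁰ = 1.
    g≢0 : g ≢ 0#
    g≢0 g≡0 = ℕ.<⇒≱ 2<q (small f f-injective)
      where
      ≡1 : ∀ x → x ≢ 0# → x ≡ 1#
      ≡1 x x≢0 with dlog x x≢0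
      ... | zero  , eq = sym eq
      ... | suc j , eq = contradiction (trans (sym eq) (trans (cong (_*ᶠ g ^ᵏ j) g≡0) (K.zeroˡ _))) x≢0
      f : F → Fin.Fin 2
      f x = ifDec (x ≟ᶠ 0#) Fin.zero (Fin.suc Fin.zero)
      f-injective : ∀ {x y} → f x ≡ f y → x ≡ y
      f-injective {x} {y} eq with x ≟ᶠ 0# | y ≟ᶠ 0#
      ... | yes x≡0 | yes y≡0 = trans x≡0 (sym y≡0)
      ... | no x≢0  | no y≢0  = trans (≡1 x x≢0) (sym (≡1 y y≢0))
      f-injective () | yes _ | no _
      f-injective () | no _  | yes _

    -- If g^o = 1, the powers of `g` take at most `o` values; with 0 they exhaust the field, so q ≤
    -- o + 1.
    order-≥ : ∀ o → 0 < o → g ^ᵏ o ≡ 1# → q-1 ≤ o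
    order-≥ o 0<o eq = ℕ.≤-pred (subst (_≤ suc o) q≡ (small f f-injective))
      where
      instance
        o-nonZero : NonZero o
        o-nonZero = >-nonZero 0<o
      f : F → Fin.Fin (suc o)
      f x with x ≟ᶠ 0#
      ... | yes _ = Fin.zero
      ... | no x≢0 = Fin.suc (ℕ._mod_ (proj₁ (dlog x x≢0)) o)
      mod-injective : ∀ i j → (i ℕ.mod o) ≡ (j ℕ.mod o) → g ^ᵏ i ≡ g ^ᵏ j
      mod-injective i j e = begin
        g ^ᵏ i         ≡⟨ ^ᵏ-mod o i eq ⟩
        g ^ᵏ (i % o)   ≡⟨ cong (g ^ᵏ_) (Fin.toℕ-fromℕ< (ℕ.m%n<n i o)) ⟨
        g ^ᵏ Fin.toℕ (i ℕ.mod o) ≡⟨ cong (λ t → g ^ᵏ Fin.toℕ t) e ⟩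
        g ^ᵏ Fin.toℕ (j ℕ.mod o) ≡⟨ cong (g ^ᵏ_) (Fin.toℕ-fromℕ< (ℕ.m%n<n j o)) ⟩
        g ^ᵏ (j % o)   ≡⟨ ^ᵏ-mod o j eq ⟨
        g ^ᵏ j         ∎
        where open ≡-Reasoning
      f-injective : ∀ {x y} → f x ≡ f y → x ≡ y
      f-injective {x} {y} e with x ≟ᶠ 0# | y ≟ᶠ 0#
      ... | yes x≡0 | yes y≡0 = trans x≡0 (sym y≡0)
      ... | no x≢0  | no y≢0  = trans (sym (proj₂ (dlog x x≢0)))
        (trans (mod-injective _ _ (Fin.suc-injective e)) (proj₂ (dlog y y≢0)))
      f-injective () | yes _ | no _
      f-injective () | no _  | yes _

    g^[j∸i]≡1 : ∀ {i j} → i ≤ j → g ^ᵏ i ≡ g ^ᵏ j → g ^ᵏ (j ∸ i) ≡ 1#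
    g^[j∸i]≡1 {i} {j} i≤j eq = sym (*-cancelˡ (^-≢0 i g≢0) (begin
      g ^ᵏ i *ᶠ 1#           ≡⟨ K.*-identityʳ _ ⟩
      g ^ᵏ i                 ≡⟨ eq ⟩
      g ^ᵏ j                 ≡⟨ cong (g ^ᵏ_) (ℕ.m+[n∸m]≡n i≤j) ⟨
      g ^ᵏ (i + (j ∸ i))     ≡⟨ KS.^-homo-* g i (j ∸ i) ⟩
      g ^ᵏ i *ᶠ g ^ᵏ (j ∸ i) ∎))
      where open ≡-Reasoning

    -- Among the q + 1 elements 0, g^0, ..., g^(q-1) two coincide. The difference of their exponents
    -- is at most q - 1 by its range and at least q - 1 by `order-≥`.
    g^q-1≡1 : g ^ᵏ q-1 ≡ 1#
    g^q-1≡1 with Fin.pigeonhole ℕ.≤-refl f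
      where
      f : Fin.Fin (suc q) → Fin.Fin q
      f Fin.zero    = to 0#
      f (Fin.suc i) = to (g ^ᵏ Fin.toℕ i)
    ... | Fin.zero  , Fin.suc j , _ , eq = contradiction (sym (to-injective eq)) (^-≢0 (Fin.toℕ j) g≢0)
    ... | Fin.suc i , Fin.suc j , s≤s i<j , eq = subst (λ o → g ^ᵏ o ≡ 1#) (ℕ.≤-antisym j-i≤ (order-≥ _ (ℕ.m<n⇒0<n∸m i<j) eq′)) eq′
      where
      eq′ : g ^ᵏ (Fin.toℕ j ∸ Fin.toℕ i) ≡ 1#
      eq′ = g^[j∸i]≡1 (ℕ.<⇒≤ i<j) (to-injective eq)
      j-i≤ : Fin.toℕ j ∸ Fin.toℕ i ≤ q-1
      j-i≤ = ℕ.≤-trans (ℕ.m∸n≤m _ (Fin.toℕ i)) (ℕ.≤-pred (subst (Fin.toℕ j <_) q≡ (Fin.toℕ<n j)))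

    g^n≡1⇒q-1∣n : ∀ n → g ^ᵏ n ≡ 1# → q-1 ∣ n
    g^n≡1⇒q-1∣n n eq = ℕ.m%n≡0⇒n∣m n q-1 (r≡0 (n % q-1) (trans (sym (^ᵏ-mod q-1 n g^q-1≡1)) eq) (ℕ.m%n<n n q-1))
      where
      r≡0 : ∀ r → g ^ᵏ r ≡ 1# → r < q-1 → r ≡ 0
      r≡0 zero    _ _ = refl
      r≡0 (suc r) e r<q-1 = contradiction (order-≥ (suc r) (s≤s z≤n) e) (ℕ.<⇒≱ r<q-1)

    x^q-1≡1 : ∀ {x} → x ≢ 0# → x ^ᵏ q-1 ≡ 1#
    x^q-1≡1 {x} x≢0 with dlog x x≢0
    ... | j , refl = begin
      (g ^ᵏ j) ^ᵏ q-1   ≡⟨ KS.^-assocʳ g j q-1 ⟩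
      g ^ᵏ (j * q-1)    ≡⟨ cong (g ^ᵏ_) (ℕ.*-comm j q-1) ⟩
      g ^ᵏ (q-1 * j)    ≡⟨ KS.^-assocʳ g q-1 j ⟨
      (g ^ᵏ q-1) ^ᵏ j   ≡⟨ cong (_^ᵏ j) g^q-1≡1 ⟩
      1# ^ᵏ j           ≡⟨ KS.1^n≈1 j ⟩
      1#                ∎
      where open ≡-Reasoning

    x^q≡x : ∀ x → x ^ᵏ q ≡ x
    x^q≡x x with x ≟ᶠ 0#
    ... | yes refl = trans (cong (0# ^ᵏ_) q≡) (K.zeroˡ _)
    ... | no x≢0 = trans (cong (x ^ᵏ_) q≡) (trans (cong (x *ᶠ_) (x^q-1≡1 x≢0)) (K.*-identityʳ x))

    -- Additivity of the q-th power

    -- The leading terms cancel. In the recursion, with a and b the current powers of 1 + y and y,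
    -- the next difference is a + y (a - b).
    Rep-difference : ∀ n → Rep n (λ y → (𝟙 +ˢ y) ^ˢ suc n +ˢ -ˢ (y ^ˢ suc n))
    Rep-difference zero = ES.Rep-resp (λ y → S.sym (begin
      (𝟙 +ˢ y) *ˢ 𝟙 +ˢ -ˢ (y *ˢ 𝟙)  ≈⟨ S.+-cong (S.*-identityʳ _) (S.-‿cong (S.*-identityʳ y)) ⟩
      (𝟙 +ˢ y) +ˢ -ˢ y              ≈⟨ S.+-assoc 𝟙 y _ ⟩
      𝟙 +ˢ (y +ˢ -ˢ y)              ≈⟨ S.+-congˡ (S.-‿inverseʳ y) ⟩
      𝟙 +ˢ 𝟘                        ≈⟨ S.+-identityʳ 𝟙 ⟩
      𝟙                             ∎)) ES.Rep-1
      where open S-Reasoning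
    Rep-difference (suc n) = ES.Rep-resp (λ y → let a = (𝟙 +ˢ y) ^ˢ suc n ; b = y ^ˢ suc n in S.sym (begin
      (𝟙 +ˢ y) *ˢ a +ˢ -ˢ (y *ˢ b)          ≈⟨ S.+-congʳ (S.distribʳ a 𝟙 y) ⟩
      𝟙 *ˢ a +ˢ y *ˢ a +ˢ -ˢ (y *ˢ b)       ≈⟨ S.+-assoc _ _ _ ⟩
      𝟙 *ˢ a +ˢ (y *ˢ a +ˢ -ˢ (y *ˢ b))     ≈⟨ S.+-cong (S.*-identityˡ a) (S.+-congˡ (SP.-‿distribʳ-* y b)) ⟩
      a +ˢ (y *ˢ a +ˢ y *ˢ -ˢ b)            ≈⟨ S.+-congˡ (S.sym (S.distribˡ y a _)) ⟩
      a +ˢ y *ˢ (a +ˢ -ˢ b)                 ∎))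
      (ES.Rep-+ (ES.Rep-≤ (ℕ.≤-reflexive (ℕ.*-identityʳ (suc n))) (ES.Rep-^ (suc n) (ES.Rep-+ (ES.Rep-≤ z≤n ES.Rep-1) ES.Rep-id)))
        (ES.Rep-* ES.Rep-id (Rep-difference n)))
      where open S-Reasoning

    -- (1 + y)^q − y^q − 1 has degree below q and vanishes at all q elements of F.
    [1+y]^q : ∀ y → (𝟙 +ˢ y) ^ˢ q ≋ 𝟙 +ˢ y ^ˢ q
    [1+y]^q y = begin
      (𝟙 +ˢ y) ^ˢ q                                        ≈⟨ S.sym (S.trans (S.+-congˡ (S.-‿inverseˡ _)) (S.+-identityʳ _)) ⟩
      (𝟙 +ˢ y) ^ˢ q +ˢ (-ˢ (y ^ˢ q) +ˢ y ^ˢ q)             ≈⟨ S.sym (S.+-assoc _ _ _) ⟩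
      (𝟙 +ˢ y) ^ˢ q +ˢ -ˢ (y ^ˢ q) +ˢ y ^ˢ q               ≈⟨ S.+-congʳ d≋𝟙 ⟩
      𝟙 +ˢ y ^ˢ q                                          ∎
      where
      open S-Reasoning
      φ : Ser → Ser
      φ y = (𝟙 +ˢ y) ^ˢ q +ˢ -ˢ (y ^ˢ q)
      repD : Rep q-1 (λ y → φ y +ˢ -ˢ 𝟙)
      repD = ES.Rep-+ (subst (λ k → Rep q-1 (λ y → (𝟙 +ˢ y) ^ˢ k +ˢ -ˢ (y ^ˢ k))) (sym q≡) (Rep-difference q-1))
        (ES.Rep-≤ z≤n (ES.Rep-resp (λ _ → mk λ { zero → refl ; (suc n) → sym KP.-0#≈0# }) (ES.Rep-const (-ᶠ 1#))))
      point : F → Ser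
      point a = ι a +ˢ X
      φ-at0 : ∀ a → (φ (point a) +ˢ -ˢ 𝟙) 0 ≡ 0#
      φ-at0 a = trans
        (cong₂ (λ u v → u +ᶠ -ᶠ v +ᶠ -ᶠ 1#) (trans (^-at0 (𝟙 +ˢ point a) q) (x^q≡x _)) (trans (^-at0 (point a) q) (x^q≡x _)))
        (trans (cong (_+ᶠ -ᶠ 1#) (trans (K.+-assoc _ _ _) (trans (cong (1# +ᶠ_) (K.-‿inverseʳ _)) (K.+-identityʳ 1#))))
          (K.-‿inverseʳ 1#))
      d≋𝟙 : φ y ≋ 𝟙
      d≋𝟙 with repD
      ... | p , p≤ , evp = S.trans (SP.+-inverseˡ-unique (φ y) (-ˢ 𝟙) (S.trans (S.sym (evp y))
        (roots 1 elems point p elems-unique (λ a _ → (K.+-identityʳ a , λ e → 1≢0 (trans (sym (K.+-identityˡ 1#)) e))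
            , (λ { zero _ → trans (at (evp (point a)) 0) (φ-at0 a) ; (suc _) (s≤s ()) }))
          (ℕ.≤-trans p≤ (ℕ.≤-reflexive (trans (sym q≡) (trans (sym length-elems) (sym (ℕ.*-identityˡ _)))))) y)))
        (SP.-‿involutive 𝟙)

    [1+y]^q^ : ∀ N y → (𝟙 +ˢ y) ^ˢ (q ^ N) ≋ 𝟙 +ˢ y ^ˢ (q ^ N)
    [1+y]^q^ zero    y = S.trans (S.*-identityʳ _) (S.+-congˡ (S.sym (S.*-identityʳ y)))
    [1+y]^q^ (suc N) y = begin
      (𝟙 +ˢ y) ^ˢ (q * q ^ N)      ≈⟨ S.sym (SS.^-assocʳ _ q (q ^ N)) ⟩
      ((𝟙 +ˢ y) ^ˢ q) ^ˢ (q ^ N)   ≈⟨ SS.^-congˡ (q ^ N) ([1+y]^q y) ⟩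
      (𝟙 +ˢ y ^ˢ q) ^ˢ (q ^ N)     ≈⟨ [1+y]^q^ N (y ^ˢ q) ⟩
      𝟙 +ˢ (y ^ˢ q) ^ˢ (q ^ N)     ≈⟨ S.+-congˡ (SS.^-assocʳ y q (q ^ N)) ⟩
      𝟙 +ˢ y ^ˢ (q * q ^ N)        ∎
      where open S-Reasoning

    n<q^n : ∀ n → n < q ^ n
    n<q^n zero    = s≤s z≤n
    n<q^n (suc n) = ℕ.≤-trans (ℕ.≤-trans (ℕ.+-mono-≤ (ℕ.≤-trans (s≤s z≤n) (n<q^n n)) (n<q^n n))
        (ℕ.≤-reflexive (cong (q ^ n +_) (sym (ℕ.+-identityʳ (q ^ n))))))
      (ℕ.*-monoˡ-≤ (q ^ n) 1<q)

    _≈[_]_ : Ser → ℕ → Ser → Set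
    s ≈[ n ] t = ∀ i → i < n → s i ≡ t i

    ≈[]-trans : ∀ {n s t u} → s ≈[ n ] t → t ≈[ n ] u → s ≈[ n ] u
    ≈[]-trans p r i i<n = trans (p i i<n) (r i i<n)

    ≈[]-sym : ∀ {n s t} → s ≈[ n ] t → t ≈[ n ] s
    ≈[]-sym p i i<n = sym (p i i<n)

    ≋⇒≈[] : ∀ {n s t} → s ≋ t → s ≈[ n ] t
    ≋⇒≈[] eq i _ = at eq i

    ≈[]-+ : ∀ {n s s′ t t′} → s ≈[ n ] s′ → t ≈[ n ] t′ → (s +ˢ t) ≈[ n ] (s′ +ˢ t′)
    ≈[]-+ p r i i<n = cong₂ _+ᶠ_ (p i i<n) (r i i<n)

    ≈[]-* : ∀ {n s s′ t t′} → s ≈[ n ] s′ → t ≈[ n ] t′ → (s *ˢ t) ≈[ n ] (s′ *ˢ t′)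
    ≈[]-* p r i i<n = *ˢ-cong≤ i (λ j j≤i → p j (ℕ.≤-<-trans j≤i i<n)) (λ j j≤i → r j (ℕ.≤-<-trans j≤i i<n))

    ≈[]-^ : ∀ {n s s′} m → s ≈[ n ] s′ → (s ^ˢ m) ≈[ n ] (s′ ^ˢ m)
    ≈[]-^ zero    p _ _ = refl
    ≈[]-^ (suc m) p = ≈[]-* p (≈[]-^ m p)

    ≈[]-∏ : ∀ {n} m {f f′ : ℕ → Ser} → (∀ i → i < m → f i ≈[ n ] f′ i) → SS.∏ m f ≈[ n ] SS.∏ m f′
    ≈[]-∏ zero    p _ _ = refl
    ≈[]-∏ (suc m) p = ≈[]-* (≈[]-∏ m λ i i<m → p i (ℕ.m<n⇒m<1+n i<m)) (p m ℕ.≤-refl)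

    ≈[]-∑ : ∀ {n} m {f f′ : ℕ → Ser} → (∀ i → i < m → f i ≈[ n ] f′ i) → SS.∑ m f ≈[ n ] SS.∑ m f′
    ≈[]-∑ zero    p _ _ = refl
    ≈[]-∑ (suc m) p = ≈[]-+ (≈[]-∑ m λ i i<m → p i (ℕ.m<n⇒m<1+n i<m)) (p m ℕ.≤-refl)

    ≈[]-1+V : ∀ {n v} → V n v → (𝟙 +ˢ v) ≈[ n ] 𝟙
    ≈[]-1+V vv i i<n = trans (cong (𝟙 i +ᶠ_) (vv i i<n)) (K.+-identityʳ _)

    V-q^ : ∀ N {v} → V 1 v → V (q ^ N) (v ^ˢ (q ^ N))
    V-q^ N v = V-≤ (ℕ.≤-reflexive (sym (ℕ.*-identityʳ _))) (V-^ˢ (q ^ N) v)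

    V1-X* : ∀ s → V 1 (X *ˢ s)
    V1-X* s zero    _        = X*-0 s
    V1-X* s (suc _) (s≤s ())

    -- For u = 1 + Xs the power u^(q^N − 1) is an approximate inverse of u, which reduces (u + Xt)^q to [1+y]^q.
    frobenius : ∀ s t → (s +ˢ t) ^ˢ q ≋ s ^ˢ q +ˢ t ^ˢ q
    frobenius s t .at i = trans (sym (X^-at q _ i)) (trans (goal (q + i) (n<q^n (q + i))) (X^-at q _ i))
      where
      -- Coefficient `i` of the claim is coefficient `q + i` after multiplication by X^q, so a
      -- precision above `q + i` is needed; q^N is large enough for N = q + i.
      N : ℕ
      N = q + i
      L : ℕ
      L = q ^ N
      u a b u′ : Ser
      a = X *ˢ s
      b = X *ˢ t
      u = 𝟙 +ˢ a
      u′ = u ^ˢ (L ∸ 1)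
      uu′ : (u *ˢ u′) ≈[ L ] 𝟙
      uu′ = ≈[]-trans (≋⇒≈[] (S.trans (S.reflexive (cong (u ^ˢ_) (ℕ.m+[n∸m]≡n (ℕ.≤-trans (s≤s z≤n) (n<q^n N)))))
        ([1+y]^q^ N a))) (≈[]-1+V (V-q^ N (V1-X* s)))
      via-u : ((u +ˢ b) ^ˢ q) ≈[ L ] (u ^ˢ q +ˢ b ^ˢ q)
      via-u = ≈[]-trans (≈[]-^ q (≈[]-+ {t = b} (λ _ _ → refl) (≈[]-trans (≋⇒≈[] (S.sym (S.*-identityˡ b))) (≈[]-* (≈[]-sym uu′) (λ _ _ → refl)))))
        (≈[]-trans (≋⇒≈[] (begin
          (u +ˢ (u *ˢ u′) *ˢ b) ^ˢ q              ≈⟨ SS.^-congˡ q (S.+-cong (S.sym (S.*-identityʳ u)) (S.*-assoc u u′ b)) ⟩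
          (u *ˢ 𝟙 +ˢ u *ˢ (u′ *ˢ b)) ^ˢ q         ≈⟨ SS.^-congˡ q (S.sym (S.distribˡ u 𝟙 (u′ *ˢ b))) ⟩
          (u *ˢ (𝟙 +ˢ u′ *ˢ b)) ^ˢ q              ≈⟨ SS.^-distrib-* u _ q ⟩
          u ^ˢ q *ˢ (𝟙 +ˢ u′ *ˢ b) ^ˢ q           ≈⟨ S.*-congˡ ([1+y]^q (u′ *ˢ b)) ⟩
          u ^ˢ q *ˢ (𝟙 +ˢ (u′ *ˢ b) ^ˢ q)         ≈⟨ S.distribˡ (u ^ˢ q) 𝟙 _ ⟩
          u ^ˢ q *ˢ 𝟙 +ˢ u ^ˢ q *ˢ (u′ *ˢ b) ^ˢ q ≈⟨ S.+-cong (S.*-identityʳ _) (S.sym (SS.^-distrib-* u (u′ *ˢ b) q)) ⟩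
          u ^ˢ q +ˢ (u *ˢ (u′ *ˢ b)) ^ˢ q         ≈⟨ S.+-congˡ (SS.^-congˡ q (S.sym (S.*-assoc u u′ b))) ⟩
          u ^ˢ q +ˢ ((u *ˢ u′) *ˢ b) ^ˢ q         ∎))
        (≈[]-+ {s = u ^ˢ q} (λ _ _ → refl) (≈[]-^ q (≈[]-trans (≈[]-* uu′ (λ _ _ → refl)) (≋⇒≈[] (S.*-identityˡ b))))))
        where open S-Reasoning
      one : (u +ˢ b) ^ˢ q ≋ 𝟙 +ˢ X ^ˢ q *ˢ (s +ˢ t) ^ˢ q
      one = begin
        (𝟙 +ˢ a +ˢ b) ^ˢ q              ≈⟨ SS.^-congˡ q (S.trans (S.+-assoc 𝟙 a b) (S.+-congˡ (S.sym (S.distribˡ X s t)))) ⟩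
        (𝟙 +ˢ X *ˢ (s +ˢ t)) ^ˢ q       ≈⟨ [1+y]^q _ ⟩
        𝟙 +ˢ (X *ˢ (s +ˢ t)) ^ˢ q       ≈⟨ S.+-congˡ (SS.^-distrib-* X _ q) ⟩
        𝟙 +ˢ X ^ˢ q *ˢ (s +ˢ t) ^ˢ q    ∎
        where open S-Reasoning
      two : u ^ˢ q +ˢ b ^ˢ q ≋ 𝟙 +ˢ X ^ˢ q *ˢ (s ^ˢ q +ˢ t ^ˢ q)
      two = begin
        u ^ˢ q +ˢ b ^ˢ q                                ≈⟨ S.+-cong ([1+y]^q a) (SS.^-distrib-* X t q) ⟩
        (𝟙 +ˢ a ^ˢ q) +ˢ X ^ˢ q *ˢ t ^ˢ q               ≈⟨ S.+-congʳ (S.+-congˡ (SS.^-distrib-* X s q)) ⟩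
        (𝟙 +ˢ X ^ˢ q *ˢ s ^ˢ q) +ˢ X ^ˢ q *ˢ t ^ˢ q     ≈⟨ S.+-assoc _ _ _ ⟩
        𝟙 +ˢ (X ^ˢ q *ˢ s ^ˢ q +ˢ X ^ˢ q *ˢ t ^ˢ q)     ≈⟨ S.+-congˡ (S.sym (S.distribˡ _ _ _)) ⟩
        𝟙 +ˢ X ^ˢ q *ˢ (s ^ˢ q +ˢ t ^ˢ q)               ∎
        where open S-Reasoning
      goal : ∀ j → j < L → (X ^ˢ q *ˢ (s +ˢ t) ^ˢ q) j ≡ (X ^ˢ q *ˢ (s ^ˢ q +ˢ t ^ˢ q)) j
      goal j j<L = KP.+-cancelˡ (𝟙 j) _ _ (trans (sym (at one j)) (trans (via-u j j<L) (at two j)))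

    frobenius-∑ : ∀ n f → SS.∑ n f ^ˢ q ≋ SS.∑ n (λ i → f i ^ˢ q)
    frobenius-∑ zero    f = S.trans (S.reflexive (cong (𝟘 ^ˢ_) q≡)) (S.zeroˡ _)
    frobenius-∑ (suc n) f = S.trans (frobenius (SS.∑ n f) (f n)) (S.+-congʳ (frobenius-∑ n f))

    -- Nonzero solutions of homogeneous linear systems

    open DivMod

    private
      assignment : ∀ n → Fin.Fin (q ^ n) → ℕ → F
      assignment n t j with j <? n
      ... | yes j<n = Inverse.from enum (Fin.finToFun t (Fin.fromℕ< j<n))
      ... | no _    = 0#

      assignment-injective : ∀ n t u → (∀ j → j < n → assignment n t j ≡ assignment n u j) → t ≡ u
      assignment-injective n t u eq = trans (sym (Fin.funToFin-finToFin {n} t)) (trans (funToFin-cong n pointwise) (Fin.funToFin-finToFin {n} u))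
        where
        pointwise : ∀ i → Fin.finToFun t i ≡ Fin.finToFun u i
        pointwise i with Fin.toℕ i <? n | eq (Fin.toℕ i) (Fin.toℕ<n i)
        ... | no i≮n | _ = contradiction (Fin.toℕ<n i) i≮n
        ... | yes i<n | e = subst (λ i′ → Fin.finToFun t i′ ≡ Fin.finToFun u i′) (Fin.fromℕ<-toℕ i i<n)
          (trans (sym (Inverse.strictlyInverseˡ enum _)) (trans (cong (Inverse.to enum) e) (Inverse.strictlyInverseˡ enum _)))

      rows : ∀ m n → (ℕ → ℕ → F) → Fin.Fin (q ^ n) → Fin.Fin m → Fin.Fin q
      rows m n M t i = Inverse.to enum (KS.∑ n (λ j → assignment n t j *ᶠ M (Fin.toℕ i) j))

    -- Two assignments of the unknowns have the same image by the pigeonhole principle.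
    kernel : ∀ m n → m < n → (M : ℕ → ℕ → F) →
      ∃ λ (x : ℕ → F) → (∃ λ j → j < n × x j ≢ 0#) × (∀ i → i < m → KS.∑ n (λ j → x j *ᶠ M i j) ≡ 0#)
    kernel m n m<n M with Fin.pigeonhole (ℕ.^-monoʳ-< q 1<q m<n) (Fin.funToFin ∘ rows m n M)
    ... | t , u , t<u , eq = x , nonzero , solves
      where
      x : ℕ → F
      x j = assignment n t j +ᶠ -ᶠ assignment n u j
      nonzero : ∃ λ j → j < n × x j ≢ 0#
      nonzero with findOrd n x
      ... | inj₂ (j , j<n , _ , xj≢0) = j , j<n , xj≢0
      ... | inj₁ v = contradiction (assignment-injective n t u λ j j<n → -‿≡0 (v j j<n)) (Fin.<⇒≢ t<u)
      same : ∀ i → i < m → KS.∑ n (λ j → assignment n t j *ᶠ M i j) ≡ KS.∑ n (λ j → assignment n u j *ᶠ M i j)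
      same i i<m = subst (λ i′ → KS.∑ n (λ j → assignment n t j *ᶠ M i′ j) ≡ KS.∑ n (λ j → assignment n u j *ᶠ M i′ j)) (Fin.toℕ-fromℕ< i<m)
        (trans (sym (Inverse.strictlyInverseʳ enum _)) (trans (cong (Inverse.from enum)
          (funToFin-injective (rows m n M t) (rows m n M u) eq (Fin.fromℕ< i<m))) (Inverse.strictlyInverseʳ enum _)))
      solves : ∀ i → i < m → KS.∑ n (λ j → x j *ᶠ M i j) ≡ 0#
      solves i i<m = begin
        KS.∑ n (λ j → x j *ᶠ M i j)
          ≡⟨ KS.∑-cong n (λ j _ → trans (K.distribʳ (M i j) _ _) (cong (assignment n t j *ᶠ M i j +ᶠ_) (trans (sym (KP.-‿distribˡ-* _ _)) (sym (KP.-1*x≈-x _))))) ⟩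
        KS.∑ n (λ j → assignment n t j *ᶠ M i j +ᶠ -ᶠ 1# *ᶠ (assignment n u j *ᶠ M i j))
          ≡⟨ KS.∑-∙ n _ _ ⟩
        KS.∑ n (λ j → assignment n t j *ᶠ M i j) +ᶠ KS.∑ n (λ j → -ᶠ 1# *ᶠ (assignment n u j *ᶠ M i j))
          ≡⟨ cong₂ _+ᶠ_ (same i i<m) (trans (sym (KS.*-distribˡ-∑ n (-ᶠ 1#) _)) (KP.-1*x≈-x _)) ⟩
        KS.∑ n (λ j → assignment n u j *ᶠ M i j) +ᶠ -ᶠ KS.∑ n (λ j → assignment n u j *ᶠ M i j)
          ≡⟨ K.-‿inverseʳ _ ⟩
        0# ∎
        where open ≡-Reasoning

    kernel₂ : ∀ L W .{{_ : NonZero W}} I J → L * W < I * J → (M : ℕ → ℕ → ℕ → ℕ → F) →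
      ∃ λ (x : ℕ → ℕ → F) → (∃ λ i → ∃ λ j → i < I × j < J × x i j ≢ 0#) ×
        (∀ l w → l < L → w < W → KS.∑ I (λ i → KS.∑ J (λ j → x i j *ᶠ M l w i j)) ≡ 0#)
    kernel₂ L W I J lt M with kernel (L * W) (I * J) lt M′
      where
      instance
        J-nonZero : NonZero J
        J-nonZero = ℕ.m*n≢0⇒n≢0 I {{>-nonZero (ℕ.≤-trans (s≤s z≤n) lt)}}
      M′ : ℕ → ℕ → F
      M′ u t = M (u / W) (u % W) (t / J) (t % J)
    ... | x , (t , t< , xt≢0) , sol = (λ i j → x (i * J + j)) , (t / J , t % J , ℕ.m<n*o⇒m/o<n t< , ℕ.m%n<n t J
          , subst (λ u → x u ≢ 0#) (trans (ℕ.m≡m%n+[m/n]*n t J) (ℕ.+-comm (t % J) _)) xt≢0) , solves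
      where
      instance
        J-nonZero : NonZero J
        J-nonZero = ℕ.m*n≢0⇒n≢0 I {{>-nonZero (ℕ.≤-trans (s≤s z≤n) lt)}}
      solves : ∀ l w → l < L → w < W → KS.∑ I (λ i → KS.∑ J (λ j → x (i * J + j) *ᶠ M l w i j)) ≡ 0#
      solves l w l<L w<W = trans (KS.∑-cong I λ i _ → KS.∑-cong J λ j j<J → cong (x (i * J + j) *ᶠ_)
          (trans (cong₂ (λ l′ w′ → M l′ w′ i j) (sym ([j+in]/n≡i l w W w<W)) (sym ([j+in]%n≡j l w W w<W)))
            (cong₂ (M ((l * W + w) / W) ((l * W + w) % W)) (sym ([j+in]/n≡i i j J j<J)) (sym ([j+in]%n≡j i j J j<J)))))
        (trans (sym (KS.∑-flatten I J _)) (sol (l * W + w) (i*n+j< l<L w<W)))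

    kernel₃ : ∀ L W .{{_ : NonZero W}} I J A → L * W < I * (J * A) → (M : ℕ → ℕ → ℕ → ℕ → ℕ → F) →
      ∃ λ (x : ℕ → ℕ → ℕ → F) → (∃ λ i → ∃ λ j → ∃ λ a → i < I × j < J × a < A × x i j a ≢ 0#) ×
        (∀ l w → l < L → w < W → KS.∑ I (λ i → KS.∑ J (λ j → KS.∑ A (λ a → x i j a *ᶠ M l w i j a))) ≡ 0#)
    kernel₃ L W I J A lt M with kernel₂ L W I (J * A) lt (λ l w i t → M l w i (t / A) (t % A))
      where
      instance
        A-nonZero : NonZero A
        A-nonZero = ℕ.m*n≢0⇒n≢0 J {{ℕ.m*n≢0⇒n≢0 I {{>-nonZero (ℕ.≤-trans (s≤s z≤n) lt)}}}}
    ... | x , (i , t , i< , t< , xt≢0) , sol = (λ i j a → x i (j * A + a))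
          , (i , t / A , t % A , i< , ℕ.m<n*o⇒m/o<n t< , ℕ.m%n<n t A
            , subst (λ u → x i u ≢ 0#) (trans (ℕ.m≡m%n+[m/n]*n t A) (ℕ.+-comm (t % A) _)) xt≢0) , solves
      where
      instance
        A-nonZero : NonZero A
        A-nonZero = ℕ.m*n≢0⇒n≢0 J {{ℕ.m*n≢0⇒n≢0 I {{>-nonZero (ℕ.≤-trans (s≤s z≤n) lt)}}}}
      solves : ∀ l w → l < L → w < W → KS.∑ I (λ i → KS.∑ J (λ j → KS.∑ A (λ a → x i (j * A + a) *ᶠ M l w i j a))) ≡ 0#
      solves l w l<L w<W = trans (KS.∑-cong I λ i _ → trans (KS.∑-cong J λ j _ → KS.∑-cong A λ a a<A → cong (x i (j * A + a) *ᶠ_)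
          (cong₂ (M l w i) (sym ([j+in]/n≡i j a A a<A)) (sym ([j+in]%n≡j j a A a<A))))
          (sym (KS.∑-flatten J A _)))
        (sol l w l<L w<W)

    -- Root series and Stepanov's method

    -- The exact k-th root (1 − δx)^(−1/k), as the limit of the powers (1 − δx)^((q^N − 1)/k).
    module RootSeries (k n₀ : ℕ) (q≡1+kn₀ : q ≡ suc (k * n₀)) where
      lin : F → Ser → Ser
      lin δ y = 𝟙 +ˢ ι (-ᶠ δ) *ˢ y

      Rep-lin : ∀ δ → Rep 1 (lin δ)
      Rep-lin δ = ES.Rep-+ (ES.Rep-≤ z≤n ES.Rep-1) (ES.Rep-* (ES.Rep-const (-ᶠ δ)) ES.Rep-id)

      ℓ : F → Ser
      ℓ δ = lin δ X

      c : ℕ → ℕ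
      c zero    = 0
      c (suc N) = c N + q ^ N * n₀

      1+c*k : ∀ N → suc (c N * k) ≡ q ^ N
      1+c*k zero    = refl
      1+c*k (suc N) = begin
        suc ((c N + q ^ N * n₀) * k)          ≡⟨ cong suc (ℕ.*-distribʳ-+ k (c N) _) ⟩
        suc (c N * k) + q ^ N * n₀ * k        ≡⟨ cong₂ _+_ (1+c*k N) (trans (ℕ.*-assoc (q ^ N) n₀ k) (cong (q ^ N *_) (ℕ.*-comm n₀ k))) ⟩
        q ^ N + q ^ N * (k * n₀)              ≡⟨ ℕ.*-suc (q ^ N) (k * n₀) ⟨
        q ^ N * suc (k * n₀)                  ≡⟨ cong (q ^ N *_) q≡1+kn₀ ⟨
        q ^ N * q                             ≡⟨ ℕ.*-comm (q ^ N) q ⟩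
        q * q ^ N                             ∎
        where open ≡-Reasoning

      ωᴺ : ℕ → F → Ser
      ωᴺ N δ = ℓ δ ^ˢ c N

      -- Passing from `N` to `N + 1` multiplies the approximation by a power of ℓ^(q^N), which is 1
      -- modulo X^(q^N). Coefficient n is therefore final in approximation n + 1.
      ω : F → Ser
      ω δ n = ωᴺ (suc n) δ n

      ℓ^q^≈1 : ∀ δ N → (ℓ δ ^ˢ (q ^ N)) ≈[ q ^ N ] 𝟙
      ℓ^q^≈1 δ N = ≈[]-trans (≋⇒≈[] ([1+y]^q^ N _))
        (≈[]-1+V (V-q^ N (V-resp (S.*-comm X (ι (-ᶠ δ))) (V1-X* (ι (-ᶠ δ))))))

      ωᴺ-suc : ∀ δ N → ωᴺ (suc N) δ ≈[ q ^ N ] ωᴺ N δ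
      ωᴺ-suc δ N = ≈[]-trans (≋⇒≈[] (S.trans (SS.^-homo-* (ℓ δ) (c N) (q ^ N * n₀))
          (S.*-congˡ (S.sym (SS.^-assocʳ (ℓ δ) (q ^ N) n₀)))))
        (≈[]-trans (≈[]-* {s = ωᴺ N δ} (λ _ _ → refl) (≈[]-trans (≈[]-^ n₀ (ℓ^q^≈1 δ N)) (≋⇒≈[] (SS.1^n≈1 n₀))))
          (≋⇒≈[] (S.*-identityʳ _)))

      ωᴺ-stable : ∀ δ d M n → n < q ^ M → ωᴺ (d + M) δ n ≡ ωᴺ M δ n
      ωᴺ-stable δ zero    M n n< = refl
      ωᴺ-stable δ (suc d) M n n< = trans (ωᴺ-suc δ (d + M) n (ℕ.<-≤-trans n< (ℕ.^-monoʳ-≤ q {{>-nonZero (ℕ.<-trans (s≤s z≤n) 1<q)}} (ℕ.m≤n+m M d))))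
        (ωᴺ-stable δ d M n n<)

      ω-≈ᴺ : ∀ δ N → ω δ ≈[ N ] ωᴺ N δ
      ω-≈ᴺ δ N i i<N with ℕ.m≤n⇒∃[o]m+o≡n i<N
      ... | d , refl = sym (trans (cong (λ M → ωᴺ M δ i) (ℕ.+-comm (suc i) d))
        (ωᴺ-stable δ d (suc i) i (ℕ.<-trans (ℕ.n<1+n i) (n<q^n (suc i)))))

      -- Up to precision q the first approximation is enough, and `c 1` = n₀. This is the bridge
      -- from the polynomials `y j` to the series `Y j`.
      ω-≈ℓ^n₀ : ∀ δ → ω δ ≈[ q ] (ℓ δ ^ˢ n₀)
      ω-≈ℓ^n₀ δ i i<q = trans (cong (λ M → ωᴺ M δ i) (sym (ℕ.+-comm i 1)))
        (trans (ωᴺ-stable δ i 1 i (subst (i <_) (sym (ℕ.*-identityʳ q)) i<q))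
          (cong (λ e → (ℓ δ ^ˢ e) i) (ℕ.*-identityˡ n₀)))

      ℓω^k : ∀ δ → ℓ δ *ˢ ω δ ^ˢ k ≋ 𝟙
      ℓω^k δ .at n = trans (≈[]-* {s = ℓ δ} (λ _ _ → refl) (≈[]-^ k (ω-≈ᴺ δ (suc n))) n ℕ.≤-refl)
        (trans (at power n) (ℓ^q^≈1 δ (suc n) n (ℕ.<-trans (ℕ.n<1+n n) (n<q^n (suc n)))))
        where
        power : ℓ δ *ˢ ωᴺ (suc n) δ ^ˢ k ≋ ℓ δ ^ˢ (q ^ suc n)
        power = S.trans (S.*-congˡ (SS.^-assocʳ (ℓ δ) (c (suc n)) k)) (S.reflexive (cong (ℓ δ ^ˢ_) (1+c*k (suc n))))

      -- As q = 1 + k n₀ and ω^k inverts ℓ, the q-th power of ω differs from ω by a power of ℓ only.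
      -- This is why a relation between the `Y j` yields another one between the same series.
      ℓ^n₀ω^q : ∀ δ → ℓ δ ^ˢ n₀ *ˢ ω δ ^ˢ q ≋ ω δ
      ℓ^n₀ω^q δ = begin
        ℓ δ ^ˢ n₀ *ˢ ω δ ^ˢ q                      ≈⟨ S.*-congˡ (S.reflexive (cong (ω δ ^ˢ_) q≡1+kn₀)) ⟩
        ℓ δ ^ˢ n₀ *ˢ (ω δ *ˢ ω δ ^ˢ (k * n₀))      ≈⟨ ES.x*[a*y] _ _ _ ⟩
        ω δ *ˢ (ℓ δ ^ˢ n₀ *ˢ ω δ ^ˢ (k * n₀))      ≈⟨ S.*-congˡ (S.*-congˡ (S.sym (SS.^-assocʳ (ω δ) k n₀))) ⟩
        ω δ *ˢ (ℓ δ ^ˢ n₀ *ˢ (ω δ ^ˢ k) ^ˢ n₀)     ≈⟨ S.*-congˡ (S.sym (SS.^-distrib-* (ℓ δ) (ω δ ^ˢ k) n₀)) ⟩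
        ω δ *ˢ (ℓ δ *ˢ ω δ ^ˢ k) ^ˢ n₀             ≈⟨ S.*-congˡ (S.trans (SS.^-congˡ n₀ (ℓω^k δ)) (SS.1^n≈1 n₀)) ⟩
        ω δ *ˢ 𝟙                                   ≈⟨ S.*-identityʳ _ ⟩
        ω δ                                        ∎
        where open S-Reasoning

      ω0≢0 : ∀ δ → ω δ 0 ≢ 0#
      ω0≢0 δ eq = ^-≢0 (c 1) ℓ0≢0 (trans (sym (^-at0 (ℓ δ) (c 1))) eq)
        where
        ℓ0≢0 : ℓ δ 0 ≢ 0#
        ℓ0≢0 e = 1≢0 (trans (sym (K.+-identityʳ 1#)) (trans (cong (1# +ᶠ_) (sym (K.zeroʳ _))) e))

      -- Monomials in the k-th roots (1 − δₑx)^(−1/k), whose exponent vectors r j form a cyclic group modulo k.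
      module Monomials (σ : ℕ) (δ : ℕ → F) (δ≢0 : ∀ e → e < suc σ → δ e ≢ 0#)
        (δ-injective : ∀ e e′ → e < suc σ → e′ < suc σ → δ e ≡ δ e′ → e ≡ e′)
        (d′ : ℕ) (r : ℕ → ℕ → ℕ) (r<k : ∀ j e → r j e < k)
        (r-distinct : ∀ i j → i < j → j < suc d′ → ∃ λ e → e < suc σ × r i e ≢ r j e)
        (r0 : ∀ e → r 0 e ≡ 0)
        (r-add : ∀ i j e → (r i e + r j e ≡ r ((i + j) % suc d′) e) ⊎ (r i e + r j e ≡ k + r ((i + j) % suc d′) e)) where
        s d : ℕ
        s = suc σ
        d = suc d′

        instance
          kn₀-nonZero : NonZero (k * n₀)
          kn₀-nonZero = subst NonZero (ℕ.suc-injective (trans (sym q≡) q≡1+kn₀)) q-1-nonZero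

          k-nonZero : NonZero k
          k-nonZero = ℕ.m*n≢0⇒m≢0 k

          n₀-nonZero : NonZero n₀
          n₀-nonZero = ℕ.m*n≢0⇒n≢0 k

        Y : ℕ → Ser
        Y j = SS.∏ s (λ e → ω (δ e) ^ˢ r j e)

        Y0≢0 : ∀ j → Y j 0 ≢ 0#
        Y0≢0 j eq = ∏-≢0 s _ (λ e _ → ^-≢0 (r j e) (ω0≢0 (δ e)) ∘ trans (sym (^-at0 _ (r j e)))) (trans (sym (∏-at0 s _)) eq)

        -- The polynomial by which the q-th power multiplies `Y j`, after the common denominator
        -- `Λ^n₀k` has been cleared.
        ρ : ℕ → Ser → Ser
        ρ j y = SS.∏ s (λ e → lin (δ e) y ^ˢ (n₀ * (k ∸ r j e)))

        ρ-repr : ∀ j → ∃ λ p → ∀ y → ev p y ≋ ρ j y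
        ρ-repr j with ES.Rep-∏ s _ (λ e y → lin (δ e) y ^ˢ (n₀ * (k ∸ r j e))) (λ e _ → ES.Rep-^ (n₀ * (k ∸ r j e)) (Rep-lin (δ e)))
        ... | p , _ , eq = p , eq

        Λ^n₀k : Ser
        Λ^n₀k = SS.∏ s (λ e → ℓ (δ e) ^ˢ (n₀ * k))

        Y^q : ∀ j → Λ^n₀k *ˢ Y j ^ˢ q ≋ ρ j X *ˢ Y j
        Y^q j = begin
          Λ^n₀k *ˢ Y j ^ˢ q
            ≈⟨ S.*-congˡ (SS.∏-^ s q _) ⟩
          Λ^n₀k *ˢ SS.∏ s (λ e → (ω (δ e) ^ˢ r j e) ^ˢ q)
            ≈⟨ S.sym (SS.∏-* s _ _) ⟩
          SS.∏ s (λ e → ℓ (δ e) ^ˢ (n₀ * k) *ˢ (ω (δ e) ^ˢ r j e) ^ˢ q)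
            ≈⟨ SS.∏-cong s (λ e _ → factor e) ⟩
          SS.∏ s (λ e → ℓ (δ e) ^ˢ (n₀ * (k ∸ r j e)) *ˢ ω (δ e) ^ˢ r j e)
            ≈⟨ SS.∏-* s _ _ ⟩
          ρ j X *ˢ Y j ∎
          where
          open S-Reasoning
          factor : ∀ e → ℓ (δ e) ^ˢ (n₀ * k) *ˢ (ω (δ e) ^ˢ r j e) ^ˢ q ≋ ℓ (δ e) ^ˢ (n₀ * (k ∸ r j e)) *ˢ ω (δ e) ^ˢ r j e
          factor e = let l = ℓ (δ e) ; w = ω (δ e) ; m = r j e in begin
            l ^ˢ (n₀ * k) *ˢ (w ^ˢ m) ^ˢ q
              ≈⟨ S.*-cong (S.reflexive (cong (λ t → l ^ˢ (n₀ * t)) (sym (ℕ.m∸n+n≡m (ℕ.<⇒≤ (r<k j e))))))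
                   (S.trans (SS.^-assocʳ w m q) (S.trans (S.reflexive (cong (w ^ˢ_) (ℕ.*-comm m q))) (S.sym (SS.^-assocʳ w q m)))) ⟩
            l ^ˢ (n₀ * (k ∸ m + m)) *ˢ (w ^ˢ q) ^ˢ m
              ≈⟨ S.*-congʳ (S.trans (S.reflexive (cong (l ^ˢ_) (ℕ.*-distribˡ-+ n₀ (k ∸ m) m))) (SS.^-homo-* l (n₀ * (k ∸ m)) (n₀ * m))) ⟩
            (l ^ˢ (n₀ * (k ∸ m)) *ˢ l ^ˢ (n₀ * m)) *ˢ (w ^ˢ q) ^ˢ m
              ≈⟨ S.*-assoc _ _ _ ⟩
            l ^ˢ (n₀ * (k ∸ m)) *ˢ (l ^ˢ (n₀ * m) *ˢ (w ^ˢ q) ^ˢ m)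
              ≈⟨ S.*-congˡ (S.*-congʳ (S.sym (SS.^-assocʳ l n₀ m))) ⟩
            l ^ˢ (n₀ * (k ∸ m)) *ˢ ((l ^ˢ n₀) ^ˢ m *ˢ (w ^ˢ q) ^ˢ m)
              ≈⟨ S.*-congˡ (S.trans (S.sym (SS.^-distrib-* _ _ m)) (SS.^-congˡ m (ℓ^n₀ω^q (δ e)))) ⟩
            l ^ˢ (n₀ * (k ∸ m)) *ˢ w ^ˢ m ∎

        centre : ℕ → Ser
        centre e = ι (δ e ⁻¹) +ˢ X

        centre-local : ∀ e → LocalAt (δ e ⁻¹) (centre e)
        centre-local e = K.+-identityʳ _ , λ eq → 1≢0 (trans (sym (K.+-identityˡ 1#)) eq)

        lin-at0 : ∀ a e → lin a (centre e) 0 ≡ 1# +ᶠ -ᶠ (a *ᶠ δ e ⁻¹)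
        lin-at0 a e = cong (1# +ᶠ_) (trans (cong (-ᶠ a *ᶠ_) (K.+-identityʳ _)) (sym (KP.-‿distribˡ-* a _)))

        lin-Ord1 : ∀ e → e < s → Ord 1 (lin (δ e) (centre e))
        lin-Ord1 e e<s = (λ { zero _ → trans (lin-at0 (δ e) e) (trans (cong (λ t → 1# +ᶠ -ᶠ t) (⁻¹-inverse (δ≢0 e e<s))) (K.-‿inverseʳ 1#))
                            ; (suc _) (s≤s ()) })
          , λ eq → δ≢0 e e<s (trans (sym (KP.-‿involutive _)) (trans (cong -ᶠ_ (trans (sym coef1) eq)) KP.-0#≈0#))
          where
          coef1 : lin (δ e) (centre e) 1 ≡ -ᶠ δ e
          coef1 = trans (K.+-identityˡ _) (trans (at (ι-·ˢ (-ᶠ δ e) (centre e)) 1)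
            (trans (cong (-ᶠ δ e *ᶠ_) (K.+-identityˡ 1#)) (K.*-identityʳ _)))

        lin-Ord0 : ∀ {e e′} → e < s → e′ < s → e′ ≢ e → lin (δ e′) (centre e) 0 ≢ 0#
        lin-Ord0 {e} {e′} e<s e′<s e′≢e eq = e′≢e (δ-injective e′ e e′<s e<s (sym (*-cancelˡ (⁻¹-≢0 (δ≢0 e e<s)) (begin
          δ e ⁻¹ *ᶠ δ e     ≡⟨ K.*-comm _ _ ⟩
          δ e *ᶠ δ e ⁻¹     ≡⟨ ⁻¹-inverse (δ≢0 e e<s) ⟩
          1#                ≡⟨ -‿≡0 (trans (sym (lin-at0 (δ e′) e)) eq) ⟩
          δ e′ *ᶠ δ e ⁻¹    ≡⟨ K.*-comm _ _ ⟩
          δ e ⁻¹ *ᶠ δ e′    ∎))))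
          where open ≡-Reasoning

        -- Only the factor with index `e` vanishes at 1/δₑ, and it does so simply before it is
        -- raised to its power. The order thus retains the exponent `r j e`, by which two indices
        -- can be told apart.
        ρ-Ord : ∀ j e → e < s → Ord (n₀ * (k ∸ r j e)) (ρ j (centre e))
        ρ-Ord j e e<s = Ord-resp (S.sym (SS.∏-omit s f e<s)) (subst (λ m → Ord m (f e *ˢ SS.∏ s (SS.omit* e f)))
          (trans (ℕ.+-identityʳ _) (ℕ.*-identityʳ _)) (Ord-* (Ord-^ (n₀ * (k ∸ r j e)) (lin-Ord1 e e<s))
            (Ord-0 λ eq → ∏-≢0 s _ rest≢0 (trans (sym (∏-at0 s (SS.omit* e f))) eq))))
          where
          f : ℕ → Ser
          f e′ = lin (δ e′) (centre e) ^ˢ (n₀ * (k ∸ r j e′))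
          rest≢0 : ∀ i → i < s → SS.omit* e f i 0 ≢ 0#
          rest≢0 i i<s with i ≟ e
          ... | yes _ = 1≢0
          ... | no i≢e = ^-≢0 (n₀ * (k ∸ r j i)) (lin-Ord0 e<s i<s i≢e) ∘ trans (sym (^-at0 (lin (δ i) (centre e)) (n₀ * (k ∸ r j i))))

        powP : ℕ → Pol → Pol
        powP zero    p = 1# ∷ []
        powP (suc n) p = mulP p (powP n p)

        ev-powP : ∀ n p y → ev (powP n p) y ≋ ev p y ^ˢ n
        ev-powP zero    p y = S.trans (S.+-congˡ (S.zeroʳ y)) (S.+-identityʳ 𝟙)
        ev-powP (suc n) p y = S.trans (ES.ev-mulP p (powP n p) y) (S.*-congˡ (ev-powP n p y))

        -- The coefficient of Y j after raising a relation to the q-th power and clearing denominators.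
        twist : Pol → ℕ → Pol
        twist h j = mulP (powP q h) (proj₁ (ρ-repr j))

        ev-twist : ∀ h j y → ev (twist h j) y ≋ ev h y ^ˢ q *ˢ ρ j y
        ev-twist h j y = S.trans (ES.ev-mulP (powP q h) (proj₁ (ρ-repr j)) y) (S.*-cong (ev-powP q h y) (proj₂ (ρ-repr j) y))

        relation : ℕ → (ℕ → Pol) → Ser
        relation N h = SS.∑ N (λ j → ev (h j) X *ˢ Y j)

        relation-twist : ∀ N h → relation N h ≋ 𝟘 → relation N (λ j → twist (h j) j) ≋ 𝟘
        relation-twist N h eq = begin
          SS.∑ N (λ j → ev (twist (h j) j) X *ˢ Y j)
            ≈⟨ SS.∑-cong N (λ j _ → S.trans (S.*-congʳ (ev-twist (h j) j X)) (S.*-assoc _ _ _)) ⟩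
          SS.∑ N (λ j → ev (h j) X ^ˢ q *ˢ (ρ j X *ˢ Y j))
            ≈⟨ SS.∑-cong N (λ j _ → S.trans (S.*-congˡ (S.sym (Y^q j))) (S.trans (ES.x*[a*y] _ _ _) (S.*-congˡ (S.sym (SS.^-distrib-* _ _ q))))) ⟩
          SS.∑ N (λ j → Λ^n₀k *ˢ (ev (h j) X *ˢ Y j) ^ˢ q)
            ≈⟨ S.sym (SS.*-distribˡ-∑ N _ _) ⟩
          Λ^n₀k *ˢ SS.∑ N (λ j → (ev (h j) X *ˢ Y j) ^ˢ q)
            ≈⟨ S.*-congˡ (S.sym (frobenius-∑ N _)) ⟩
          Λ^n₀k *ˢ relation N h ^ˢ q
            ≈⟨ S.*-congˡ (S.trans (SS.^-congˡ q eq) (S.trans (S.reflexive (cong (𝟘 ^ˢ_) q≡)) (S.zeroˡ _))) ⟩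
          Λ^n₀k *ˢ 𝟘
            ≈⟨ S.zeroʳ _ ⟩
          𝟘 ∎
          where open S-Reasoning

        eliminate : Pol → Pol → Pol → Pol → Pol
        eliminate h h′ p p′ = addP (mulP h′ p) (negP (mulP h p′))

        ev-eliminate : ∀ h h′ p p′ y → ev (eliminate h h′ p p′) y ≋ ev h′ y *ˢ ev p y +ˢ -ˢ (ev h y *ˢ ev p′ y)
        ev-eliminate h h′ p p′ y = S.trans (ES.ev-addP (mulP h′ p) (negP (mulP h p′)) y)
          (S.+-cong (ES.ev-mulP h′ p y) (S.trans (ev-negP (mulP h p′) y) (S.-‿cong (ES.ev-mulP h p′ y))))

        -- Each relation is multiplied by the last coefficient of the other; the terms with `Y N`
        -- then cancel in the difference.
        relation-eliminate : ∀ N (h h′ : ℕ → Pol) → relation (suc N) h ≋ 𝟘 → relation (suc N) h′ ≋ 𝟘 →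
          relation N (λ j → eliminate (h N) (h′ N) (h j) (h′ j)) ≋ 𝟘
        relation-eliminate N h h′ eq eq′ = begin
          SS.∑ N (λ j → ev (eliminate (h N) (h′ N) (h j) (h′ j)) X *ˢ Y j)
            ≈⟨ SS.∑-cong N (λ j _ → term j) ⟩
          SS.∑ N (λ j → b *ˢ (ev (h j) X *ˢ Y j) +ˢ -ˢ a *ˢ (ev (h′ j) X *ˢ Y j))
            ≈⟨ SS.∑-∙ N _ _ ⟩
          SS.∑ N (λ j → b *ˢ (ev (h j) X *ˢ Y j)) +ˢ SS.∑ N (λ j → -ˢ a *ˢ (ev (h′ j) X *ˢ Y j))
            ≈⟨ S.+-cong (S.sym (SS.*-distribˡ-∑ N b _)) (S.sym (SS.*-distribˡ-∑ N (-ˢ a) _)) ⟩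
          b *ˢ relation N h +ˢ -ˢ a *ˢ relation N h′
            ≈⟨ S.+-cong (S.*-congˡ (SP.+-inverseˡ-unique _ _ eq)) (S.*-congˡ (SP.+-inverseˡ-unique _ _ eq′)) ⟩
          b *ˢ -ˢ (a *ˢ Y N) +ˢ -ˢ a *ˢ -ˢ (b *ˢ Y N)
            ≈⟨ S.+-cong (S.sym (SP.-‿distribʳ-* b _)) (S.trans (S.sym (SP.-‿distribˡ-* a _)) (S.trans (S.-‿cong (S.sym (SP.-‿distribʳ-* a _)))
                (S.trans (SP.-‿involutive _) (ES.x*[a*y] a b (Y N))))) ⟩
          -ˢ (b *ˢ (a *ˢ Y N)) +ˢ b *ˢ (a *ˢ Y N)
            ≈⟨ S.-‿inverseˡ _ ⟩
          𝟘 ∎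
          where
          open S-Reasoning
          a b : Ser
          a = ev (h N) X
          b = ev (h′ N) X
          term : ∀ j → ev (eliminate (h N) (h′ N) (h j) (h′ j)) X *ˢ Y j ≋ b *ˢ (ev (h j) X *ˢ Y j) +ˢ -ˢ a *ˢ (ev (h′ j) X *ˢ Y j)
          term j = S.trans (S.*-congʳ (ev-eliminate (h N) (h′ N) (h j) (h′ j) X)) (S.trans (S.distribʳ (Y j) _ _)
            (S.+-cong (S.*-assoc _ _ _) (S.trans (S.*-congʳ (SP.-‿distribˡ-* a _)) (S.*-assoc _ _ _))))

        -- Comparing orders at 1/δₑ excludes a proportionality between a two-term relation and its q-th power.
        two-term : ∀ i j → i < j → j < d → ∀ p h → ¬ IsZero p → ¬ IsZero h →
          (∀ y → ev (twist h j) y *ˢ ev p y ≋ ev h y *ˢ ev (twist p i) y) → ⊥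
        two-term i j i<j j<d p h p≢0 h≢0 eq with r-distinct i j i<j j<d
        ... | e , e<s , ri≢rj with ord-exists {y = centre e} h (centre-local e) h≢0 | ord-exists {y = centre e} p (centre-local e) p≢0
        ...   | a , oh | b , op = ri≢rj (ℕ.∸-cancelˡ-≡ (ℕ.<⇒≤ (r<k i e)) (ℕ.<⇒≤ (r<k j e)) (sym (remainders u v (ℕ.m<n⇒0<n∸m (r<k j e))
              (ℕ.m<n⇒0<n∸m (r<k i e)) (ℕ.m∸n≤m k (r j e)) (ℕ.m∸n≤m k (r i e)) (ℕ.*-cancelˡ-≡ _ _ n₀ orders))))
          where
          u v : ℕ
          u = k ∸ r j e
          v = k ∸ r i e
          -- The numbers k - r lie in 1, ..., k, so both are lowered by one before they are reduced
          -- modulo k.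
          remainders : ∀ u v → 0 < u → 0 < v → u ≤ k → v ≤ k → u + a * k ≡ v + b * k → u ≡ v
          remainders (suc u) (suc v) _ _ u<k v<k eq′ = cong suc (begin
            u                 ≡⟨ ℕ.m<n⇒m%n≡m u<k ⟨
            u % k             ≡⟨ ℕ.[m+kn]%n≡m%n u a k ⟨
            (u + a * k) % k   ≡⟨ cong (_% k) (ℕ.suc-injective eq′) ⟩
            (v + b * k) % k   ≡⟨ ℕ.[m+kn]%n≡m%n v b k ⟩
            v % k             ≡⟨ ℕ.m<n⇒m%n≡m v<k ⟩
            v                 ∎)
            where open ≡-Reasoning
          -- Since q = 1 + k n₀, this equation reduces to u + k a = v + k b: the unknown orders `a`
          -- and `b` drop out modulo k.
          orders′ : (q * a + n₀ * u) + b ≡ a + (q * b + n₀ * v)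
          orders′ = Ord-unique
            (Ord-* (Ord-resp (S.sym (ev-twist h j (centre e))) (Ord-* (Ord-^ q oh) (ρ-Ord j e e<s))) op)
            (Ord-resp (S.sym (eq (centre e))) (Ord-* oh (Ord-resp (S.sym (ev-twist p i (centre e))) (Ord-* (Ord-^ q op) (ρ-Ord i e e<s)))))
          orders : n₀ * (u + a * k) ≡ n₀ * (v + b * k)
          orders = ℕ.+-cancelˡ-≡ (a + b) _ _ (begin
            (a + b) + n₀ * (u + a * k)         ≡⟨ solve 5 (λ a b k n u → (a :+ b) :+ n :* (u :+ a :* k) := ((con 1 :+ k :* n) :* a :+ n :* u) :+ b) refl a b k n₀ u ⟩
            (suc (k * n₀) * a + n₀ * u) + b    ≡⟨ cong (λ t → (t * a + n₀ * u) + b) q≡1+kn₀ ⟨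
            (q * a + n₀ * u) + b               ≡⟨ orders′ ⟩
            a + (q * b + n₀ * v)               ≡⟨ cong (λ t → a + (t * b + n₀ * v)) q≡1+kn₀ ⟩
            a + (suc (k * n₀) * b + n₀ * v)    ≡⟨ solve 5 (λ a b k n v → a :+ ((con 1 :+ k :* n) :* b :+ n :* v) := (a :+ b) :+ n :* (v :+ b :* k)) refl a b k n₀ v ⟩
            (a + b) + n₀ * (v + b * k)         ∎)
            where
            open ≡-Reasoning
            open Data.Nat.Solver.+-*-Solver

        -- Induction on the number of terms takes the place of a relation of minimal length. If the
        -- last coefficient is nonzero, eliminating it against the twisted relation leaves a shorter
        -- relation, trivial by induction; `two-term` then kills every other coefficient, and a
        -- single term cannot vanish.
        independence : ∀ N → N ≤ d → ∀ h → relation N h ≋ 𝟘 → ∀ j → j < N → IsZero (h j)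
        independence (suc N) N<d h eq with isZero? (h N)
        ... | yes hN≡0 = λ j j<1+N → split j (ℕ.m≤n⇒m<n∨m≡n (ℕ.≤-pred j<1+N))
          where
          rest : relation N h ≋ 𝟘
          rest = S.trans (S.sym (S.trans (S.+-congˡ (S.trans (S.*-congʳ (ev-IsZero (h N) hN≡0 X)) (S.zeroˡ _))) (S.+-identityʳ _))) eq
          split : ∀ j → j < N ⊎ j ≡ N → IsZero (h j)
          split j (inj₁ j<N)  = independence N (ℕ.<⇒≤ N<d) h rest j j<N
          split j (inj₂ refl) = hN≡0
        ... | no hN≢0 = contradiction hN≡0 hN≢0
          where
          h′ : ℕ → Pol
          h′ j = twist (h j) j
          eliminated : ∀ j → j < N → IsZero (eliminate (h N) (h′ N) (h j) (h′ j))
          eliminated = independence N (ℕ.<⇒≤ N<d) (λ j → eliminate (h N) (h′ N) (h j) (h′ j)) (relation-eliminate N h h′ eq (relation-twist (suc N) h eq))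
          hj≡0 : ∀ j → j < N → IsZero (h j)
          hj≡0 j j<N with isZero? (h j)
          ... | yes z = z
          ... | no hj≢0 = ⊥-elim (two-term j N j<N N<d (h j) (h N) hj≢0 hN≢0 λ y →
            S.trans (SP.+-inverseˡ-unique _ _ (S.trans (S.sym (ev-eliminate (h N) (h′ N) (h j) (h′ j) y))
              (ev-IsZero (eliminate (h N) (h′ N) (h j) (h′ j)) (eliminated j j<N) y))) (SP.-‿involutive _))
          hN≡0 : IsZero (h N)
          hN≡0 = IsZero-X (h N) (≋𝟘-cancel (Ord-0 (Y0≢0 N)) (S.trans (S.*-comm _ _) (S.trans (S.sym (S.trans
            (S.+-congʳ (SS.∑-ε N λ j j<N → S.trans (S.*-congʳ (ev-IsZero (h j) (hj≡0 j j<N) X)) (S.zeroˡ _))) (S.+-identityˡ _))) eq)))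

        y : ℕ → Ser
        y j = SS.∏ s (λ e → ℓ (δ e) ^ˢ (n₀ * r j e))

        y≈Y : ∀ j → y j ≈[ q ] Y j
        y≈Y j = ≈[]-∏ s λ e _ → ≈[]-trans (≋⇒≈[] (S.sym (SS.^-assocʳ (ℓ (δ e)) n₀ (r j e)))) (≈[]-^ (r j e) (≈[]-sym (ω-≈ℓ^n₀ (δ e))))

        Λ : Ser
        Λ = SS.∏ s (λ e → ℓ (δ e))

        carry : ℕ → ℕ → ℕ → Ser → Ser
        carry i j e z = ifDec (r i e + r j e <? k) (lin (δ e) z) 𝟙

        γ : ℕ → ℕ → Ser
        γ i j = SS.∏ s (λ e → carry i j e X)

        Z-γ : ∀ i j → Z (suc s) (γ i j)
        Z-γ i j = Z-Rep (subst (λ n → Rep n (λ z → SS.∏ s (λ e → carry i j e z))) (trans (ℕ∑-const s 1) (ℕ.*-identityʳ s)) (ES.Rep-∏ s (λ _ → 1) (carry i j) λ e _ → rep e))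
          where
          rep : ∀ e → Rep 1 (carry i j e)
          rep e with r i e + r j e <? k
          ... | yes _ = Rep-lin (δ e)
          ... | no _  = ES.Rep-≤ z≤n ES.Rep-1

        -- The `Y j` multiply like their exponent vectors, up to a polynomial. A coordinate whose
        -- exponents add up to at least k consumes its factor of `Λ` through ℓ ω^k = 1; any other
        -- coordinate keeps the factor, as `carry` records.
        ΛYY : ∀ i j → Λ *ˢ (Y i *ˢ Y j) ≋ γ i j *ˢ Y ((i + j) % d)
        ΛYY i j = begin
          Λ *ˢ (Y i *ˢ Y j)
            ≈⟨ S.trans (S.*-congˡ (S.sym (SS.∏-* s _ _))) (S.sym (SS.∏-* s _ _)) ⟩
          SS.∏ s (λ e → ℓ (δ e) *ˢ (ω (δ e) ^ˢ r i e *ˢ ω (δ e) ^ˢ r j e))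
            ≈⟨ SS.∏-cong s (λ e _ → S.trans (S.*-congˡ (S.sym (SS.^-homo-* (ω (δ e)) (r i e) (r j e)))) (factor e)) ⟩
          SS.∏ s (λ e → carry i j e X *ˢ ω (δ e) ^ˢ r l e)
            ≈⟨ SS.∏-* s _ _ ⟩
          γ i j *ˢ Y l ∎
          where
          open S-Reasoning
          l : ℕ
          l = (i + j) % d
          factor : ∀ e → ℓ (δ e) *ˢ ω (δ e) ^ˢ (r i e + r j e) ≋ carry i j e X *ˢ ω (δ e) ^ˢ r l e
          factor e with r i e + r j e <? k | r-add i j e
          ... | yes _  | inj₁ eq = S.*-congˡ (S.reflexive (cong (ω (δ e) ^ˢ_) eq))
          ... | yes lt | inj₂ eq = contradiction (subst (_< k) eq lt) (ℕ.m+n≮m k _)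
          ... | no ge  | inj₁ eq = contradiction (subst (_< k) (sym eq) (r<k l e)) ge
          ... | no _   | inj₂ eq = begin
            ℓ (δ e) *ˢ ω (δ e) ^ˢ (r i e + r j e)              ≈⟨ S.*-congˡ (S.trans (S.reflexive (cong (ω (δ e) ^ˢ_) eq)) (SS.^-homo-* (ω (δ e)) k (r l e))) ⟩
            ℓ (δ e) *ˢ (ω (δ e) ^ˢ k *ˢ ω (δ e) ^ˢ r l e)      ≈⟨ S.sym (S.*-assoc _ _ _) ⟩
            (ℓ (δ e) *ˢ ω (δ e) ^ˢ k) *ˢ ω (δ e) ^ˢ r l e      ≈⟨ S.*-congʳ (ℓω^k (δ e)) ⟩
            𝟙 *ˢ ω (δ e) ^ˢ r l e                              ∎

        Y0≋𝟙 : Y 0 ≋ 𝟙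
        Y0≋𝟙 = SS.∏-1 s λ e _ → S.reflexive (cong (ω (δ e) ^ˢ_) (r0 e))

        Λ0≢0 : Λ 0 ≢ 0#
        Λ0≢0 eq = ∏-≢0 s (λ e → ℓ (δ e) 0) (λ e _ e≡0 → 1≢0 (trans (sym (K.+-identityʳ 1#)) (trans (cong (1# +ᶠ_) (sym (K.zeroʳ _))) e≡0)))
          (trans (sym (∏-at0 s _)) eq)

        -- A nonzero combination G of the Y i is chosen so that Λ G H is a polynomial; its degree is below q, so it vanishes with H.
        zero-estimate : ∀ A (h : ℕ → Pol) → suc (d * (A + s)) ≤ q → (∀ j → j < d → length (h j) ≤ A) →
          V q (SS.∑ d (λ j → ev (h j) X *ˢ y j)) → ∀ j → j < d → IsZero (h j)
        zero-estimate A h dA<q h≤ v = by-kernel (kernel₂ d′ W d A′ d′W<dA′ (λ l w i a → (X ^ˢ a *ˢ M i (suc l)) w))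
          where
          -- The multiplier has `d * A′` coefficients, and the `d′` components of the product other
          -- than the one at `Y 0` impose `d′ * W` conditions. `A′` is the least number for which
          -- the unknowns prevail, and `W` becomes `d * (A + s) + 1`, hence at most q.
          A′ W : ℕ
          A′ = suc (d′ * (A + s))
          W = A′ + (A + s)
          d′W<dA′ : d′ * W < d * A′
          d′W<dA′ = ℕ.≤-trans (ℕ.≤-reflexive (trans (cong suc (ℕ.*-distribˡ-+ d′ A′ (A + s)))
            (trans (sym (ℕ.+-suc (d′ * A′) (d′ * (A + s)))) (ℕ.+-comm (d′ * A′) A′)))) ℕ.≤-refl
          W≤q : W ≤ q
          W≤q = ℕ.≤-trans (ℕ.≤-reflexive (cong suc (ℕ.+-comm (d′ * (A + s)) (A + s)))) dA<q
          H : Ser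
          H = relation d h
          M-term : ℕ → ℕ → ℕ → Ser
          M-term i j l = ifDec (l ≟ (i + j) % d) (ev (h j) X *ˢ γ i j) 𝟘
          M : ℕ → ℕ → Ser
          M i l = SS.∑ d (λ j → M-term i j l)
          Z-M : ∀ i l → Z (suc (A + s)) (M i l)
          Z-M i l = Z-∑ d (λ j → M-term i j l) term
            where
            term : ∀ j → j < d → Z (suc (A + s)) (M-term i j l)
            term j j<d with l ≟ (i + j) % d
            ... | yes _ = Z-≤ (ℕ.n≤1+n (A + s)) (Z-* A (Z-ev (h j) (h≤ j j<d)) (Z-γ i j))
            ... | no _  = λ _ _ → refl
          ΛYH : ∀ i → Λ *ˢ (Y i *ˢ H) ≋ SS.∑ d (λ l → M i l *ˢ Y l)
          ΛYH i = begin
            Λ *ˢ (Y i *ˢ H)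
              ≈⟨ S.*-congˡ (SS.*-distribˡ-∑ d (Y i) _) ⟩
            Λ *ˢ SS.∑ d (λ j → Y i *ˢ (ev (h j) X *ˢ Y j))
              ≈⟨ SS.*-distribˡ-∑ d Λ _ ⟩
            SS.∑ d (λ j → Λ *ˢ (Y i *ˢ (ev (h j) X *ˢ Y j)))
              ≈⟨ SS.∑-cong d (λ j _ → S.trans (S.*-congˡ (ES.x*[a*y] (Y i) (ev (h j) X) (Y j)))
                   (S.trans (ES.x*[a*y] Λ (ev (h j) X) _) (S.trans (S.*-congˡ (ΛYY i j)) (S.sym (S.*-assoc _ _ _))))) ⟩
            SS.∑ d (λ j → (ev (h j) X *ˢ γ i j) *ˢ Y ((i + j) % d))
              ≈⟨ SS.∑-cong d (λ j _ → S.sym (SS.∑-only d (λ l → (ev (h j) X *ˢ γ i j) *ˢ Y l) (ℕ.m%n<n (i + j) d))) ⟩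
            SS.∑ d (λ j → SS.∑ d (SS.only ((i + j) % d) (λ l → (ev (h j) X *ˢ γ i j) *ˢ Y l)))
              ≈⟨ SS.∑-cong d (λ j _ → SS.∑-cong d (λ l _ → only-* j l)) ⟩
            SS.∑ d (λ j → SS.∑ d (λ l → M-term i j l *ˢ Y l))
              ≈⟨ SS.∑-swap d d _ ⟩
            SS.∑ d (λ l → SS.∑ d (λ j → M-term i j l *ˢ Y l))
              ≈⟨ SS.∑-cong d (λ l _ → S.sym (SS.*-distribʳ-∑ d (Y l) _)) ⟩
            SS.∑ d (λ l → M i l *ˢ Y l) ∎
            where
            open S-Reasoning
            only-* : ∀ j l → SS.only ((i + j) % d) (λ l → (ev (h j) X *ˢ γ i j) *ˢ Y l) l ≋ M-term i j l *ˢ Y l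
            only-* j l with l ≟ (i + j) % d
            ... | yes _ = S.refl
            ... | no _  = S.sym (S.zeroˡ (Y l))
          by-kernel : (∃ λ (x : ℕ → ℕ → F) → (∃ λ i → ∃ λ a → i < d × a < A′ × x i a ≢ 0#) ×
            (∀ l w → l < d′ → w < W → KS.∑ d (λ i → KS.∑ A′ (λ a → x i a *ᶠ (X ^ˢ a *ˢ M i (suc l)) w)) ≡ 0#)) →
            ∀ j → j < d → IsZero (h j)
          by-kernel (x , (i₀ , a₀ , i₀<d , a₀<A′ , x≢0) , sol) = independence d ℕ.≤-refl h H≋𝟘
            where
            G : Ser
            G = relation d (λ i → poly (x i) A′)
            C : ℕ → Ser
            C l = SS.∑ d (λ i → ev (poly (x i) A′) X *ˢ M i l)
            ΛGH : Λ *ˢ (G *ˢ H) ≋ SS.∑ d (λ l → C l *ˢ Y l)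
            ΛGH = begin
              Λ *ˢ (G *ˢ H)
                ≈⟨ S.trans (S.*-congˡ (SS.*-distribʳ-∑ d H _)) (SS.*-distribˡ-∑ d Λ _) ⟩
              SS.∑ d (λ i → Λ *ˢ ((ev (poly (x i) A′) X *ˢ Y i) *ˢ H))
                ≈⟨ SS.∑-cong d (λ i _ → S.trans (S.*-congˡ (S.*-assoc _ _ _)) (S.trans (ES.x*[a*y] Λ _ _) (S.*-congˡ (ΛYH i)))) ⟩
              SS.∑ d (λ i → ev (poly (x i) A′) X *ˢ SS.∑ d (λ l → M i l *ˢ Y l))
                ≈⟨ SS.∑-cong d (λ i _ → S.trans (SS.*-distribˡ-∑ d _ _) (SS.∑-cong d λ l _ → S.sym (S.*-assoc _ _ _))) ⟩
              SS.∑ d (λ i → SS.∑ d (λ l → (ev (poly (x i) A′) X *ˢ M i l) *ˢ Y l))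
                ≈⟨ SS.∑-swap d d _ ⟩
              SS.∑ d (λ l → SS.∑ d (λ i → (ev (poly (x i) A′) X *ˢ M i l) *ˢ Y l))
                ≈⟨ SS.∑-cong d (λ l _ → S.sym (SS.*-distribʳ-∑ d (Y l) _)) ⟩
              SS.∑ d (λ l → C l *ˢ Y l) ∎
              where open S-Reasoning
            C-at : ∀ l w → C l w ≡ KS.∑ d (λ i → KS.∑ A′ (λ a → x i a *ᶠ (X ^ˢ a *ˢ M i l) w))
            C-at l w = trans (∑-at d _ w) (KS.∑-cong d λ i _ → trans
              (at (S.trans (S.*-congʳ (ev-poly (x i) A′ X)) (SS.*-distribʳ-∑ A′ (M i l) _)) w)
              (trans (∑-at A′ _ w) (KS.∑-cong A′ λ a _ → at (S.trans (S.*-assoc _ _ _) (ι-·ˢ (x i a) _)) w)))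
            Z-C : ∀ l → Z W (C l)
            Z-C l = Z-∑ d _ λ i _ → Z-* A′ (Z-ev (poly (x i) A′) (ℕ.≤-reflexive (length-poly (x i) A′))) (Z-M i l)
            C≋𝟘 : ∀ l → l < d′ → C (suc l) ≋ 𝟘
            C≋𝟘 l l<d′ .at w with ℕ.<-≤-connex w W
            ... | inj₁ w<W = trans (C-at (suc l) w) (sol l w l<d′ w<W)
            ... | inj₂ W≤w = Z-C (suc l) w W≤w
            ΛGH≋C₀ : Λ *ˢ (G *ˢ H) ≋ C 0
            ΛGH≋C₀ = S.trans ΛGH (S.trans (SS.∑-front d′ _) (S.trans (S.+-cong (S.trans (S.*-congˡ Y0≋𝟙) (S.*-identityʳ _))
              (SS.∑-ε d′ λ l l<d′ → S.trans (S.*-congʳ (C≋𝟘 l l<d′)) (S.zeroˡ _))) (S.+-identityʳ _)))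
            V-H : V q H
            V-H i i<q = trans (sym (≈[]-∑ d (λ j _ → ≈[]-* {s = ev (h j) X} (λ _ _ → refl) (y≈Y j)) i i<q)) (v i i<q)
            C₀≋𝟘 : C 0 ≋ 𝟘
            C₀≋𝟘 .at w with ℕ.<-≤-connex w q
            ... | inj₁ w<q = V-resp ΛGH≋C₀ (V-*ˢʳ Λ (V-*ˢʳ G V-H)) w w<q
            ... | inj₂ q≤w = Z-C 0 w (ℕ.≤-trans W≤q q≤w)
            H≋𝟘 : H ≋ 𝟘
            H≋𝟘 = Ser-domain (≋𝟘-cancel (Ord-0 Λ0≢0) (S.trans ΛGH≋C₀ C₀≋𝟘)) λ G≋𝟘 →
              x≢0 (IsZero-poly (x i₀) A′ (independence d ℕ.≤-refl (λ i → poly (x i) A′) G≋𝟘 i₀ i₀<d) a₀ a₀<A′)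

        -- Taylor coefficients as polynomials in the base point, and Stepanov's inequality

        *ˢ-conv : ∀ u v l → (u *ˢ v) l ≡ KS.∑ (suc l) (λ i → u i *ᶠ v (l ∸ i))
        *ˢ-conv u v zero    = sym (K.+-identityˡ _)
        *ˢ-conv u v (suc l) = trans (cong (u 0 *ᶠ v (suc l) +ᶠ_) (*ˢ-conv (u ∘ suc) v l)) (sym (KS.∑-front (suc l) _))

        -- Coefficient `l` has degree at most `D + l * σ` in the base point. Each order costs σ and
        -- not s, because the curve `U` itself has weight 1; the series `T` have weight 0, so their
        -- high powers n₀ r_j(e) cost no degree at all.
        PW : ℕ → (F → Ser) → Set
        PW D G = ∀ l → EK.Rep (D + l * σ) (λ x → G x l)

        PW-1 : PW 0 (λ _ → 𝟙)
        PW-1 zero    = EK.Rep-1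
        PW-1 (suc l) = EK.Rep-≤ z≤n EK.Rep-0

        PW-* : ∀ {D E G H} → PW D G → PW E H → PW (D + E) (λ x → G x *ˢ H x)
        PW-* {D} {E} {G} {H} pG pH l = EK.Rep-resp (λ x → sym (*ˢ-conv (G x) (H x) l)) (EK.Rep-∑ (suc l) _ λ i i<1+l →
          subst (λ n → EK.Rep n (λ x → G x i *ᶠ H x (l ∸ i))) (degrees i (ℕ.≤-pred i<1+l)) (EK.Rep-* (pG i) (pH (l ∸ i))))
          where
          degrees : ∀ i → i ≤ l → (D + i * σ) + (E + (l ∸ i) * σ) ≡ (D + E) + l * σ
          degrees i i≤l = trans (solve 4 (λ D E u v → (D :+ u) :+ (E :+ v) := (D :+ E) :+ (u :+ v)) refl D E (i * σ) ((l ∸ i) * σ))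
            (cong (D + E +_) (trans (sym (ℕ.*-distribʳ-+ σ i (l ∸ i))) (cong (_* σ) (ℕ.m+[n∸m]≡n i≤l))))
            where open Data.Nat.Solver.+-*-Solver

        PW-^ : ∀ {D G} n → PW D G → PW (n * D) (λ x → G x ^ˢ n)
        PW-^ zero    p = PW-1
        PW-^ (suc n) p = PW-* p (PW-^ n p)

        PW-∏ : ∀ n (G : ℕ → F → Ser) → (∀ e → e < n → PW 0 (G e)) → PW 0 (λ x → SS.∏ n (λ e → G e x))
        PW-∏ zero    G p = PW-1
        PW-∏ (suc n) G p = PW-* (PW-∏ n G λ e e<n → p e (ℕ.m<n⇒m<1+n e<n)) (p n ℕ.≤-refl)

        L : ℕ → F → F
        L e x = 1# +ᶠ -ᶠ δ e *ᶠ x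

        Rep-L : ∀ e → EK.Rep 1 (L e)
        Rep-L e = EK.Rep-+ (EK.Rep-≤ z≤n EK.Rep-1) (EK.Rep-* (EK.Rep-const (-ᶠ δ e)) EK.Rep-id)

        R : F → F
        R x = KS.∏ s (λ e → L e x)

        Rₑ : ℕ → F → F
        Rₑ e x = KS.∏ s (KS.omit* e (λ e′ → L e′ x))

        Rep-R : EK.Rep (suc σ) R
        Rep-R = subst (λ n → EK.Rep n R) (trans (ℕ∑-const s 1) (ℕ.*-identityʳ s)) (EK.Rep-∏ s (λ _ → 1) L λ e _ → Rep-L e)

        Rep-Rₑ : ∀ e → e < s → EK.Rep σ (Rₑ e)
        Rep-Rₑ e e<s = subst (λ n → EK.Rep n (Rₑ e)) degree (EK.Rep-∏ s (ℕΣ.omit e (λ _ → 1)) (λ e′ x → KS.omit* e (λ e″ → L e″ x) e′) λ e′ _ → rep e′)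
          where
          rep : ∀ e′ → EK.Rep (ℕΣ.omit e (λ _ → 1) e′) (λ x → KS.omit* e (λ e″ → L e″ x) e′)
          rep e′ with e′ ≟ e
          ... | yes _ = EK.Rep-1
          ... | no _  = Rep-L e′
          degree : ℕΣ.∑ s (ℕΣ.omit e (λ _ → 1)) ≡ σ
          degree = ℕ.suc-injective (trans (sym (ℕΣ.∑-omit s (λ _ → 1) e<s)) (trans (ℕ∑-const s 1) (ℕ.*-identityʳ s)))

        -- The substitution x + R(x) τ, under which 1 − δₑ X becomes (1 − δₑ x)(1 − δₑ Rₑ(x) τ).
        U : F → Ser
        U x zero          = x
        U x (suc zero)    = R x
        U x (suc (suc _)) = 0#

        T : ℕ → F → Ser
        T e x zero          = 1#
        T e x (suc zero)    = -ᶠ δ e *ᶠ Rₑ e x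
        T e x (suc (suc _)) = 0#

        PW-U : PW 1 U
        PW-U zero          = EK.Rep-id
        PW-U (suc zero)    = subst (λ n → EK.Rep (suc n) R) (sym (ℕ.+-identityʳ σ)) Rep-R
        PW-U (suc (suc l)) = EK.Rep-≤ z≤n EK.Rep-0

        PW-T : ∀ e → e < s → PW 0 (T e)
        PW-T e e<s zero          = EK.Rep-1
        PW-T e e<s (suc zero)    = EK.Rep-≤ (ℕ.≤-reflexive (sym (ℕ.+-identityʳ σ))) (EK.Rep-* (EK.Rep-const (-ᶠ δ e)) (Rep-Rₑ e e<s))
        PW-T e e<s (suc (suc l)) = EK.Rep-≤ z≤n EK.Rep-0

        lin-U : ∀ e x → e < s → lin (δ e) (U x) ≋ ι (L e x) *ˢ T e x
        lin-U e x e<s = S.trans (S.+-congˡ (ι-·ˢ (-ᶠ δ e) (U x))) (S.trans (mk coefs) (S.sym (ι-·ˢ (L e x) (T e x))))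
          where
          coefs : ∀ n → (𝟙 +ˢ (-ᶠ δ e) ·ˢ U x) n ≡ L e x *ᶠ T e x n
          coefs zero = sym (K.*-identityʳ _)
          coefs (suc zero) = trans (K.+-identityˡ _) (trans (cong (-ᶠ δ e *ᶠ_) (KS.∏-omit s (λ e′ → L e′ x) e<s)) (EK.x*[a*y] _ _ _))
          coefs (suc (suc n)) = trans (K.+-identityˡ _) (trans (K.zeroʳ _) (sym (K.zeroʳ _)))

        -- The q-th power is additive and maps the nonconstant part to order q. Below that order,
        -- the factor x^(qi) of high degree therefore acts as x^i of low degree, which is the gain
        -- in Stepanov's method.
        U^q : ∀ x → (U x ^ˢ q) ≈[ q ] ι x
        U^q x = ≈[]-trans (≋⇒≈[] (S.trans (SS.^-congˡ q U≋) (S.trans (frobenius (ι x) W)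
            (S.+-congʳ (S.trans (S.sym (ι-^ x q)) (ι-cong (x^q≡x x)))))))
          λ i i<q → trans (cong (ι x i +ᶠ_) (V-^ˢ q V1-W i (subst (i <_) (sym (ℕ.*-identityʳ q)) i<q))) (K.+-identityʳ _)
          where
          W : Ser
          W zero    = 0#
          W (suc n) = U x (suc n)
          V1-W : V 1 W
          V1-W zero _ = refl
          V1-W (suc _) (s≤s ())
          U≋ : U x ≋ ι x +ˢ W
          U≋ .at zero    = sym (K.+-identityʳ x)
          U≋ .at (suc n) = sym (K.+-identityˡ _)

        G : ℕ → ℕ → F → Ser
        G j a x = U x ^ˢ a *ˢ SS.∏ s (λ e → T e x ^ˢ (n₀ * r j e))

        PW-G : ∀ j a → PW a (G j a)
        PW-G j a = subst (λ n → PW n (G j a)) (trans (ℕ.+-identityʳ _) (ℕ.*-identityʳ a))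
          (PW-* (PW-^ a PW-U) (PW-∏ s (λ e x → T e x ^ˢ (n₀ * r j e)) λ e e<s →
            subst (λ n → PW n (λ x → T e x ^ˢ (n₀ * r j e))) (ℕ.*-zeroʳ (n₀ * r j e)) (PW-^ (n₀ * r j e) (PW-T e e<s))))

        ∑₃-linear : ∀ {I J N} n (f : ℕ → ℕ → ℕ → F) (h : ℕ → ℕ → ℕ → ℕ → F) (z : ℕ → F) →
          KS.∑ I (λ i → KS.∑ J (λ j → KS.∑ N (λ a → f i j a *ᶠ KS.∑ n (λ w → h w i j a *ᶠ z w)))) ≡
          KS.∑ n (λ w → KS.∑ I (λ i → KS.∑ J (λ j → KS.∑ N (λ a → f i j a *ᶠ h w i j a))) *ᶠ z w)
        ∑₃-linear {I} {J} {N} n f h z = begin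
          KS.∑ I (λ i → KS.∑ J (λ j → KS.∑ N (λ a → f i j a *ᶠ KS.∑ n (λ w → h w i j a *ᶠ z w))))
            ≡⟨ KS.∑-cong I (λ i _ → KS.∑-cong J λ j _ → trans (KS.∑-cong N λ a _ → trans (KS.*-distribˡ-∑ n _ _)
                 (KS.∑-cong n λ w _ → sym (K.*-assoc _ _ _))) (KS.∑-swap N n _)) ⟩
          KS.∑ I (λ i → KS.∑ J (λ j → KS.∑ n (λ w → KS.∑ N (λ a → f i j a *ᶠ h w i j a *ᶠ z w))))
            ≡⟨ KS.∑-cong I (λ i _ → KS.∑-swap J n _) ⟩
          KS.∑ I (λ i → KS.∑ n (λ w → KS.∑ J (λ j → KS.∑ N (λ a → f i j a *ᶠ h w i j a *ᶠ z w))))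
            ≡⟨ KS.∑-swap I n _ ⟩
          KS.∑ n (λ w → KS.∑ I (λ i → KS.∑ J (λ j → KS.∑ N (λ a → f i j a *ᶠ h w i j a *ᶠ z w))))
            ≡⟨ KS.∑-cong n (λ w _ → trans (KS.∑-cong I λ i _ → trans (KS.∑-cong J λ j _ → sym (KS.*-distribʳ-∑ N (z w) _))
                 (sym (KS.*-distribʳ-∑ J (z w) _))) (sym (KS.*-distribʳ-∑ I (z w) _))) ⟩
          KS.∑ n (λ w → KS.∑ I (λ i → KS.∑ J (λ j → KS.∑ N (λ a → f i j a *ᶠ h w i j a))) *ᶠ z w) ∎
          where open ≡-Reasoning

        -- Modulo X^q only `H 0` is left, and the hypothesis `small` makes it zero; the rest is
        -- divided by X^q. The layers may overlap in degree, so the zero estimate takes the place of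
        -- a degree bound here.
        layers : ∀ B (H : ℕ → Ser) → (∀ i → V q (H i) → H i ≋ 𝟘) → SS.∑ B (λ i → X ^ˢ (q * i) *ˢ H i) ≋ 𝟘 → ∀ i → i < B → H i ≋ 𝟘
        layers (suc B) H small eq = λ { zero _ → H₀≋𝟘 ; (suc i) (s≤s i<B) → layers B (H ∘ suc) (small ∘ suc) rest≋𝟘 i i<B }
          where
          rest : Ser
          rest = SS.∑ B (λ i → X ^ˢ (q * i) *ˢ H (suc i))
          split : SS.∑ (suc B) (λ i → X ^ˢ (q * i) *ˢ H i) ≋ H 0 +ˢ X ^ˢ q *ˢ rest
          split = S.trans (SS.∑-front B _) (S.+-cong
            (S.trans (S.*-congʳ (S.reflexive (cong (X ^ˢ_) (ℕ.*-zeroʳ q)))) (S.*-identityˡ _))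
            (S.trans (SS.∑-cong B λ i _ → S.trans (S.*-congʳ (S.trans (S.reflexive (cong (X ^ˢ_) (ℕ.*-suc q i))) (SS.^-homo-* X q (q * i))))
              (S.*-assoc _ _ _)) (S.sym (SS.*-distribˡ-∑ B (X ^ˢ q) _))))
          H₀≋𝟘 : H 0 ≋ 𝟘
          H₀≋𝟘 = small 0 λ i i<q → trans (sym (K.+-identityʳ _)) (trans (cong (H 0 i +ᶠ_) (sym (X^-V q rest i i<q)))
            (trans (sym (at split i)) (at eq i)))
          rest≋𝟘 : rest ≋ 𝟘
          rest≋𝟘 .at i = trans (sym (X^-at q rest i)) (trans (sym (K.+-identityˡ _)) (trans (cong (_+ᶠ (X ^ˢ q *ˢ rest) (q + i)) (sym (at H₀≋𝟘 (q + i))))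
            (trans (sym (at split (q + i))) (at eq (q + i)))))

        -- On the class the factors Π L^(n₀ r_j) are constants, so each of the first `M`
        -- coefficients along `U` is given by one polynomial in the base point, of degree below `W`.
        -- Making these polynomials vanish costs `M * W` conditions, however large the class is. The
        -- resulting P has all elements of the class as M-fold roots; were the class too large, P
        -- would vanish, and with it every coefficient.
        stepanov : ∀ A B M → suc (d * (A + s)) ≤ q → M ≤ q → M * (A + B + σ * M) < B * (d * A) →
          (c : ℕ → F) (as : List F) → Unique as →
          (∀ x → x ∈ as → (∀ e → e < s → L e x ≢ 0#) × (∀ j → j < d → KS.∏ s (λ e → L e x ^ᵏ (n₀ * r j e)) ≡ c j)) →
          M * length as < q * B + s * (n₀ * (k ∸ 1))
        stepanov A zero M dA<q M≤q () c as
        stepanov A (suc B′) M dA<q M≤q lt c as unique class = ℕ.≰⇒> λ large → by-kernel large (kernel₃ M W (suc B′) d A lt entry)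
          where
          B W D : ℕ
          B = suc B′
          W = A + B + σ * M
          D = q * B′ + (A + s * (n₀ * (k ∸ 1)))
          instance
            W-nonZero : NonZero W
            W-nonZero = >-nonZero (ℕ.≤-trans (s≤s z≤n) (ℕ.≤-trans (ℕ.m≤n+m B A) (ℕ.m≤m+n (A + B) (σ * M))))
          φ-rep : ∀ l i j a → EK.Rep (i * 1 + (a + l * σ)) (λ x → x ^ᵏ i *ᶠ (c j *ᶠ G j a x l))
          φ-rep l i j a = EK.Rep-* (EK.Rep-^ i EK.Rep-id) (EK.Rep-* (EK.Rep-const (c j)) (PW-G j a l))
          entry : ℕ → ℕ → ℕ → ℕ → ℕ → F
          entry l w i j a = coef (proj₁ (φ-rep l i j a)) w
          φ-length : ∀ l i j a → l < M → i < B → a < A → length (proj₁ (φ-rep l i j a)) ≤ W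
          φ-length l i j a l<M i<B a<A = ℕ.≤-trans (proj₁ (proj₂ (φ-rep l i j a))) (begin
            suc (i * 1 + (a + l * σ))   ≡⟨ cong (λ t → suc (t + (a + l * σ))) (ℕ.*-identityʳ i) ⟩
            suc i + (a + l * σ)         ≤⟨ ℕ.+-mono-≤ i<B (ℕ.+-mono-≤ (ℕ.<⇒≤ a<A) (ℕ.*-monoˡ-≤ σ (ℕ.<⇒≤ l<M))) ⟩
            B + (A + M * σ)             ≡⟨ ℕ.+-assoc B A (M * σ) ⟨
            B + A + M * σ               ≡⟨ cong₂ _+_ (ℕ.+-comm B A) (ℕ.*-comm M σ) ⟩
            W                           ∎)
            where open ℕ.≤-Reasoning
          A<q : A < q
          A<q = ℕ.≤-trans (s≤s (ℕ.≤-trans (ℕ.m≤m+n A s) (ℕ.m≤m+n (A + s) (d′ * (A + s))))) dA<q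
          basis : ℕ → ℕ → ℕ → Ser → Ser
          basis i j a z = z ^ˢ (q * i) *ˢ (z ^ˢ a *ˢ SS.∏ s (λ e → lin (δ e) z ^ˢ (n₀ * r j e)))
          Rep-basis : ∀ i j a → i < B → a < A → Rep D (basis i j a)
          Rep-basis i j a i<B a<A = ES.Rep-≤ bound (ES.Rep-* (ES.Rep-^ (q * i) ES.Rep-id) (ES.Rep-* (ES.Rep-^ a ES.Rep-id)
            (ES.Rep-∏ s (λ _ → n₀ * (k ∸ 1)) (λ e z → lin (δ e) z ^ˢ (n₀ * r j e)) λ e _ →
              ES.Rep-≤ (ℕ.≤-trans (ℕ.≤-reflexive (ℕ.*-identityʳ _)) (ℕ.*-monoʳ-≤ n₀ (ℕ.∸-monoˡ-≤ 1 (r<k j e)))) (ES.Rep-^ (n₀ * r j e) (Rep-lin (δ e))))))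
            where
            bound : q * i * 1 + (a * 1 + ℕΣ.∑ s (λ _ → n₀ * (k ∸ 1))) ≤ D
            bound = ℕ.+-mono-≤ (ℕ.≤-trans (ℕ.≤-reflexive (ℕ.*-identityʳ (q * i))) (ℕ.*-monoʳ-≤ q (ℕ.≤-pred i<B)))
              (ℕ.+-mono-≤ (ℕ.≤-trans (ℕ.≤-reflexive (ℕ.*-identityʳ a)) (ℕ.<⇒≤ a<A)) (ℕ.≤-reflexive (ℕ∑-const s _)))
          by-kernel : q * B + s * (n₀ * (k ∸ 1)) ≤ M * length as →
            (∃ λ (x : ℕ → ℕ → ℕ → F) → (∃ λ i → ∃ λ j → ∃ λ a → i < B × j < d × a < A × x i j a ≢ 0#) ×
              (∀ l w → l < M → w < W → KS.∑ B (λ i → KS.∑ d (λ j → KS.∑ A (λ a → x i j a *ᶠ entry l w i j a))) ≡ 0#)) → ⊥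
          by-kernel large (x , (i₀ , j₀ , a₀ , i₀<B , j₀<d , a₀<A , x≢0) , sol) =
            x≢0 (IsZero-poly (x i₀ j₀) A (zero-h i₀ (λ i _ → at (layers B H H-small P-X i₀ i₀<B) i) j₀ j₀<d) a₀ a₀<A)
            where
            P : Ser → Ser
            P z = SS.∑ B (λ i → SS.∑ d (λ j → SS.∑ A (λ a → ι (x i j a) *ˢ basis i j a z)))
            P-rep : Rep D P
            P-rep = ES.Rep-∑ B _ λ i i<B → ES.Rep-∑ d _ λ j _ → ES.Rep-∑ A _ λ a a<A →
              ES.Rep-* (ES.Rep-const (x i j a)) (Rep-basis i j a i<B a<A)
            basis-U : ∀ u → u ∈ as → ∀ i j a → j < d → basis i j a (U u) ≈[ q ] (ι (u ^ᵏ i *ᶠ c j) *ˢ G j a u)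
            basis-U u u∈as i j a j<d = ≈[]-trans (≈[]-* (≈[]-trans (≋⇒≈[] (S.sym (SS.^-assocʳ (U u) q i)))
                (≈[]-trans (≈[]-^ i (U^q u)) (≋⇒≈[] (S.sym (ι-^ u i))))) (λ _ _ → refl)) (≋⇒≈[] (begin
              ι (u ^ᵏ i) *ˢ (U u ^ˢ a *ˢ SS.∏ s (λ e → lin (δ e) (U u) ^ˢ (n₀ * r j e)))
                ≈⟨ S.*-congˡ (S.*-congˡ (SS.∏-cong s λ e e<s → S.trans (SS.^-congˡ (n₀ * r j e) (lin-U e u e<s))
                     (S.trans (SS.^-distrib-* _ _ (n₀ * r j e)) (S.*-congʳ (S.sym (ι-^ (L e u) (n₀ * r j e))))))) ⟩
              ι (u ^ᵏ i) *ˢ (U u ^ˢ a *ˢ SS.∏ s (λ e → ι (L e u ^ᵏ (n₀ * r j e)) *ˢ T e u ^ˢ (n₀ * r j e)))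
                ≈⟨ S.*-congˡ (S.*-congˡ (S.trans (SS.∏-* s _ _) (S.*-congʳ (S.trans (S.sym (ι-∏ s _)) (ι-cong (proj₂ (class u u∈as) j j<d)))))) ⟩
              ι (u ^ᵏ i) *ˢ (U u ^ˢ a *ˢ (ι (c j) *ˢ SS.∏ s (λ e → T e u ^ˢ (n₀ * r j e))))
                ≈⟨ S.*-congˡ (ES.x*[a*y] _ _ _) ⟩
              ι (u ^ᵏ i) *ˢ (ι (c j) *ˢ G j a u)
                ≈⟨ S.trans (S.sym (S.*-assoc _ _ _)) (S.*-congʳ (S.sym (ι-* _ _))) ⟩
              ι (u ^ᵏ i *ᶠ c j) *ˢ G j a u ∎))
              where open S-Reasoning
            vanishes : ∀ u → u ∈ as → V M (P (U u))
            vanishes u u∈as l l<M = begin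
              P (U u) l
                ≡⟨ trans (∑-at B _ l) (KS.∑-cong B λ i _ → trans (∑-at d _ l) (KS.∑-cong d λ j _ → ∑-at A _ l)) ⟩
              KS.∑ B (λ i → KS.∑ d (λ j → KS.∑ A (λ a → (ι (x i j a) *ˢ basis i j a (U u)) l)))
                ≡⟨ KS.∑-cong B (λ i i<B → KS.∑-cong d λ j j<d → KS.∑-cong A λ a a<A → trans (at (ι-·ˢ (x i j a) _) l) (cong (x i j a *ᶠ_) (value i j a i<B j<d a<A))) ⟩
              KS.∑ B (λ i → KS.∑ d (λ j → KS.∑ A (λ a → x i j a *ᶠ KS.∑ W (λ w → entry l w i j a *ᶠ u ^ᵏ w))))
                ≡⟨ ∑₃-linear {B} {d} {A} W x (entry l) (u ^ᵏ_) ⟩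
              KS.∑ W (λ w → KS.∑ B (λ i → KS.∑ d (λ j → KS.∑ A (λ a → x i j a *ᶠ entry l w i j a))) *ᶠ u ^ᵏ w)
                ≡⟨ KS.∑-ε W (λ w w<W → trans (cong (_*ᶠ u ^ᵏ w) (sol l w l<M w<W)) (K.zeroˡ _)) ⟩
              0# ∎
              where
              open ≡-Reasoning
              value : ∀ i j a → i < B → j < d → a < A → basis i j a (U u) l ≡ KS.∑ W (λ w → entry l w i j a *ᶠ u ^ᵏ w)
              value i j a i<B j<d a<A = trans (basis-U u u∈as i j a j<d l (ℕ.<-≤-trans l<M M≤q))
                (trans (trans (at (ι-·ˢ _ _) l) (K.*-assoc _ _ _)) (trans (sym (proj₂ (proj₂ (φ-rep l i j a)) u))
                  (EK.ev-coef W (proj₁ (φ-rep l i j a)) u (φ-length l i j a l<M i<B a<A))))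
            P≋𝟘 : P X ≋ 𝟘
            P≋𝟘 = S.trans (S.sym (proj₂ (proj₂ P-rep) X)) (roots M as U (proj₁ P-rep) unique
              -- The velocity `R u` of the curve is nonzero because no factor `L e u` vanishes, so
              -- `U u` measures multiplicities at `u`.
              (λ u u∈as → (refl , ∏-≢0 s _ (proj₁ (class u u∈as))) , V-resp (S.sym (proj₂ (proj₂ P-rep) (U u))) (vanishes u u∈as))
              (ℕ.≤-trans (proj₁ (proj₂ P-rep)) (ℕ.≤-trans size large)) X)
              where
              size : suc D ≤ q * B + s * (n₀ * (k ∸ 1))
              size = begin
                suc (q * B′ + (A + s * (n₀ * (k ∸ 1))))   ≡⟨ solve 3 (λ u v w → con 1 :+ (u :+ (v :+ w)) := ((con 1 :+ v) :+ u) :+ w) refl (q * B′) A (s * (n₀ * (k ∸ 1))) ⟩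
                suc A + q * B′ + s * (n₀ * (k ∸ 1))       ≤⟨ ℕ.+-monoˡ-≤ _ (ℕ.+-monoˡ-≤ (q * B′) A<q) ⟩
                q + q * B′ + s * (n₀ * (k ∸ 1))           ≡⟨ cong (_+ s * (n₀ * (k ∸ 1))) (sym (ℕ.*-suc q B′)) ⟩
                q * B + s * (n₀ * (k ∸ 1))                ∎
                where
                open ℕ.≤-Reasoning
                open Data.Nat.Solver.+-*-Solver
            H : ℕ → Ser
            H i = SS.∑ d (λ j → ev (poly (x i j) A) X *ˢ y j)
            zero-h : ∀ i → V q (H i) → ∀ j → j < d → IsZero (poly (x i j) A)
            zero-h i = zero-estimate A (λ j → poly (x i j) A) dA<q (λ j _ → ℕ.≤-reflexive (length-poly (x i j) A))
            H-small : ∀ i → V q (H i) → H i ≋ 𝟘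
            H-small i v = SS.∑-ε d λ j j<d → S.trans (S.*-congʳ (ev-IsZero (poly (x i j) A) (zero-h i v j j<d) X)) (S.zeroˡ (y j))
            P-X : SS.∑ B (λ i → X ^ˢ (q * i) *ˢ H i) ≋ 𝟘
            P-X = S.trans (SS.∑-cong B λ i _ → S.trans (SS.*-distribˡ-∑ d _ _) (SS.∑-cong d λ j _ → S.trans
                (S.*-congˡ (S.trans (S.*-congʳ (ev-poly (x i j) A X)) (SS.*-distribʳ-∑ A (y j) _)))
                (S.trans (SS.*-distribˡ-∑ A _ _) (SS.∑-cong A λ a _ → S.trans (S.*-congˡ (S.*-assoc _ _ _)) (ES.x*[a*y] _ _ _))))) P≋𝟘

    -- Counting the elements whose differences to all points are k-th powers

    module OffPoints (σ : ℕ) (pt : ℕ → F) where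
      s : ℕ
      s = suc σ

      OnPoint : F → Set
      OnPoint a = ∃ λ e → e < s × a ≡ pt e

      onPoint? : ∀ a → Dec (OnPoint a)
      onPoint? a = ℕ.anyUpTo? (λ e → a ≟ᶠ pt e) s

      others : List F
      others = filter (¬? ∘ onPoint?) elems

      others-unique : Unique others
      others-unique = Unique.filter⁺ (¬? ∘ onPoint?) elems-unique

      length-others : q ≤ length others + s
      length-others = begin
        q                                       ≡⟨ length-elems ⟨
        length elems                            ≡⟨ length-filter-¬ onPoint? elems ⟨
        length points + length others           ≤⟨ ℕ.+-monoˡ-≤ (length others) points≤s ⟩
        s + length others                       ≡⟨ ℕ.+-comm s _ ⟩
        length others + s                       ∎
        where
        open ℕ.≤-Reasoning
        points : List F
        points = filter onPoint? elems
        key : F → ℕ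
        key a with onPoint? a
        ... | yes (e , _) = e
        ... | no _ = 0
        key-correct : ∀ a → OnPoint a → a ≡ pt (key a % s)
        key-correct a on with onPoint? a
        ... | yes (e , e<s , eq) = trans eq (cong pt (sym (ℕ.m<n⇒m%n≡m e<s)))
        ... | no ¬on = contradiction on ¬on
        at-most-one : ∀ (p : F) as → Unique as → (∀ a → a ∈ as → a ≡ p) → length as ≤ 1
        at-most-one p [] _ _ = z≤n
        at-most-one p (a ∷ []) _ _ = s≤s z≤n
        at-most-one p (a ∷ b ∷ as) ((a≢b ∷ _) ∷ _) eq = contradiction (trans (eq a (here refl)) (sym (eq b (there (here refl))))) a≢b
        points≤s : length points ≤ s
        points≤s = begin
          length points                                                       ≡⟨ sumOver-1 points ⟨
          sumOver points (λ _ → 1)                                            ≡⟨ sumOver-classes s key (λ _ → 1) points ⟩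
          ℕΣ.∑ s (λ l → 1 * length (filter (λ a → l ≟ key a % s) points))     ≤⟨ ℕ∑-mono-≤ s (λ l _ → ℕ.≤-trans (ℕ.≤-reflexive (ℕ.*-identityˡ _)) (one l)) ⟩
          ℕΣ.∑ s (λ _ → 1)                                                    ≡⟨ trans (ℕ∑-const s 1) (ℕ.*-identityʳ s) ⟩
          s                                                                   ∎
          where
          one : ∀ l → length (filter (λ a → l ≟ key a % s) points) ≤ 1
          one l = at-most-one (pt l) _ (Unique.filter⁺ (λ a → l ≟ key a % s) (Unique.filter⁺ onPoint? elems-unique)) λ a a∈ →
            let a∈points , l≡ = ∈.∈-filter⁻ (λ a → l ≟ key a % s) {xs = points} a∈
            in trans (key-correct a (proj₂ (∈.∈-filter⁻ onPoint? {xs = elems} a∈points))) (cong pt (sym l≡))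

    module ManyPowers (j σ n₀ : ℕ) (q≡1+kn₀ : q ≡ suc ((2 + j) * n₀))
      (pt : ℕ → F) (pt-injective : ∀ e e′ → e < suc σ → e′ < suc σ → pt e ≡ pt e′ → e ≡ e′) where
      open Parameters j σ
      open OffPoints σ pt hiding (s) public
      open Averaging κ using (dot; InBox; NonZeroVector; Bad; bad?; averaging; Content; content; class-bound
        ; exponent; exponent-<k; exponent-add; exponent-distinct; ŵ)

      v : F → ℕ → ℕ
      v a e with (a -ᶠ pt e) ≟ᶠ 0#
      ... | yes _ = 0
      ... | no a≢pt = proj₁ (dlog _ a≢pt)

      g^v : ∀ a → ¬ OnPoint a → ∀ e → e < s → g ^ᵏ v a e ≡ a -ᶠ pt e
      g^v a ¬on e e<s with (a -ᶠ pt e) ≟ᶠ 0#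
      ... | yes a≡pt = contradiction (e , e<s , -‿≡0 a≡pt) ¬on
      ... | no a≢pt = proj₂ (dlog _ a≢pt)

      ζ : F
      ζ = g ^ᵏ n₀

      ζ^k≡1 : ζ ^ᵏ k ≡ 1#
      ζ^k≡1 = trans (KS.^-assocʳ g n₀ k) (trans (cong (g ^ᵏ_) (trans (ℕ.*-comm n₀ k) (ℕ.suc-injective (trans (sym q≡1+kn₀) q≡)))) g^q-1≡1)

      ∏-^ᵏ : ∀ n x (f : ℕ → ℕ) → KS.∏ n (λ e → x ^ᵏ f e) ≡ x ^ᵏ ℕΣ.∑ n f
      ∏-^ᵏ zero    x f = refl
      ∏-^ᵏ (suc n) x f = trans (cong (_*ᶠ x ^ᵏ f n) (∏-^ᵏ n x f)) (sym (KS.^-homo-* x (ℕΣ.∑ n f) (f n)))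

      module _ {M : ℕ} (M²≤q : M * M ≤ q) (q≤ : q ≤ M * (M + 2)) (ks<M : suc (k * s) ≤ M) (6≤M : 6 ≤ M) where
        module _ {ψ : ℕ → ℕ} (C : Content s ψ) (l : ℕ) where
          open Content C
          open Bounds {q} {n₀} {M} q≡1+kn₀ M²≤q q≤ ks<M 6≤M {h} {d′} h*d≡k using (d; A; B; size; count; bound; M≤q)

          private
            class : List F
            class = filter (λ a → l ≟ dot s ρ (v a) % d) others

            r : ℕ → ℕ → ℕ
            r = exponent C

            ζ^dot : ∀ a → l ≡ dot s ρ (v a) % d → ∀ i → ζ ^ᵏ (dot s ρ (v a) * (i * h)) ≡ ζ ^ᵏ (l * (i * h))
            ζ^dot a l≡ i = trans (^ᵏ-mod k (dot s ρ (v a) * (i * h)) ζ^k≡1) (trans (cong (ζ ^ᵏ_) same) (sym (^ᵏ-mod k (l * (i * h)) ζ^k≡1)))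
              where
              open Data.Nat.Solver.+-*-Solver
              D : ℕ
              D = dot s ρ (v a)
              same : (D * (i * h)) % k ≡ (l * (i * h)) % k
              same = begin
                (D * (i * h)) % k                          ≡⟨ cong (λ t → (t * (i * h)) % k) (ℕ.m≡m%n+[m/n]*n D d) ⟩
                ((D % d + D / d * d) * (i * h)) % k        ≡⟨ cong (_% k) (solve 5 (λ a b d i h → (a :+ b :* d) :* (i :* h) := a :* (i :* h) :+ b :* i :* (h :* d)) refl (D % d) (D / d) d i h) ⟩
                (D % d * (i * h) + D / d * i * (h * d)) % k ≡⟨ cong₂ (λ t u → (t * (i * h) + D / d * i * u) % k) (sym l≡) h*d≡k ⟩
                (l * (i * h) + D / d * i * k) % k          ≡⟨ ℕ.[m+kn]%n≡m%n (l * (i * h)) (D / d * i) k ⟩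
                (l * (i * h)) % k                          ∎
                where open ≡-Reasoning

            -- In terms of ζ = g^n₀ the product is ζ to the power Σ r_i(e) v(e), which modulo k is
            -- `dot s ρ (v a)` times `i * h`. As ζ^(hd) = 1, only the residue `l` modulo `d`
            -- matters.
            ∏-class : ∀ a → ¬ OnPoint a → l ≡ dot s ρ (v a) % d → ∀ i →
              KS.∏ s (λ e → (a -ᶠ pt e) ^ᵏ (n₀ * r i e)) ≡ ζ ^ᵏ (l * (i * h))
            ∏-class a ¬on l≡ i = begin
              KS.∏ s (λ e → (a -ᶠ pt e) ^ᵏ (n₀ * r i e))
                ≡⟨ KS.∏-cong s (λ e e<s → factor e e<s) ⟩
              KS.∏ s (λ e → ζ ^ᵏ (ρ e * v a e * (i * h)))
                ≡⟨ ∏-^ᵏ s ζ _ ⟩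
              ζ ^ᵏ ℕΣ.∑ s (λ e → ρ e * v a e * (i * h))
                ≡⟨ cong (ζ ^ᵏ_) (ℕ∑-*ʳ s _ (i * h)) ⟨
              ζ ^ᵏ (dot s ρ (v a) * (i * h))
                ≡⟨ ζ^dot a l≡ i ⟩
              ζ ^ᵏ (l * (i * h)) ∎
              where
              open ≡-Reasoning
              factor : ∀ e → e < s → (a -ᶠ pt e) ^ᵏ (n₀ * r i e) ≡ ζ ^ᵏ (ρ e * v a e * (i * h))
              factor e e<s = begin
                (a -ᶠ pt e) ^ᵏ (n₀ * r i e)              ≡⟨ cong (_^ᵏ (n₀ * r i e)) (g^v a ¬on e e<s) ⟨
                (g ^ᵏ v a e) ^ᵏ (n₀ * r i e)             ≡⟨ KS.^-assocʳ g (v a e) (n₀ * r i e) ⟩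
                g ^ᵏ (v a e * (n₀ * r i e))              ≡⟨ cong (g ^ᵏ_) (solve 3 (λ v n r → v :* (n :* r) := n :* (r :* v)) refl (v a e) n₀ (r i e)) ⟩
                g ^ᵏ (n₀ * (r i e * v a e))              ≡⟨ KS.^-assocʳ g n₀ (r i e * v a e) ⟨
                ζ ^ᵏ (r i e * v a e)                     ≡⟨ KS.^-assocʳ ζ (r i e) (v a e) ⟨
                (ζ ^ᵏ r i e) ^ᵏ v a e                    ≡⟨ cong (_^ᵏ v a e) (^ᵏ-mod k (i * (ρ e * h)) ζ^k≡1) ⟨
                (ζ ^ᵏ (i * (ρ e * h))) ^ᵏ v a e          ≡⟨ KS.^-assocʳ ζ (i * (ρ e * h)) (v a e) ⟩
                ζ ^ᵏ (i * (ρ e * h) * v a e)             ≡⟨ cong (ζ ^ᵏ_) (solve 4 (λ i r h v → i :* (r :* h) :* v := r :* v :* (i :* h)) refl i (ρ e) h (v a e)) ⟩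
                ζ ^ᵏ (ρ e * v a e * (i * h))             ∎
                where open Data.Nat.Solver.+-*-Solver

          -- Stepanov's bound after a translation moving a base point b, distinct from all pt e, to the origin.
          class-size : M * length class < q * B + s * (n₀ * κ)
          class-size with others in eq
          ... | [] = contradiction (subst (λ as → q ≤ length as + s) eq length-others) (ℕ.<⇒≱ s<q)
            where
            s<q : s < q
            s<q = ℕ.≤-trans (s≤s (ℕ.m≤n*m s k)) (ℕ.≤-trans ks<M M≤q)
          ... | b ∷ _ = subst (λ as → M * length (filter (λ a → l ≟ dot s ρ (v a) % d) as) < q * B + s * (n₀ * κ)) eq bounded
            where
            b-off : ¬ OnPoint b
            b-off = proj₂ (∈.∈-filter⁻ (¬? ∘ onPoint?) {xs = elems} (subst (b ∈_) (sym eq) (here refl)))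
            pt-b≢0 : ∀ e → e < s → pt e -ᶠ b ≢ 0#
            pt-b≢0 e e<s e≡ = b-off (e , e<s , sym (-‿≡0 e≡))
            δ : ℕ → F
            δ e = (pt e -ᶠ b) ⁻¹
            δ-injective : ∀ e e′ → e < s → e′ < s → δ e ≡ δ e′ → e ≡ e′
            δ-injective e e′ e<s e′<s δ≡ = pt-injective e e′ e<s e′<s (KP.+-cancelʳ (-ᶠ b) _ _ (*-cancelˡ (⁻¹-≢0 (pt-b≢0 e e<s)) (begin
              δ e *ᶠ (pt e -ᶠ b)      ≡⟨ trans (K.*-comm _ _) (⁻¹-inverse (pt-b≢0 e e<s)) ⟩
              1#                      ≡⟨ trans (K.*-comm _ _) (⁻¹-inverse (pt-b≢0 e′ e′<s)) ⟨
              δ e′ *ᶠ (pt e′ -ᶠ b)    ≡⟨ cong (_*ᶠ (pt e′ -ᶠ b)) δ≡ ⟨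
              δ e *ᶠ (pt e′ -ᶠ b)     ∎)))
              where open ≡-Reasoning
            module St = RootSeries.Monomials k n₀ q≡1+kn₀ σ δ (λ e e<s → ⁻¹-≢0 (pt-b≢0 e e<s)) δ-injective d′ r (exponent-<k C)
              (exponent-distinct C) (λ _ → refl) (exponent-add C)
            L≡ : ∀ e a → e < s → St.L e (a -ᶠ b) ≡ (a -ᶠ pt e) *ᶠ -ᶠ δ e
            L≡ e a e<s = begin
              1# +ᶠ -ᶠ δ e *ᶠ (a -ᶠ b)                                ≡⟨ cong (_+ᶠ -ᶠ δ e *ᶠ (a -ᶠ b)) (⁻¹-inverse (pt-b≢0 e e<s)) ⟨
              (pt e -ᶠ b) *ᶠ δ e +ᶠ -ᶠ δ e *ᶠ (a -ᶠ b)                ≡⟨ cong₂ _+ᶠ_ (sym (-x*-y _ _)) (K.*-comm _ _) ⟩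
              (-ᶠ (pt e -ᶠ b)) *ᶠ -ᶠ δ e +ᶠ (a -ᶠ b) *ᶠ -ᶠ δ e        ≡⟨ K.distribʳ (-ᶠ δ e) _ _ ⟨
              (-ᶠ (pt e -ᶠ b) +ᶠ (a -ᶠ b)) *ᶠ -ᶠ δ e                  ≡⟨ cong (_*ᶠ -ᶠ δ e) (difference (pt e) a b) ⟩
              (a -ᶠ pt e) *ᶠ -ᶠ δ e                                   ∎
              where open ≡-Reasoning
            bounded : M * length class < q * B + s * (n₀ * κ)
            bounded = subst (λ n → M * n < q * B + s * (n₀ * κ)) (List.length-map (_-ᶠ b) class)
              -- The linear factors are normalised to constant term 1, so 1 - δₑ(a - b) = -δₑ(a - pt
              -- e); the class constant acquires the corresponding powers of -δₑ.
              (St.stepanov A B M size M≤q count (λ i → ζ ^ᵏ (l * (i * h)) *ᶠ KS.∏ s (λ e → (-ᶠ δ e) ^ᵏ (n₀ * r i e)))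
                (map (_-ᶠ b) class) (Unique.map⁺ (KP.+-cancelʳ (-ᶠ b) _ _) (Unique.filter⁺ _ others-unique)) member)
              where
              member : ∀ x → x ∈ map (_-ᶠ b) class → (∀ e → e < s → St.L e x ≢ 0#) ×
                (∀ i → i < d → KS.∏ s (λ e → St.L e x ^ᵏ (n₀ * r i e)) ≡ ζ ^ᵏ (l * (i * h)) *ᶠ KS.∏ s (λ e → (-ᶠ δ e) ^ᵏ (n₀ * r i e)))
              member x x∈ with ∈.∈-map⁻ (_-ᶠ b) x∈
              ... | a , a∈ , refl with ∈.∈-filter⁻ (λ a → l ≟ dot s ρ (v a) % d) {xs = others} a∈
              ...   | a∈others , l≡ = nonzero , product
                where
                a-off : ¬ OnPoint a
                a-off = proj₂ (∈.∈-filter⁻ (¬? ∘ onPoint?) {xs = elems} a∈others)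
                nonzero : ∀ e → e < s → St.L e (a -ᶠ b) ≢ 0#
                nonzero e e<s L≡0 = *-≢0 (λ a≡pt → a-off (e , e<s , -‿≡0 a≡pt)) (λ -δ≡0 → ⁻¹-≢0 (pt-b≢0 e e<s)
                  (trans (sym (KP.-‿involutive _)) (trans (cong -ᶠ_ -δ≡0) KP.-0#≈0#))) (trans (sym (L≡ e a e<s)) L≡0)
                product : ∀ i → i < d → KS.∏ s (λ e → St.L e (a -ᶠ b) ^ᵏ (n₀ * r i e)) ≡ ζ ^ᵏ (l * (i * h)) *ᶠ KS.∏ s (λ e → (-ᶠ δ e) ^ᵏ (n₀ * r i e))
                product i _ = trans (KS.∏-cong s λ e e<s → trans (cong (_^ᵏ (n₀ * r i e)) (L≡ e a e<s)) (KS.^-distrib-* _ _ (n₀ * r i e)))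
                  (trans (KS.∏-* s _ _) (cong (_*ᶠ KS.∏ s (λ e → (-ᶠ δ e) ^ᵏ (n₀ * r i e))) (∏-class a a-off l≡ i)))

        good : List F
        good = filter (λ a → ¬? (bad? s (v a))) others

        -- All nonzero vectors obey the same bound `U`, since the order `d` cancels between the
        -- weights of the classes and their sizes. With at most `ν` good elements the averaging
        -- inequality would contradict `main`.
        many-good : k ^ s * Ψ ≤ M → ν < length good
        many-good QΨ≤M = ℕ.≰⇒> λ few → ℕ.<⇒≱ (main M²≤q QΨ≤M) (upper few)
          where
          open Data.Nat.Solver.+-*-Solver
          Q E U : ℕ
          Q = k ^ s
          E = Θ * (M + 3)
          U = q + E
          instance
            M-nonZero : NonZero M
            M-nonZero = >-nonZero (ℕ.≤-trans (s≤s z≤n) 6≤M)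
          vector-bound : ∀ ψ → InBox s ψ → NonZeroVector s ψ → sumOver others (λ a → ŵ (dot s ψ (v a))) ≤ U
          vector-bound ψ inb ψ≢0 = ℕ.≤-trans (class-bound C others v (U / d) λ l _ → quotient-bound l)
              (ℕ.≤-trans (ℕ.≤-reflexive (ℕ.*-comm d (U / d))) (ℕ.m/n*n≤m U d))
            where
            C : Content s ψ
            C = content s ψ inb ψ≢0
            open Content C
            open Bounds {q} {n₀} {M} q≡1+kn₀ M²≤q q≤ ks<M 6≤M {h} {d′} h*d≡k using (d; bound)
            quotient-bound : ∀ l → length (filter (λ a → l ≟ dot s ρ (v a) % d) others) ≤ U / d
            quotient-bound l = ℕ.≤-trans (ℕ.≤-reflexive (sym (ℕ.m*n/n≡m n d))) (ℕ./-monoˡ-≤ d (ℕ.*-cancelʳ-≤ (n * d) U M (begin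
              n * d * M      ≡⟨ solve 3 (λ n d m → n :* d :* m := d :* (m :* n)) refl n d M ⟩
              d * (M * n)    ≤⟨ ℕ.*-monoʳ-≤ d (ℕ.<⇒≤ (class-size C l)) ⟩
              d * _          ≤⟨ bound ⟩
              U * M          ∎)))
              where
              open ℕ.≤-Reasoning
              n : ℕ
              n = length (filter (λ a → l ≟ dot s ρ (v a) % d) others)
          upper : length good ≤ ν → q ≤ Q * (E + s + ν)
          -- The main terms `q * Q` cancel. What leaves q on the left is the summand `U` that
          -- `averaging` gains from the zero vector.
          upper few = ℕ.≤-trans (ℕ.m≤m+n q E) (ℕ.+-cancelˡ-≤ (q * Q) _ _ (begin
            q * Q + U                                    ≤⟨ ℕ.+-monoˡ-≤ U (ℕ.*-monoˡ-≤ Q length-others) ⟩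
            (length others + s) * Q + U                  ≡⟨ solve 4 (λ o s q u → (o :+ s) :* q :+ u := o :* q :+ u :+ s :* q) refl (length others) s Q U ⟩
            length others * Q + U + s * Q                ≤⟨ ℕ.+-monoˡ-≤ (s * Q) (averaging s others v U vector-bound) ⟩
            length good * Q + Q * U + s * Q              ≤⟨ ℕ.+-monoˡ-≤ (s * Q) (ℕ.+-monoˡ-≤ (Q * U) (ℕ.*-monoˡ-≤ Q few)) ⟩
            ν * Q + Q * U + s * Q                        ≡⟨ solve 5 (λ n q x s f → n :* f :+ f :* (q :+ x) :+ s :* f := q :* f :+ f :* (x :+ s :+ n)) refl ν q E s Q ⟩
            q * Q + Q * (E + s + ν)                      ∎))
            where open ℕ.≤-Reasoning

    PowerList : ℕ → ℕ → List F → Set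
    PowerList k n₀ ps = ∃ λ as → Unique as × 3 + k * (k * k) < length as × (∀ a p → a ∈ as → p ∈ ps → (a -ᶠ p) ^ᵏ n₀ ≡ 1#)

    -- Without points every element qualifies, and for k = 1 every element off the points does,
    -- since all nonzero elements are first powers. Only k ≥ 2 needs characters. The length of `ps`
    -- may fall below `S` because repeated multipliers have been removed.
    power-list : ∀ k n₀ S q₀ → k ≢ 0 → q ≡ suc (k * n₀) → BoundHolds (3 + S) k q₀ → q₀ ≤ q →
      ∀ ps → Unique ps → length ps ≤ S → PowerList k n₀ ps
    power-list k n₀ S q₀ k≢0 q≡1+kn₀ bound q₀≤q [] _ _ = elems , elems-unique , large , λ _ _ _ ()
      where
      instance
        k-nonZero : NonZero k
        k-nonZero = ≢-nonZero k≢0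
      large : 3 + k * (k * k) < length elems
      large = ℕ.≤-<-trans (ℕ.+-mono-≤ (ℕ.≤-trans (ℕ.m≤m+n 3 S) (ℕ.m≤m*n (3 + S) (k ^ (2 + S)) {{ℕ.m^n≢0 k (2 + S)}}))
          (ℕ.*-monoʳ-≤ k (ℕ.*-monoʳ-≤ k (ℕ.m≤m*n k (k ^ S) {{ℕ.m^n≢0 k S}}))))
        (subst ((3 + S) * k ^ (2 + S) + k ^ (3 + S) <_) (sym length-elems) (ℕ.<-≤-trans (bound⇒T+K<m (3 + S) k q₀ bound) q₀≤q))
    power-list zero n₀ S q₀ k≢0 _ _ _ _ _ _ = contradiction refl k≢0
    power-list 1 n₀ S q₀ k≢0 q≡1+kn₀ bound q₀≤q ps@(p₀ ∷ ps′) u s≤S = others , others-unique , large , powers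
      where
      open OffPoints (length ps′) (nth p₀ ps)
      large : 4 < length others
      large = ℕ.+-cancelʳ-< s 4 (length others) (ℕ.<-≤-trans (ℕ.≤-<-trans (ℕ.+-monoʳ-≤ 4 s≤S) S+4<q) length-others)
        where
        S+4<q : 4 + S < q
        S+4<q = subst (_< q) (trans (cong₂ _+_ (trans (cong ((3 + S) *_) (ℕ.^-zeroˡ (2 + S))) (ℕ.*-identityʳ (3 + S))) (ℕ.^-zeroˡ (3 + S)))
          (ℕ.+-comm (3 + S) 1)) (ℕ.<-≤-trans (bound⇒T+K<m (3 + S) 1 q₀ bound) q₀≤q)
      powers : ∀ a p → a ∈ others → p ∈ ps → (a -ᶠ p) ^ᵏ n₀ ≡ 1#
      powers a p a∈ p∈ with ∈-nth p₀ ps p∈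
      ... | e , e<s , refl = subst (λ n → (a -ᶠ nth p₀ ps e) ^ᵏ n ≡ 1#) (trans (ℕ.suc-injective (trans (sym q≡) q≡1+kn₀)) (ℕ.*-identityˡ n₀))
        (x^q-1≡1 λ a≡p → proj₂ (∈.∈-filter⁻ (¬? ∘ onPoint?) {xs = elems} a∈) (e , e<s , -‿≡0 a≡p))
    power-list (suc (suc j)) n₀ S q₀ k≢0 q≡1+kn₀ bound q₀≤q ps@(p₀ ∷ ps′) u s≤S with isqrt q
    ... | M , M²≤q , q<[1+M]² = good M²≤q q≤ ks<M 6≤M , Unique.filter⁺ _ others-unique , large , powers
      where
      open ManyPowers j (length ps′) n₀ q≡1+kn₀ (nth p₀ ps) (λ e e′ → nth-injective p₀ ps u e e′)
      open Parameters j (length ps′)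
      open Averaging κ using (bad?; Bad)
      B W : ℕ
      W = k ^ (2 + S)
      -- The coefficient tK - K - T + 1 of the hypothesis for t = 3 + S, with k = 2 + j inserted so
      -- that no subtraction remains.
      B = W * (S + 1 + j * (S + 2)) + 1
      B≡ : B + k ^ (3 + S) + (3 + S) * k ^ (2 + S) ≡ (3 + S) * k ^ (3 + S) + 1
      B≡ = solve 3 (λ w s j → w :* (s :+ con 1 :+ j :* (s :+ con 2)) :+ con 1 :+ (con 2 :+ j) :* w :+ (con 3 :+ s) :* w
          := (con 3 :+ s) :* ((con 2 :+ j) :* w) :+ con 1) refl W S j
        where open Data.Nat.Solver.+-*-Solver
      -- Otherwise q < (M + 1)² ≤ B² < q₀ ≤ q.
      B≤M : B ≤ M
      B≤M = ℕ.≮⇒≥ λ M<B → ℕ.<⇒≱ (ℕ.<-≤-trans (bound⇒B²<m (3 + S) k q₀ B B≡ bound) (ℕ.≤-trans q₀≤q (ℕ.<⇒≤ q<[1+M]²))) (ℕ.*-mono-≤ M<B M<B)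
      k^sΨ≤M : k ^ s * Ψ ≤ M
      k^sΨ≤M = begin
        k ^ s * (k * k * (s + 1 + j * (s + 2)))     ≡⟨ solve 3 (λ q k x → q :* (k :* k :* x) := k :* (k :* q) :* x) refl (k ^ s) k (s + 1 + j * (s + 2)) ⟩
        k ^ (2 + s) * (s + 1 + j * (s + 2))         ≤⟨ ℕ.*-mono-≤ (ℕ.^-monoʳ-≤ k (ℕ.+-monoʳ-≤ 2 s≤S)) (ℕ.+-mono-≤ (ℕ.+-monoˡ-≤ 1 s≤S) (ℕ.*-monoʳ-≤ j (ℕ.+-monoˡ-≤ 2 s≤S))) ⟩
        W * (S + 1 + j * (S + 2))                   ≤⟨ ℕ.m≤m+n _ 1 ⟩
        B                                           ≤⟨ B≤M ⟩
        M                                           ∎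
        where
        open ℕ.≤-Reasoning
        open Data.Nat.Solver.+-*-Solver
      k[s+3]≤M : k * (s + 3) ≤ M
      k[s+3]≤M = ℕ.≤-trans (ℕ.*-mono-≤ (ℕ.m≤m*n k (k ^ length ps′) {{ℕ.m^n≢0 k (length ps′)}}) (ℕ.≤-trans (ℕ.m≤n+m (s + 3) Θ) Ψ-≥)) k^sΨ≤M
      ks<M : suc (k * s) ≤ M
      ks<M = ℕ.<-≤-trans (ℕ.*-monoʳ-< k (ℕ.m<m+n s (s≤s z≤n))) k[s+3]≤M
      6≤M : 6 ≤ M
      6≤M = ℕ.≤-trans (ℕ.≤-trans (ℕ.m≤m+n 6 2) (ℕ.*-mono-≤ {2} {k} {4} {s + 3} (s≤s (s≤s z≤n)) (ℕ.+-monoˡ-≤ 3 {1} {s} (s≤s z≤n)))) k[s+3]≤M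
      q≤ : q ≤ M * (M + 2)
      q≤ = ℕ.≤-pred (ℕ.≤-trans q<[1+M]² (ℕ.≤-reflexive (solve 1 (λ m → (con 1 :+ m) :* (con 1 :+ m) := con 1 :+ m :* (m :+ con 2)) refl M)))
        where open Data.Nat.Solver.+-*-Solver
      large : 3 + k * (k * k) < length (good M²≤q q≤ ks<M 6≤M)
      large = subst (_< length (good M²≤q q≤ ks<M 6≤M)) (ℕ.+-comm (k * (k * k)) 3) (many-good M²≤q q≤ ks<M 6≤M k^sΨ≤M)
      powers : ∀ a p → a ∈ good M²≤q q≤ ks<M 6≤M → p ∈ ps → (a -ᶠ p) ^ᵏ n₀ ≡ 1#
      powers a p a∈ p∈ with ∈-nth p₀ ps p∈ | ∈.∈-filter⁻ (λ a → ¬? (bad? s (v a))) {xs = others} a∈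
      ... | e , e<s , refl | a∈others , ¬bad with k ℕ.∣? v a e
      ...   | no k∤v = contradiction (e , e<s , k∤v) ¬bad
      ...   | yes (divides c v≡ck) = begin
        (a -ᶠ nth p₀ ps e) ^ᵏ n₀     ≡⟨ cong (_^ᵏ n₀) (g^v a (proj₂ (∈.∈-filter⁻ (¬? ∘ onPoint?) {xs = elems} a∈others)) e e<s) ⟨
        (g ^ᵏ v a e) ^ᵏ n₀           ≡⟨ KS.^-assocʳ g (v a e) n₀ ⟩
        g ^ᵏ (v a e * n₀)            ≡⟨ cong (g ^ᵏ_) (trans (cong (_* n₀) v≡ck) (solve 3 (λ c k n → c :* k :* n := n :* (k :* c)) refl c k n₀)) ⟩
        g ^ᵏ (n₀ * (k * c))          ≡⟨ KS.^-assocʳ g n₀ (k * c) ⟨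
        ζ ^ᵏ (k * c)                 ≡⟨ KS.^-assocʳ ζ k c ⟨
        (ζ ^ᵏ k) ^ᵏ c                ≡⟨ trans (cong (_^ᵏ c) ζ^k≡1) (KS.1^n≈1 c) ⟩
        1#                           ∎
        where
        open ≡-Reasoning
        open Data.Nat.Solver.+-*-Solver

    -- Classes modulo k-th powers and the near-linear map

    -- The class of x modulo k-th powers is identified by x^n₀.
    module Classes (k n₀ : ℕ) .{{_ : NonZero k}} .{{_ : NonZero n₀}} (q≡1+kn₀ : q ≡ suc (k * n₀)) where
      q-1≡kn₀ : q-1 ≡ k * n₀
      q-1≡kn₀ = ℕ.suc-injective (trans (sym q≡) q≡1+kn₀)

      log : F → ℕ
      log x with x ≟ᶠ 0#
      ... | yes _ = 0
      ... | no x≢0 = proj₁ (dlog x x≢0)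

      g^log : ∀ {x} → x ≢ 0# → g ^ᵏ log x ≡ x
      g^log {x} x≢0 with x ≟ᶠ 0#
      ... | yes x≡0 = contradiction x≡0 x≢0
      ... | no x≢0′ = proj₂ (dlog x x≢0′)

      same-residue-≤ : ∀ i j m .{{_ : NonZero m}} → m ∣ k → i ≤ j → (g ^ᵏ i) ^ᵏ n₀ ≡ (g ^ᵏ j) ^ᵏ n₀ → i % m ≡ j % m
      same-residue-≤ i j m m∣k i≤j eq with ℕ.∣-trans m∣k (ℕ.*-cancelʳ-∣ n₀ (subst₂ _∣_ q-1≡kn₀ (sym (ℕ.*-distribʳ-∸ n₀ j i)) (g^n≡1⇒q-1∣n (j * n₀ ∸ i * n₀)
        (g^[j∸i]≡1 (ℕ.*-monoˡ-≤ n₀ i≤j) (trans (sym (KS.^-assocʳ g i n₀)) (trans eq (KS.^-assocʳ g j n₀)))))))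
      ... | divides t j∸i≡ = sym (trans (cong (_% m) (trans (sym (ℕ.m+[n∸m]≡n i≤j)) (cong (i +_) j∸i≡))) (ℕ.[m+kn]%n≡m%n i t m))

      same-residue : ∀ i j m .{{_ : NonZero m}} → m ∣ k → (g ^ᵏ i) ^ᵏ n₀ ≡ (g ^ᵏ j) ^ᵏ n₀ → i % m ≡ j % m
      same-residue i j m m∣k eq with ℕ.≤-total i j
      ... | inj₁ i≤j = same-residue-≤ i j m m∣k i≤j eq
      ... | inj₂ j≤i = sym (same-residue-≤ j i m m∣k j≤i (sym eq))

      log-residue : ∀ {x y} m .{{_ : NonZero m}} → m ∣ k → x ≢ 0# → y ≢ 0# → x ^ᵏ n₀ ≡ y ^ᵏ n₀ → log x % m ≡ log y % m
      log-residue {x} {y} m m∣k x≢0 y≢0 eq = same-residue (log x) (log y) m m∣k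
        (trans (cong (_^ᵏ n₀) (g^log x≢0)) (trans eq (cong (_^ᵏ n₀) (sym (g^log y≢0)))))

      log-g^ : ∀ i m .{{_ : NonZero m}} → m ∣ k → log (g ^ᵏ i) % m ≡ i % m
      log-g^ i m m∣k = same-residue (log (g ^ᵏ i)) i m m∣k (cong (_^ᵏ n₀) (g^log (^-≢0 i g≢0)))

      ζ^k≡1 : (g ^ᵏ n₀) ^ᵏ k ≡ 1#
      ζ^k≡1 = trans (KS.^-assocʳ g n₀ k) (trans (cong (g ^ᵏ_) (trans (ℕ.*-comm n₀ k) (sym q-1≡kn₀))) g^q-1≡1)

      ^n₀≡ : ∀ {x} → x ≢ 0# → x ^ᵏ n₀ ≡ (g ^ᵏ n₀) ^ᵏ (log x % k)
      ^n₀≡ {x} x≢0 = begin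
        x ^ᵏ n₀                        ≡⟨ cong (_^ᵏ n₀) (g^log x≢0) ⟨
        (g ^ᵏ log x) ^ᵏ n₀             ≡⟨ KS.^-assocʳ g (log x) n₀ ⟩
        g ^ᵏ (log x * n₀)              ≡⟨ cong (g ^ᵏ_) (ℕ.*-comm (log x) n₀) ⟩
        g ^ᵏ (n₀ * log x)              ≡⟨ KS.^-assocʳ g n₀ (log x) ⟨
        (g ^ᵏ n₀) ^ᵏ log x             ≡⟨ ^ᵏ-mod k (log x) ζ^k≡1 ⟩
        (g ^ᵏ n₀) ^ᵏ (log x % k)       ∎
        where open ≡-Reasoning

      injective⇒perm : (f : F → F) → (∀ x y → f x ≡ f y → x ≡ y) → IsPerm FF f
      injective⇒perm f inj = inj , λ y → preimage y (Fin.any? λ i → f (from i) ≟ᶠ y)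
        where
        preimage : ∀ y → Dec (∃ λ i → f (from i) ≡ y) → ∃ λ x → f x ≡ y
        preimage y (yes (i , eq)) = from i , eq
        preimage y (no ∄) = contradiction (Fin.injective⇒≤ {f = extended} extended-injective) (ℕ.<⇒≱ ℕ.≤-refl)
          where
          extended : Fin.Fin (suc q) → Fin.Fin q
          extended Fin.zero    = to y
          extended (Fin.suc i) = to (f (from i))
          extended-injective : ∀ {i j} → extended i ≡ extended j → i ≡ j
          extended-injective {Fin.zero}  {Fin.zero}  eq = refl
          extended-injective {Fin.zero}  {Fin.suc j} eq = contradiction (j , to-injective (sym eq)) ∄
          extended-injective {Fin.suc i} {Fin.zero}  eq = contradiction (i , to-injective eq) ∄
          extended-injective {Fin.suc i} {Fin.suc j} eq = cong Fin.suc (trans (sym (Inverse.strictlyInverseˡ enum i))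
            (trans (cong to (inj _ _ (to-injective eq))) (Inverse.strictlyInverseˡ enum j)))

      -- The multiplier depends only on the class of its argument, and all multipliers lie in one
      -- class, so f multiplies every class by the same class. Equal values thus come from arguments
      -- in one class, which share their multiplier, and the multiplier cancels.
      class-perm : (f μ : F → F) → f 0# ≡ 0# → (∀ x → x ≢ 0# → f x ≡ μ x *ᶠ x) → (∀ x → x ≢ 0# → μ x ≢ 0#) →
        (∀ x y → x ≢ 0# → y ≢ 0# → x ^ᵏ n₀ ≡ y ^ᵏ n₀ → μ x ≡ μ y) →
        (∀ x y → x ≢ 0# → y ≢ 0# → μ x ^ᵏ n₀ ≡ μ y ^ᵏ n₀) → IsPerm FF f
      class-perm f μ f0 f≡ μ≢0 μ-class same-class = injective⇒perm f injective
        where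
        f≢0 : ∀ x → x ≢ 0# → f x ≢ 0#
        f≢0 x x≢0 eq = *-≢0 (μ≢0 x x≢0) x≢0 (trans (sym (f≡ x x≢0)) eq)
        injective : ∀ x y → f x ≡ f y → x ≡ y
        injective x y eq with x ≟ᶠ 0# | y ≟ᶠ 0#
        ... | yes x≡0 | yes y≡0 = trans x≡0 (sym y≡0)
        ... | yes refl | no y≢0 = contradiction (trans (sym eq) f0) (f≢0 y y≢0)
        ... | no x≢0 | yes refl = contradiction (trans eq f0) (f≢0 x x≢0)
        ... | no x≢0 | no y≢0 = *-cancelˡ (μ≢0 x x≢0) (trans μx*x≡μy*y (cong (_*ᶠ y) (sym (μ-class x y x≢0 y≢0 same-argument))))
          where
          μx*x≡μy*y : μ x *ᶠ x ≡ μ y *ᶠ y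
          μx*x≡μy*y = trans (sym (f≡ x x≢0)) (trans eq (f≡ y y≢0))
          same-argument : x ^ᵏ n₀ ≡ y ^ᵏ n₀
          same-argument = *-cancelˡ (^-≢0 n₀ (μ≢0 x x≢0)) (trans (sym (KS.^-distrib-* (μ x) x n₀)) (trans (cong (_^ᵏ n₀) μx*x≡μy*y)
            (trans (KS.^-distrib-* (μ y) y n₀) (cong (_*ᶠ y ^ᵏ n₀) (same-class y x y≢0 x≢0)))))

      0^n₀ : 0# ^ᵏ n₀ ≡ 0#
      0^n₀ = trans (cong (0# ^ᵏ_) (sym (ℕ.suc-pred n₀))) (K.zeroˡ _)

      ≡1⇒≢0 : ∀ {x} → x ^ᵏ n₀ ≡ 1# → x ≢ 0#
      ≡1⇒≢0 eq refl = 0≢1 (trans (sym 0^n₀) eq)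

      record Twins (a b : F) : Set where
        field
          a≢b : a ≢ b
          a≢0 : a ≢ 0#
          b≢0 : b ≢ 0#
          a≢1 : a -ᶠ 1# ≢ 0#
          b≢1 : b -ᶠ 1# ≢ 0#
          a≢-1 : a +ᶠ 1# ≢ 0#
          b≢-1 : b +ᶠ 1# ≢ 0#
          class₀ : a ^ᵏ n₀ ≡ b ^ᵏ n₀
          class₁ : (a -ᶠ 1#) ^ᵏ n₀ ≡ (b -ᶠ 1#) ^ᵏ n₀
          class₋₁ : (a +ᶠ 1#) ^ᵏ n₀ ≡ (b +ᶠ 1#) ^ᵏ n₀

      private
        residue : F → ℕ
        residue x = log x % k

        residue< : ∀ x → residue x < k
        residue< x = ℕ.m%n<n (log x) k

        -- The elements 0, 1, -1, at which a multiplier or one of its shifts is zero, receive a code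
        -- each. Two different elements with equal codes are therefore never exceptional and agree
        -- in all three classes.
        data Code (a : F) : ℕ → Set where
          at0  : a ≡ 0# → Code a 0
          at1  : a -ᶠ 1# ≡ 0# → Code a 1
          at-1 : a +ᶠ 1# ≡ 0# → Code a 2
          else : ∀ {m} → a ≢ 0# → a -ᶠ 1# ≢ 0# → a +ᶠ 1# ≢ 0# →
            m ≡ residue a * (k * k) + (residue (a -ᶠ 1#) * k + residue (a +ᶠ 1#)) → Code a (3 + m)

        code : ∀ a → ∃ λ n → n < 3 + k * (k * k) × Code a n
        code a with a ≟ᶠ 0# | (a -ᶠ 1#) ≟ᶠ 0# | (a +ᶠ 1#) ≟ᶠ 0#
        ... | yes e | _     | _     = 0 , s≤s z≤n , at0 e
        ... | no _  | yes e | _     = 1 , s≤s (s≤s z≤n) , at1 e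
        ... | no _  | no _  | yes e = 2 , s≤s (s≤s (s≤s z≤n)) , at-1 e
        ... | no e  | no e′ | no e″ = _ , ℕ.+-monoʳ-< 3 (DivMod.i*n+j< (residue< a) (DivMod.i*n+j< (residue< (a -ᶠ 1#)) (residue< (a +ᶠ 1#)))) , else e e′ e″ refl

        pair-injective : ∀ n .{{_ : NonZero n}} {i j i′ j′} → j < n → j′ < n → i * n + j ≡ i′ * n + j′ → i ≡ i′ × j ≡ j′
        pair-injective n {i} {j} {i′} {j′} j<n j′<n eq =
            trans (sym (DivMod.[j+in]/n≡i i j n j<n)) (trans (cong (_/ n) eq) (DivMod.[j+in]/n≡i i′ j′ n j′<n))
          , trans (sym (DivMod.[j+in]%n≡j i j n j<n)) (trans (cong (_% n) eq) (DivMod.[j+in]%n≡j i′ j′ n j′<n))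

        same-class : ∀ {x y} → x ≢ 0# → y ≢ 0# → residue x ≡ residue y → x ^ᵏ n₀ ≡ y ^ᵏ n₀
        same-class x≢0 y≢0 eq = trans (^n₀≡ x≢0) (trans (cong ((g ^ᵏ n₀) ^ᵏ_) eq) (sym (^n₀≡ y≢0)))

        decode : ∀ {a b n} → a ≢ b → Code a n → Code b n → Twins a b
        decode a≢b (at0 e)  (at0 e′)  = contradiction (trans e (sym e′)) a≢b
        decode a≢b (at1 e)  (at1 e′)  = contradiction (trans (-‿≡0 e) (sym (-‿≡0 e′))) a≢b
        decode a≢b (at-1 e) (at-1 e′) = contradiction (KP.+-cancelʳ 1# _ _ (trans e (sym e′))) a≢b
        decode {a} {b} a≢b (else a0 a1 a-1 eq) (else b0 b1 b-1 eq′) = record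
          { a≢b = a≢b ; a≢0 = a0 ; b≢0 = b0 ; a≢1 = a1 ; b≢1 = b1 ; a≢-1 = a-1 ; b≢-1 = b-1
          ; class₀ = same-class a0 b0 (proj₁ outer)
          ; class₁ = same-class a1 b1 (proj₁ inner)
          ; class₋₁ = same-class a-1 b-1 (proj₂ inner) }
          where
          instance
            k*k-nonZero : NonZero (k * k)
            k*k-nonZero = ℕ.m*n≢0 k k
          outer : residue a ≡ residue b × residue (a -ᶠ 1#) * k + residue (a +ᶠ 1#) ≡ residue (b -ᶠ 1#) * k + residue (b +ᶠ 1#)
          outer = pair-injective (k * k) (DivMod.i*n+j< (residue< _) (residue< _)) (DivMod.i*n+j< (residue< _) (residue< _)) (trans (sym eq) eq′)
          inner : residue (a -ᶠ 1#) ≡ residue (b -ᶠ 1#) × residue (a +ᶠ 1#) ≡ residue (b +ᶠ 1#)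
          inner = pair-injective k (residue< _) (residue< _) (proj₂ outer)

      twins : ∀ as → Unique as → 3 + k * (k * k) < length as → ∃ λ a → ∃ λ b → a ∈ as × b ∈ as × Twins a b
      twins as u ν<n with list-pigeonhole as u (3 + k * (k * k)) ν<n (proj₁ ∘ code) (proj₁ ∘ proj₂ ∘ code)
      ... | a , b , a∈ , b∈ , a≢b , eq = a , b , a∈ , b∈ , decode a≢b (proj₂ (proj₂ (code a))) (subst (Code b) (sym eq) (proj₂ (proj₂ (code b))))

      module NearLinearMap (c : ℕ) .{{_ : NonZero c}} (c∣k : c ∣ k) (a₀ a₁ : F) (a₀a₁ : Twins a₀ a₁) where
        open Twins a₀a₁

        α : ℕ → F
        α zero    = a₀
        α (suc _) = a₁

        -- log 0 is junk, but it is multiplied by 0.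
        φ : F → F
        φ x = α (log x % c) *ᶠ x

        φ0 : φ 0# ≡ 0#
        φ0 = K.zeroʳ _

        φ-cyclotomic : CyclotomicWith FF g c (α ∘ Fin.toℕ) φ
        φ-cyclotomic = φ0 , λ i m → cong (λ j → α j *ᶠ g ^ᶠ (Fin.toℕ i + m * c)) (begin
          log (g ^ᶠ (Fin.toℕ i + m * c)) % c     ≡⟨ cong (λ x → log x % c) (^ᶠ≡^ᵏ g (Fin.toℕ i + m * c)) ⟩
          log (g ^ᵏ (Fin.toℕ i + m * c)) % c     ≡⟨ log-g^ (Fin.toℕ i + m * c) c c∣k ⟩
          (Fin.toℕ i + m * c) % c                ≡⟨ ℕ.[m+kn]%n≡m%n (Fin.toℕ i) m c ⟩
          Fin.toℕ i % c                          ≡⟨ ℕ.m<n⇒m%n≡m (Fin.toℕ<n i) ⟩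
          Fin.toℕ i                              ∎)
          where open ≡-Reasoning

        α-class : ∀ x y → x ≢ 0# → y ≢ 0# → x ^ᵏ n₀ ≡ y ^ᵏ n₀ → α (log x % c) ≡ α (log y % c)
        α-class x y x≢0 y≢0 eq = cong α (log-residue c c∣k x≢0 y≢0 eq)

        α-same : (f : F → F) → f a₀ ^ᵏ n₀ ≡ f a₁ ^ᵏ n₀ → ∀ i j → f (α i) ^ᵏ n₀ ≡ f (α j) ^ᵏ n₀
        α-same f eq zero    zero    = refl
        α-same f eq zero    (suc _) = eq
        α-same f eq (suc _) zero    = sym eq
        α-same f eq (suc _) (suc _) = refl

        α-all : (P : F → Set) → P a₀ → P a₁ → ∀ i → P (α i)
        α-all P p₀ p₁ zero    = p₀
        α-all P p₀ p₁ (suc _) = p₁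

        shifted-perm : (f shift : F → F) → f 0# ≡ 0# → (∀ x → f x ≡ shift (α (log x % c)) *ᶠ x) →
          shift a₀ ≢ 0# → shift a₁ ≢ 0# → shift a₀ ^ᵏ n₀ ≡ shift a₁ ^ᵏ n₀ → IsPerm FF f
        shifted-perm f shift f0 f≡ ≢0₀ ≢0₁ eq = class-perm f (λ x → shift (α (log x % c))) f0 (λ x _ → f≡ x)
          (λ x _ → α-all (λ a → shift a ≢ 0#) ≢0₀ ≢0₁ (log x % c)) (λ x y x≢0 y≢0 e → cong shift (α-class x y x≢0 y≢0 e))
          (λ x y _ _ → α-same shift eq (log x % c) (log y % c))

        φ-strong : IsStrongOrthomorphism FF φ
        φ-strong =
          ( shifted-perm φ (λ a → a) φ0 (λ _ → refl) a≢0 b≢0 class₀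
          , shifted-perm (λ x → φ x -ᶠ x) (_-ᶠ 1#) (trans (cong (_-ᶠ 0#) φ0) (K.-‿inverseʳ 0#)) minus a≢1 b≢1 class₁ )
          , shifted-perm (λ x → φ x +ᶠ x) (_+ᶠ 1#) (trans (K.+-identityʳ _) φ0) plus a≢-1 b≢-1 class₋₁
          where
          minus : ∀ x → φ x -ᶠ x ≡ (α (log x % c) -ᶠ 1#) *ᶠ x
          minus x = sym (trans (K.distribʳ x (α (log x % c)) (-ᶠ 1#)) (cong (φ x +ᶠ_) (KP.-1*x≈-x x)))
          plus : ∀ x → φ x +ᶠ x ≡ (α (log x % c) +ᶠ 1#) *ᶠ x
          plus x = sym (trans (K.distribʳ x (α (log x % c)) 1#) (cong (φ x +ᶠ_) (K.*-identityˡ x)))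

        φ-nearLinear : NearLinear FF g c φ
        φ-nearLinear = α ∘ Fin.toℕ , φ-cyclotomic , constant , λ i j i≡0 j≢0 eq → distinct (Fin.toℕ i) (Fin.toℕ j) i≡0 j≢0 eq
          where
          constant : ∀ (i j : Fin.Fin c) → Fin.toℕ i ≢ 0 → Fin.toℕ j ≢ 0 → α (Fin.toℕ i) ≡ α (Fin.toℕ j)
          constant i j i≢0 j≢0 with Fin.toℕ i | Fin.toℕ j
          ... | zero  | _     = contradiction refl i≢0
          ... | suc _ | zero  = contradiction refl j≢0
          ... | suc _ | suc _ = refl
          distinct : ∀ i j → i ≡ 0 → j ≢ 0 → α i ≢ α j
          distinct zero zero    _ j≢0 = contradiction refl j≢0
          distinct zero (suc j) _ _   = a≢b

        -- An index l < c would force equal multipliers at g^0 and g^l, but their exponents leave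
        -- the remainders 0 and l modulo c, with multipliers `a₀` and `a₁`.
        φ-InD : InD FF g c φ
        φ-InD = (proj₁ φ-strong , α ∘ Fin.toℕ , φ-cyclotomic) , smaller
          where
          φ-at : ∀ i → i < c → φ (g ^ᶠ i) ≡ α i *ᶠ g ^ᶠ i
          φ-at i i<c = subst (λ n → φ (g ^ᶠ n) ≡ α i *ᶠ g ^ᶠ n) (trans (ℕ.+-identityʳ _) (Fin.toℕ-fromℕ< i<c))
            (trans (proj₂ φ-cyclotomic (Fin.fromℕ< i<c) 0) (cong (λ n → α n *ᶠ g ^ᶠ (Fin.toℕ (Fin.fromℕ< i<c) + 0)) (Fin.toℕ-fromℕ< i<c)))
          smaller : ∀ l → 0 < l → l < c → l ∣ (q ∸ 1) → ¬ InC FF g l φ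
          smaller (suc l) _ l<c _ (_ , a , _ , cyc) = a≢b (trans (first 0 0 refl (ℕ.<-trans (s≤s z≤n) l<c)) (sym (first (suc l) 1 (ℕ.+-identityʳ (suc l)) l<c)))
            where
            first : ∀ i m → m * suc l ≡ i → i < c → α i ≡ a Fin.zero
            first i m eq i<c = *-cancelˡ (subst (_≢ 0#) (sym (^ᶠ≡^ᵏ g i)) (^-≢0 i g≢0)) (trans (K.*-comm _ _) (trans (sym (φ-at i i<c))
              (trans (subst (λ n → φ (g ^ᶠ n) ≡ a Fin.zero *ᶠ g ^ᶠ n) eq (cyc Fin.zero m)) (K.*-comm _ _))))

        -- Both c and `b` divide k, so the multiplier of φ - θ depends only on the class modulo k-th
        -- powers. It is always some a - e, with a one of the twins and e a multiplier of θ; all of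
        -- these are k-th powers, so they lie in a single class.
        φ-orthogonal : ∀ b .{{_ : NonZero b}} → b ∣ k → ∀ θ (e : Fin.Fin b → F) → CyclotomicWith FF g b e θ →
          (∀ j → (a₀ -ᶠ e j) ^ᵏ n₀ ≡ 1#) → (∀ j → (a₁ -ᶠ e j) ^ᵏ n₀ ≡ 1#) → Orthogonal FF φ θ
        φ-orthogonal b b∣k θ e (θ0 , cyc) p₀ p₁ = class-perm (λ x → φ x -ᶠ θ x) μ
          (trans (cong₂ _-ᶠ_ φ0 θ0) (K.-‿inverseʳ 0#)) φ-θ (λ x _ → ≡1⇒≢0 (μ-power x))
          (λ x y x≢0 y≢0 eq → cong₂ _-ᶠ_ (α-class x y x≢0 y≢0 eq) (cong e (Fin.fromℕ<-cong _ _ (log-residue b b∣k x≢0 y≢0 eq) _ _)))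
          (λ x y _ _ → trans (μ-power x) (sym (μ-power y)))
          where
          index : F → Fin.Fin b
          index x = Fin.fromℕ< (ℕ.m%n<n (log x) b)
          μ : F → F
          μ x = α (log x % c) -ᶠ e (index x)
          μ-power : ∀ x → μ x ^ᵏ n₀ ≡ 1#
          μ-power x = α-all (λ a → (a -ᶠ e (index x)) ^ᵏ n₀ ≡ 1#) (p₀ (index x)) (p₁ (index x)) (log x % c)
          θ≡ : ∀ x → x ≢ 0# → θ x ≡ e (index x) *ᶠ x
          θ≡ x x≢0 = subst (λ z → θ z ≡ e (index x) *ᶠ z) (trans (^ᶠ≡^ᵏ g (Fin.toℕ (index x) + log x / b * b)) (trans (cong (g ^ᵏ_)
            (trans (cong (_+ log x / b * b) (Fin.toℕ-fromℕ< (ℕ.m%n<n (log x) b))) (sym (ℕ.m≡m%n+[m/n]*n (log x) b)))) (g^log x≢0))) (cyc (index x) (log x / b))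
          φ-θ : ∀ x → x ≢ 0# → φ x -ᶠ θ x ≡ μ x *ᶠ x
          φ-θ x x≢0 = trans (cong (λ z → φ x -ᶠ z) (θ≡ x x≢0)) (trans (cong (φ x +ᶠ_) (KP.-‿distribˡ-* _ x)) (sym (K.distribʳ x _ _)))

theorem4p5 : (n : ℕ) (b : Fin n → ℕ) (c : ℕ) →
    (∀ i → 0 < b i) → 0 < c →
    (q₀ : ℕ) → 0 < q₀ → BoundHolds (3 + sumF n b) (lcmF n b c) q₀ →
    (∀ m → 0 < m → m < q₀ → ¬ BoundHolds (3 + sumF n b) (lcmF n b c) m) →
    (F : FiniteField) → (g : FiniteField.Carrier F) → IsGenerator F g →
    lcmF n b c ∣ (FiniteField.size F ∸ 1) → q₀ ≤ FiniteField.size F →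
    (θ : Fin n → FiniteField.Carrier F → FiniteField.Carrier F) →
    (∀ i → InC F g (b i) (θ i)) →
    ∃ λ (φ : FiniteField.Carrier F → FiniteField.Carrier F) →
      IsStrongOrthomorphism F φ × InD F g c φ × NearLinear F g c φ ×
      (∀ i → Orthogonal F φ (θ i))
theorem4p5 n b c 0<b 0<c q₀ 0<q₀ bound _ FF g gen (divides n₀ q-1≡n₀k) q₀≤q θ inC =
  let as , as-unique , large , powers = power-list k n₀ (sumF n b) q₀ (lcmF-≢0 n b c 0<b 0<c) q≡1+kn₀ bound q₀≤q
        -- The points must be distinct for the linear factors 1 - δₑx to have distinct roots.
        (deduplicate _≟ᶠ_ es) (Dedup.deduplicate-! es)
        (ℕ.≤-trans (List.length-deduplicate _≟ᶠ_ es) (ℕ.≤-reflexive (length-multipliers n b e)))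
      a₀ , a₁ , a₀∈ , a₁∈ , a₀a₁ = twins as as-unique large
      open NearLinearMap c (lcmF-∣ᶜ n b c) a₀ a₁ a₀a₁
      e∈ = λ i j → ∈.∈-deduplicate⁺ _≟ᶠ_ (∈-multipliers n b e i j)
  in φ , φ-strong , φ-InD , φ-nearLinear , λ i → φ-orthogonal (b i) {{>-nonZero (0<b i)}} (lcmF-∣ n b c i) (θ i) (e i) (proj₂ (proj₂ (inC i)))
      (λ j → powers a₀ (e i j) a₀∈ (e∈ i j)) (λ j → powers a₁ (e i j) a₁∈ (e∈ i j))
  where
  k : ℕ
  k = lcmF n b c
  instance
    k-nonZero : NonZero k
    k-nonZero = ≢-nonZero (lcmF-≢0 n b c 0<b 0<c)
    c-nonZero : NonZero c
    c-nonZero = >-nonZero 0<c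
  2<q : 2 < FiniteField.size FF
  2<q = ℕ.≤-trans (ℕ.≤-trans (ℕ.≤-trans (ℕ.m≤m+n 3 (sumF n b)) (ℕ.m≤m*n (3 + sumF n b) (k ^ (2 + sumF n b)) {{ℕ.m^n≢0 k (2 + sumF n b)}}))
    (ℕ.m≤m+n _ (k ^ (3 + sumF n b)))) (ℕ.≤-trans (ℕ.<⇒≤ (bound⇒T+K<m (3 + sumF n b) k q₀ bound)) q₀≤q)
  q≡1+kn₀ : FiniteField.size FF ≡ suc (k * n₀)
  q≡1+kn₀ = trans (sym (ℕ.m+[n∸m]≡n (ℕ.≤-trans (s≤s z≤n) 2<q))) (cong suc (trans q-1≡n₀k (ℕ.*-comm n₀ k)))
  instance
    n₀-nonZero : NonZero n₀
    n₀-nonZero = ≢-nonZero λ n₀≡0 → ℕ.<⇒≱ 2<q (ℕ.≤-trans (ℕ.≤-reflexive (trans q≡1+kn₀ (cong suc (trans (cong (k *_) n₀≡0) (ℕ.*-zeroʳ k))))) (s≤s z≤n))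
  open FieldTheory FF using (_≟ᶠ_)
  open FieldTheory.WithGenerator FF g gen 2<q using (power-list; module Classes)
  open Classes k n₀ q≡1+kn₀ using (twins; module NearLinearMap)
  module Dedup = Data.List.Relation.Unary.Unique.DecPropositional.Properties _≟ᶠ_
  e : ∀ i → Fin (b i) → FiniteField.Carrier FF
  e i = proj₁ (proj₂ (inC i))
  es : List (FiniteField.Carrier FF)
  es = multipliers n b e
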